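{- Let $m\ge 1$ and let $\pi_k$, $k=0,1,2,\ldots$, be $m\times m$ matrices over $\overline{K}_c$ such that $|\pi_k|\le\gamma$ for all $k$, with some constant $\gamma>0$, and $|\pi_0|<1$. Let $g$ be a continuous $\mathbf F_q$-linear function on $O$ with values in the $m\times m$ matrices over $\overline{K}_c$ that solves $\tau dg=\pi_0g$, i.e. $g(xt)-xg(t)=\pi_0g(t)$ for $t\in O$. Let $\lambda_1,\ldots,\lambda_m\in\overline{K}_c$ be the eigenvalues of $\pi_0$. If $$\lambda_i-\lambda_j^{q^k}\ne[k],\qquad i,j=1,\ldots,m;\ k=1,2,\ldots,$$ then the system $$\tau du-P(\tau)u=0,\qquad P(\tau)u=\sum_{k=0}^\infty\pi_k\tau^k(u),$$ has a matrix solution (for $t\in O$ with $|t|$ sufficiently small) of the form $$u(t)=W(g(t)),\qquad W(s)=\sum_{k=0}^\infty w_k\,s^{q^k},\qquad w_0=I_m,$$ where the $w_k$ are $m\times m$ matrices over $\overline{K}_c$, and the series for $W$ has a positive radius of convergence.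
   Context: Let $q$ be a power of a prime $p$, and let $K=\mathbf F_q((x))$ with absolute value $|t|=q^{ -N}$ for $t=\sum_{j\ge N}\xi_jx^j$, $\xi_N\ne 0$, and $|0|=0$. Let $O=\{t\in K:|t|\le 1\}$, and let $\overline{K}_c$ be the completion of an algebraic closure of $K$ with the uniquely extended absolute value. For an integer $k\ge 0$ put $[k]=x^{q^k}-x$. For a matrix $\pi=(\pi_{ij})$ over $\overline{K}_c$ put $|\pi|=\max_{i,j}|\pi_{ij}|$. The operator $\tau$ is the $q$-Frobenius, acting entrywise: $\tau^k(\pi)=(\pi_{ij}^{q^k})$; for a matrix argument $s$, the notation $s^{q^k}$ means the entrywise power $\tau^k(s)$ (not the matrix power), and $w_ks^{q^k}$ is the matrix product of $w_k$ and $\tau^k(s)$. The Carlitz derivative is $d=\sqrt[q]{\ }\circ\Delta$, where $(\Delta u)(t)=u(xt)-xu(t)$ (the $q$-th root taken entrywise), so that $\tau d=\Delta$. The matrix $I_m$ is the unit matrix. "Positive radius of convergence" means that there is $r>0$ such that the series $W(s)$ converges for all matrices $s$ with $|s|<r$. -}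

module Defs where

open import Algebra.Bundles using (CommutativeRing; RawRing)
open import Algebra.Morphism.Structures using (module RingMorphisms)
import Algebra.Definitions.RawMonoid as RawMonoidDefs
import Algebra.Definitions.RawSemiring as RawSemiringDefs
import Algebra.Properties.CommutativeMonoid.Sum as Sum
open import Data.Fin.Base using (Fin; zero; suc; toℕ; punchIn)
import Data.Fin.Properties as Fin
open import Data.Integer.Base as ℤ using (ℤ; +_; +≤+)
import Data.Integer.Properties as ℤ
open import Data.Integer.Tactic.RingSolver using (solve-∀)
open import Data.List.Base as List using (List; []; _∷_)
open import Data.List.Relation.Unary.All using (All)
open import Data.Maybe.Base using (zipWith)
open import Data.Nat.Base as ℕ using (ℕ; zero; suc; z≤n)
open import Data.Nat.Primality using (Prime)
open import Data.Product.Base using (Σ; ∃-syntax; _×_; _,_; proj₁)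
open import Data.Rational.Base as ℚ using (ℚ)
open import Data.Vec.Functional as Vector using (Vector)
import Data.Vec.Functional.Relation.Binary.Equality.Setoid as VectorEquality
open import Function.Bundles using (Inverse; _⇔_; _⟶ₛ_; _⟨$⟩_)
open import Level as Level using (_⊔_)
open import Relation.Binary.Bundles using (Setoid)
open import Relation.Binary.Construct.Add.Supremum.NonStrict ℚ._≤_ using (_≤⁺_)
open import Relation.Binary.Construct.Add.Supremum.Strict ℚ._<_ using (_<⁺_)
open import Relation.Binary.PropositionalEquality as ≡ using (_≡_)
open import Relation.Nullary.Construct.Add.Supremum using (_⁺; [_]; ⊤⁺)
open import Relation.Nullary.Decidable.Core using (yes; no)
open import Relation.Nullary.Negation.Core using (¬_; contradiction)

IsPrimePower : ℕ → Set
IsPrimePower q = ∃[ p ] ∃[ e ] Prime p × 1 ℕ.≤ e × q ≡ p ℕ.^ e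

record Field c ℓ : Set (Level.suc (c ⊔ ℓ)) where
  field
    commutativeRing : CommutativeRing c ℓ
  open CommutativeRing commutativeRing public
  field
    1≉0     : ¬ (1# ≈ 0#)
    inverse : ∀ a → ¬ (a ≈ 0#) → ∃[ b ] a * b ≈ 1#

record FiniteField (q : ℕ) c ℓ : Set (Level.suc (c ⊔ ℓ)) where
  field
    field′      : Field c ℓ
    enumeration : Inverse (Field.setoid field′) (≡.setoid (Fin q))

-- A monic polynomial c₀ + c₁X + … + cₙ₋₁Xⁿ⁻¹ + Xⁿ is given by its list of
-- lower coefficients, so it is nonconstant exactly when the list is non-empty.
module _ {c ℓ} (R : RawRing c ℓ) where
  open RawRing R

  evalMonic : List Carrier → Carrier → Carrier
  evalMonic cs a = List.foldr (λ c r → c + a * r) 1# cs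

module Polynomial {c ℓ} (R : RawRing c ℓ) where
  open RawRing R

  -- Coefficients in increasing degree; trailing zeros are allowed.
  Poly : Set c
  Poly = List Carrier

  coeff : Poly → ℕ → Carrier
  coeff []      _       = 0#
  coeff (a ∷ _) zero    = a
  coeff (_ ∷ f) (suc n) = coeff f n

  _+ₚ_ : Poly → Poly → Poly
  []      +ₚ g       = g
  (a ∷ f) +ₚ []      = a ∷ f
  (a ∷ f) +ₚ (b ∷ g) = (a + b) ∷ (f +ₚ g)

  _*ₚ_ : Poly → Poly → Poly
  []      *ₚ g = []
  (a ∷ f) *ₚ g = List.map (a *_) g +ₚ (0# ∷ (f *ₚ g))

  const : Carrier → Poly
  const a = a ∷ []

  X : Poly
  X = 0# ∷ 1# ∷ []

  polyRing : RawRing c ℓ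
  polyRing = record
    { Carrier = Poly
    ; _≈_     = λ f g → ∀ n → coeff f n ≈ coeff g n
    ; _+_     = _+ₚ_
    ; _*_     = _*ₚ_
    ; -_      = List.map -_
    ; 0#      = []
    ; 1#      = const 1#
    }

module Matrix {c ℓ} (R : RawRing c ℓ) where
  open RawRing R
  open RawMonoidDefs +-rawMonoid using (sum)
  open RawSemiringDefs rawSemiring using (_^_)

  Mat : ℕ → Set c
  Mat m = Vector (Vector Carrier m) m

  module _ {m : ℕ} where
    infix  4 _≈ᴹ_
    infixl 6 _+ᴹ_ _-ᴹ_
    infixl 7 _*ᴹ_ _·ᴹ_

    _≈ᴹ_ : Mat m → Mat m → Set ℓ
    A ≈ᴹ B = ∀ i j → A i j ≈ B i j

    _+ᴹ_ _-ᴹ_ _*ᴹ_ : Mat m → Mat m → Mat m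
    (A +ᴹ B) i j = A i j + B i j
    (A -ᴹ B) i j = A i j + - B i j
    (A *ᴹ B) i j = sum λ k → A i k * B k j

    _·ᴹ_ : Carrier → Mat m → Mat m
    (a ·ᴹ B) i j = a * B i j

    Iᴹ : Mat m
    Iᴹ i j with i Fin.≟ j
    ... | yes _ = 1#
    ... | no  _ = 0#

  minor : ∀ {m} → Fin (suc m) → Mat (suc m) → Mat m
  minor j A i k = A (suc i) (punchIn j k)

  det : ∀ {m} → Mat m → Carrier
  det {zero}  A = 1#
  det {suc m} A = sum λ j → (- 1#) ^ toℕ j * (A zero j * det (minor j A))

-- Each eigenvalue is listed as often as its algebraic multiplicity:
-- det (X·I - A) = ∏ᵢ (X - λᵢ) as polynomials.
module _ {c ℓ} (R : RawRing c ℓ) where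
  open RawRing R using (Carrier)
  open Polynomial R
  open Matrix R using (Mat)
  open Matrix polyRing using (det; _·ᴹ_; _-ᴹ_; Iᴹ)
  open RawRing polyRing using (_≈_; _+_; -_; *-rawMonoid)
  open RawMonoidDefs *-rawMonoid using () renaming (sum to product)

  charPoly : ∀ {m} → Mat m → Poly
  charPoly A = det (X ·ᴹ Iᴹ -ᴹ (λ i j → const (A i j)))

  AreEigenvalues : ∀ {m} → Mat m → Vector Carrier m → Set ℓ
  AreEigenvalues A λs = charPoly A ≈ product (λ i → X + - const (λs i))

-- K = F((x)).
module LaurentSeries {c ℓ} (F : Field c ℓ) where
  open Field F
  open Sum +-commutativeMonoid using (sum; sum-cong-≋; sum-replicate-zero)

  VanishesBelow : ℤ → (ℤ → Carrier) → Set ℓ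
  VanishesBelow N f = ∀ j → j ℤ.< N → f j ≈ 0#

  -- `bound` need not be the exact order, and equality ignores it.
  record Laurent : Set (c ⊔ ℓ) where
    constructor laurent
    field
      coeff    : ℤ → Carrier
      bound    : ℤ
      vanishes : VanishesBelow bound coeff
  open Laurent public

  infix 4 _≈ₗ_
  _≈ₗ_ : Laurent → Laurent → Set ℓ
  s ≈ₗ t = ∀ j → coeff s j ≈ coeff t j

  -- ∣t∣ ≤ q⁻ᴺ
  Ord≥ : ℤ → Laurent → Set ℓ
  Ord≥ N t = VanishesBelow N (coeff t)

  +-vanishes : ∀ {N f g} → VanishesBelow N f → VanishesBelow N g →
               VanishesBelow N (λ j → f j + g j)
  +-vanishes f0 g0 j j<N = trans (+-cong (f0 j j<N) (g0 j j<N)) (+-identityˡ 0#)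

  infixl 6 _+ₗ_ _-ₗ_
  infixl 7 _*ₗ_
  infix  8 -ₗ_

  _+ₗ_ : Laurent → Laurent → Laurent
  s +ₗ t = laurent (λ j → coeff s j + coeff t j) (bound s ℤ.⊓ bound t)
    (+-vanishes {f = coeff s} {g = coeff t}
      (λ j j< → vanishes s j (ℤ.<-≤-trans j< (ℤ.i⊓j≤i (bound s) (bound t))))
      (λ j j< → vanishes t j (ℤ.<-≤-trans j< (ℤ.i⊓j≤j (bound s) (bound t)))))

  -ₗ_ : Laurent → Laurent
  -ₗ t = laurent (λ j → - coeff t j) (bound t)
    (λ j j< → trans (-‿cong (vanishes t j j<)) (trans (sym (+-identityˡ _)) (-‿inverseʳ 0#)))

  _-ₗ_ : Laurent → Laurent → Laurent
  s -ₗ t = s +ₗ (-ₗ t)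

  monomial : ℤ → Carrier → Laurent
  monomial N a = laurent f N f-vanishes
    where
    f : ℤ → Carrier
    f j with j ℤ.≟ N
    ... | yes _ = a
    ... | no  _ = 0#

    f-vanishes : VanishesBelow N f
    f-vanishes j j<N with j ℤ.≟ N
    ... | yes j≡N = contradiction j<N (ℤ.<-irrefl j≡N)
    ... | no  _   = refl

  constant : Carrier → Laurent
  constant = monomial (+ 0)

  x : Laurent
  x = monomial (+ 1) 1#

  -- The n-th coefficient of st is ∑ᵢ s(N+i) t(n-N-i) over 0 ≤ i ≤ n-N-M, where
  -- N and M are the bounds of s and t.  For n < N+M every summand vanishes, so
  -- taking ∣n-N-M∣ for the upper limit is harmless.
  mulCoeff : Laurent → Laurent → ℤ → Carrier
  mulCoeff s t n =
    sum {suc ℤ.∣ n ℤ.- (bound s ℤ.+ bound t) ∣} λ i →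
      coeff s (bound s ℤ.+ + toℕ i) * coeff t (n ℤ.- (bound s ℤ.+ + toℕ i))

  mulCoeff-vanishes : ∀ {M} s t → Ord≥ M t → VanishesBelow (bound s ℤ.+ M) (mulCoeff s t)
  mulCoeff-vanishes {M} s t t0 n n< =
    trans (sum-cong-≋ {L} summand≈0) (sum-replicate-zero L)
    where
    N = bound s
    L = suc ℤ.∣ n ℤ.- (N ℤ.+ bound t) ∣

    cancel : ∀ a b k → (a ℤ.+ b) ℤ.- (a ℤ.+ k) ≡ b ℤ.- k
    cancel = solve-∀

    index< : ∀ k → n ℤ.- (N ℤ.+ + k) ℤ.< M
    index< k = ℤ.<-≤-trans (ℤ.+-monoˡ-< (ℤ.- (N ℤ.+ + k)) n<)
      (≡.subst (ℤ._≤ M) (≡.sym (cancel N M (+ k))) (ℤ.i-j≤i M (+ k)))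

    summand≈0 : ∀ (i : Fin L) → coeff s (N ℤ.+ + toℕ i) * coeff t (n ℤ.- (N ℤ.+ + toℕ i)) ≈ 0#
    summand≈0 i = trans (*-congˡ (t0 _ (index< (toℕ i)))) (zeroʳ _)

  _*ₗ_ : Laurent → Laurent → Laurent
  s *ₗ t = laurent (mulCoeff s t) (bound s ℤ.+ bound t) (mulCoeff-vanishes s t (vanishes t))

  *ₗ-Ord≥ : ∀ {M} s t → (+ 0) ℤ.≤ bound s → Ord≥ M t → Ord≥ M (s *ₗ t)
  *ₗ-Ord≥ {M} s t 0≤N t0 j j<M = mulCoeff-vanishes s t t0 j
    (ℤ.<-≤-trans j<M (≡.subst (ℤ._≤ bound s ℤ.+ M) (ℤ.+-identityˡ M) (ℤ.+-monoˡ-≤ M 0≤N)))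

  laurentRing : RawRing (c ⊔ ℓ) ℓ
  laurentRing = record
    { Carrier = Laurent
    ; _≈_     = _≈ₗ_
    ; _+_     = _+ₗ_
    ; _*_     = _*ₗ_
    ; -_      = -ₗ_
    ; 0#      = constant 0#
    ; 1#      = constant 1#
    }

  -- { t ∈ K : ∣t∣ ≤ q⁻ⁿ }
  Disc : ℕ → Setoid (c ⊔ ℓ) ℓ
  Disc n = record
    { Carrier       = Σ Laurent (Ord≥ (+ n))
    ; _≈_           = λ s t → proj₁ s ≈ₗ proj₁ t
    ; isEquivalence = record
      { refl  = λ j → refl
      ; sym   = λ s≈t j → sym (s≈t j)
      ; trans = λ s≈t t≈u j → trans (s≈t j) (t≈u j)
      }
    }

  O : Setoid (c ⊔ ℓ) ℓ
  O = Disc 0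

  module _ {n : ℕ} where
    open Setoid (Disc n) using () renaming (Carrier to D)

    infixl 6 _+ᵈ_
    infixl 7 _·ᵈ_

    _+ᵈ_ : D → D → D
    (s , s0) +ᵈ (t , t0) = s +ₗ t , +-vanishes {f = coeff s} {g = coeff t} s0 t0

    _·ᵈ_ : Carrier → D → D
    a ·ᵈ (t , t0) = constant a *ₗ t , *ₗ-Ord≥ (constant a) t (+≤+ z≤n) t0

    x·_ : D → D
    x· (t , t0) = x *ₗ t , *ₗ-Ord≥ x t (+≤+ z≤n) t0

    toO : D → Setoid.Carrier O
    toO (t , t0) = t , λ j j<0 → t0 j (ℤ.<-≤-trans j<0 (+≤+ z≤n))

infixl 6 _+⁺_
infixl 7 _⊓⁺_

_+⁺_ : ℚ ⁺ → ℚ ⁺ → ℚ ⁺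
_+⁺_ = zipWith ℚ._+_

_⊓⁺_ : ℚ ⁺ → ℚ ⁺ → ℚ ⁺
⊤⁺    ⊓⁺ b     = b
[ a ] ⊓⁺ ⊤⁺    = [ a ]
[ a ] ⊓⁺ [ b ] = [ a ℚ.⊓ b ]

-- The absolute value is recorded additively, ∣a∣ = q^(- v a) with v 0 = ⊤⁺.  The
-- value group of an algebraic closure of K = F((x)), hence of its completion,
-- is q^ℚ, so v takes values in ℚ ⁺.
record CompletedAlgebraicClosure {c ℓ} (F : Field c ℓ) a b :
       Set (c ⊔ ℓ ⊔ Level.suc (a ⊔ b)) where
  private
    module F = Field F
  open LaurentSeries F
  field
    field′ : Field a b
  open Field field′ public

  field
    ι        : Laurent → Carrier
    ι-isHomo : RingMorphisms.IsRingHomomorphism laurentRing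
                 (CommutativeRing.rawRing commutativeRing) ι

    v         : Carrier → ℚ ⁺
    v-cong    : ∀ {y z} → y ≈ z → v y ≡ v z
    v≡⊤⇔≈0    : ∀ y → v y ≡ ⊤⁺ ⇔ y ≈ 0#
    v-*       : ∀ y z → v (y * z) ≡ v y +⁺ v z
    v-+       : ∀ y z → v y ⊓⁺ v z ≤⁺ v (y + z)
    v-extends : ∀ t N → Ord≥ N t → ¬ (coeff t N F.≈ F.0#) → v (ι t) ≡ [ N ℚ./ 1 ]

  Converges : (ℕ → Carrier) → Carrier → Set
  Converges y z = ∀ (r : ℚ) → ∃[ N ] ∀ n → N ℕ.≤ n → [ r ] ≤⁺ v (y n - z)

  Cauchy : (ℕ → Carrier) → Set
  Cauchy y = ∀ (r : ℚ) → ∃[ N ] ∀ m n → N ℕ.≤ m → N ℕ.≤ n → [ r ] ≤⁺ v (y m - y n)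

  private
    rawRing′ = CommutativeRing.rawRing commutativeRing

  Algebraic : Carrier → Set (c ⊔ ℓ ⊔ b)
  Algebraic y = ∃[ cs ] evalMonic rawRing′ (List.map ι cs) y ≈ 0#

  -- The elements algebraic over K form an algebraic closure of K, which is
  -- dense in the complete field under consideration.
  field
    complete            : ∀ y → Cauchy y → ∃[ z ] Converges y z
    algebraicallyClosed : ∀ d ds → All Algebraic (d ∷ ds) →
                          ∃[ y ] Algebraic y × evalMonic rawRing′ (d ∷ ds) y ≈ 0#
    dense               : ∀ y (r : ℚ) → ∃[ z ] Algebraic z × [ r ] ≤⁺ v (y - z)

module Carlitz {q c ℓ a b} (F : FiniteField q c ℓ)
               (C : CompletedAlgebraicClosure (FiniteField.field′ F) a b) where

  open LaurentSeries (FiniteField.field′ F) public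
  open CompletedAlgebraicClosure C public
    using (Carrier; _≈_; _*_; _-_; ι; v; commutativeRing; setoid)
  open CommutativeRing commutativeRing using (rawRing; +-commutativeMonoid)
  open Matrix rawRing public using (Mat; _≈ᴹ_; _+ᴹ_; _-ᴹ_; _*ᴹ_; _·ᴹ_; Iᴹ)
  open RawSemiringDefs (RawRing.rawSemiring rawRing) public using (_^_)
  open Sum +-commutativeMonoid using (sum)
  open VectorEquality using (≋-setoid)
  private
    module Fq = Field (FiniteField.field′ F)

  ⟦_⟧ : ℕ → Carrier
  ⟦ k ⟧ = ι x ^ (q ℕ.^ k) - ι x

  IsSpectrum : ∀ {m} → Mat m → Vector Carrier m → Set b
  IsSpectrum = AreEigenvalues rawRing

  module _ {m : ℕ} where

    MatSetoid : Setoid a b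
    MatSetoid = ≋-setoid (≋-setoid setoid m) m

    -- ∣A∣ = q^(- vᴹ A)
    vᴹ : Mat m → ℚ ⁺
    vᴹ A = Vector.foldr _⊓⁺_ ⊤⁺ λ i → Vector.foldr _⊓⁺_ ⊤⁺ λ j → v (A i j)

    τ^ : ℕ → Mat m → Mat m
    τ^ k A i j = A i j ^ (q ℕ.^ k)

    partialSum : (ℕ → Mat m) → ℕ → Mat m
    partialSum A n i j = sum {n} λ k → A (toℕ k) i j

    SumsTo : (ℕ → Mat m) → Mat m → Set
    SumsTo A S = ∀ (r : ℚ) → ∃[ N ] ∀ n → N ℕ.≤ n → [ r ] ≤⁺ vᴹ (partialSum A n -ᴹ S)

    -- The terms of ∑ wₖ s^(qᵏ); for fixed s this is also P(τ)s with coefficients w.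
    powerTerms : (ℕ → Mat m) → Mat m → ℕ → Mat m
    powerTerms w s k = w k *ᴹ τ^ k s

    PositiveRadius : (ℕ → Mat m) → Set a
    PositiveRadius w = ∃[ R ] ∀ s → [ R ] <⁺ vᴹ s → ∃[ S ] SumsTo (powerTerms w s) S

    Δ : ∀ {n} → Disc n ⟶ₛ MatSetoid → Setoid.Carrier (Disc n) → Mat m
    Δ u t = (u ⟨$⟩ (x· t)) -ᴹ (ι x ·ᴹ (u ⟨$⟩ t))

    -- du is the entrywise q-th root of Δu; q-th roots are unique in characteristic p.
    IsCarlitzDerivative : ∀ {n} → Disc n ⟶ₛ MatSetoid → Disc n ⟶ₛ MatSetoid → Set (c ⊔ ℓ ⊔ b)
    IsCarlitzDerivative u du = ∀ t → τ^ 1 (du ⟨$⟩ t) ≈ᴹ Δ u t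

    IsContinuous : O ⟶ₛ MatSetoid → Set (c ⊔ ℓ)
    IsContinuous g = ∀ t (r : ℚ) → ∃[ n ] ∀ s →
      Ord≥ (+ n) (proj₁ s -ₗ proj₁ t) → [ r ] ≤⁺ vᴹ ((g ⟨$⟩ s) -ᴹ (g ⟨$⟩ t))

    record IsFqLinear (g : O ⟶ₛ MatSetoid) : Set (c ⊔ ℓ ⊔ b) where
      field
        +-homo : ∀ s t → g ⟨$⟩ (s +ᵈ t) ≈ᴹ (g ⟨$⟩ s) +ᴹ (g ⟨$⟩ t)
        ·-homo : ∀ (ξ : Fq.Carrier) t → g ⟨$⟩ (ξ ·ᵈ t) ≈ᴹ ι (constant ξ) ·ᴹ (g ⟨$⟩ t)

    -- τdu = P(τ)u on the disc; the convergence of P(τ)u is part of the claim.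
    IsSolution : ∀ {n} → (ℕ → Mat m) → Disc n ⟶ₛ MatSetoid → Set (c ⊔ ℓ ⊔ a ⊔ b)
    IsSolution {n} π u = ∃[ du ] IsCarlitzDerivative {n} u du ×
      (∀ t → SumsTo (powerTerms π (u ⟨$⟩ t)) (τ^ 1 (du ⟨$⟩ t)))

{-# OPTIONS --safe #-}

-- Substituting u = ∑ wₖ τᵏ(g) turns the equation into the recursion
--   wₖ ([k] + τᵏ(π₀)) - π₀ wₖ = ∑_{1 ≤ j ≤ k} πⱼ τʲ(wₖ₋ⱼ),
-- a Sylvester equation.  By Cayley-Hamilton π₀ and τᵏ(π₀) are annihilated by ∏ (X - λᵢ)
-- and ∏ (X - λⱼ^(qᵏ)), so that the nonresonance condition makes it solvable.
-- For i = j the condition also excludes the eigenvalue -x (as -x - (-x)^(qᵏ) = [k]), so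
-- π₀ + x is invertible; since [k] → -x and τᵏ(π₀) → 0, the solution operators are bounded
-- uniformly for large k, which gives ∣wₖ∣ ≤ q^(D (qᵏ - 1)) for some constant D.
module Submission where

open import Algebra.Bundles using (CommutativeRing; RawRing; Ring)
import Algebra.Definitions.RawMonoid as RawMonoidDefs
import Algebra.Definitions.RawSemiring as RawSemiringDefs
import Algebra.Morphism.RingMonomorphism as RingMonomorphism
open import Algebra.Morphism.Structures using (module RingMorphisms)
import Algebra.Properties.CommutativeMonoid.Mult as CommutativeMonoidMult
import Algebra.Properties.CommutativeSemigroup as CommutativeSemigroupProperties
import Algebra.Properties.CommutativeSemiring.Binomial as Binomial
import Algebra.Properties.CommutativeSemiring.Exp as Exp
import Algebra.Properties.Group as GroupProperties
import Algebra.Properties.Ring as RingProperties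
import Algebra.Properties.Semiring.Mult as Mult
import Algebra.Properties.Semiring.Sum as SemiringSum
open import Data.Fin.Base using (Fin; zero; suc; toℕ; fromℕ; inject₁; punchIn; punchOut)
import Data.Fin.Permutation as Permutation
import Data.Fin.Properties as Fin
open import Data.Integer.Base as ℤ using (+_; -[1+_])
import Data.Integer.Properties as ℤ
import Data.List.Base as List
import Data.List.Relation.Unary.All as All
open import Data.Maybe.Base using (just; nothing)
open import Data.Nat.Base as ℕ using (ℕ; zero; suc; _!)
import Data.Nat.Combinatorics as ℕ
open import Data.Nat.Divisibility as ℕ using (_∣_; divides; ∣1⇒≡1; ∣⇒≤; m∣m*n)
import Data.Nat.DivMod as ℕ
open import Data.Nat.Primality using (Prime; euclidsLemma; prime⇒nonTrivial)
import Data.Nat.Properties as ℕ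
open import Data.Product.Base using (_×_; _,_; proj₁; proj₂; ∃-syntax)
open import Data.Rational.Base as ℚ using (ℚ; 0ℚ; 1ℚ; mkℚ; toℚᵘ)
import Data.Rational.Properties as ℚ
open import Data.Rational.Solver using (module +-*-Solver)
open import Data.Rational.Unnormalised.Base as ℚᵘ using (mkℚᵘ; *≡*; *≤*)
import Data.Rational.Unnormalised.Properties as ℚᵘ
open import Data.Sum.Base using (_⊎_; inj₁; inj₂)
open import Data.Vec.Functional as Vector using (Vector; removeAt; tail)
open import Function.Base using (_∘_; id)
open import Function.Bundles using (Equivalence; Func; Inverse; _⟶ₛ_; _⟨$⟩_)
open import Level using (_⊔_)
open import Relation.Binary.Bundles using (Setoid)
open import Relation.Binary.Construct.Add.Supremum.NonStrict ℚ._≤_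
  using (_≤⁺_; [_]; _≤⊤⁺; ≤⁺-trans; [≤]-injective)
open import Relation.Binary.Construct.Add.Supremum.Strict ℚ._<_ using (_<⁺_; [_]; [_]<⊤⁺)
open import Relation.Binary.PropositionalEquality as ≡ using (_≡_)
import Relation.Binary.Reasoning.Setoid as SetoidReasoning
open import Relation.Nullary.Construct.Add.Supremum using (_⁺; [_]; ⊤⁺; []-injective)
open import Relation.Nullary.Decidable.Core using (Dec; yes; no)
open import Relation.Nullary.Negation.Core using (¬_; contradiction)
open import Defs

-- The growth bound rests on the identity qʲ (D - q^(k-j) D) = qʲ D - qᵏ D: compared with D - qᵏ D,
-- applying τʲ with j ≥ 1 gains (qʲ - 1) D ≥ D in valuation, and this pays for the fixed loss caused
-- by the resolvent and by πⱼ. The Sylvester solver itself controls no sizes, so the estimate is a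
-- posteriori: for large k any solution satisfies w = G (w E - r) with E tiny, and its valuation
-- cannot be lower than this relation permits. No triangular form is chosen for π₀. All the linear
-- algebra uses only that a product of linear factors annihilates a matrix: a division that is
-- correct modulo each factor is corrected factor by factor. The double series in P(τ)u is handled
-- through finite sums. The n-th partial sum of Δu equals exactly the sum over j < n of πⱼ τʲ
-- applied to the partial sum of u of length n - j; replacing each of these by u costs an error that
-- tends to 0 uniformly in j, because τʲ raises the remainder to the power qʲ.

open CommutativeMonoidMult ℚ.+-0-commutativeMonoid using (×-assocˡ; ×-distrib-+) renaming (_×_ to _·_)

-- Matrices over a commutative ring.

module MatrixRing {c ℓ} (R : CommutativeRing c ℓ) where
  open CommutativeRing R hiding (zero)
  open Matrix rawRing public
  open SemiringSum semiring
  open RingProperties ring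
  open CommutativeSemigroupProperties *-commutativeSemigroup using (x∙yz≈y∙xz)
  open SetoidReasoning setoid

  sum-zero : ∀ {n} {f : Vector Carrier n} → (∀ k → f k ≈ 0#) → sum f ≈ 0#
  sum-zero {n} f≈0 = trans (sum-cong-≋ f≈0) (sum-replicate-zero n)

  -- `sum-cong-≋` with the summands explicit: they cannot be inferred from sums
  -- over Fin (suc n), which Agda unfolds.
  sum-cong : ∀ {n} (f g : Vector Carrier n) → (∀ k → f k ≈ g k) → sum f ≈ sum g
  sum-cong f g = sum-cong-≋

  sum-single : ∀ {n} (f : Vector Carrier n) i →
               (∀ k → ¬ (k ≡ i) → f k ≈ 0#) → sum f ≈ f i
  sum-single f zero    f≈0 =
    trans (+-congˡ (sum-zero λ k → f≈0 (suc k) λ ())) (+-identityʳ _)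
  sum-single f (suc i) f≈0 =
    trans (+-cong (f≈0 zero λ ())
                  (sum-single (f ∘ suc) i λ k k≢i → f≈0 (suc k) (k≢i ∘ Fin.suc-injective)))
          (+-identityˡ _)

  sum-neg : ∀ {n} (f : Vector Carrier n) → sum (λ k → - f k) ≈ - sum f
  sum-neg f = begin
    sum (λ k → - f k)        ≈⟨ sum-cong-≋ (λ k → sym (-1*x≈-x (f k))) ⟩
    sum (λ k → - 1# * f k)   ≈⟨ *-distribˡ-sum (- 1#) f ⟨
    - 1# * sum f             ≈⟨ -1*x≈-x _ ⟩
    - sum f                  ∎

  Iᴹ-diagonal : ∀ {m} (i : Fin m) → Iᴹ i i ≈ 1#
  Iᴹ-diagonal i with i Fin.≟ i
  ... | yes _  = refl
  ... | no i≢i = contradiction ≡.refl i≢i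

  Iᴹ-offDiagonal : ∀ {m} {i j : Fin m} → ¬ (i ≡ j) → Iᴹ i j ≈ 0#
  Iᴹ-offDiagonal {i = i} {j} i≢j with i Fin.≟ j
  ... | yes i≡j = contradiction i≡j i≢j
  ... | no  _   = refl

  module _ {m : ℕ} where

    0ᴹ : Mat m
    0ᴹ _ _ = 0#

    -ᴹ_ : Mat m → Mat m
    (-ᴹ A) i j = - A i j

    *ᴹ-assoc : ∀ (A B C : Mat m) → (A *ᴹ B) *ᴹ C ≈ᴹ A *ᴹ (B *ᴹ C)
    *ᴹ-assoc A B C i j = begin
      sum (λ k → sum (λ l → A i l * B l k) * C k j)
        ≈⟨ sum-cong-≋ {m} (λ k → *-distribʳ-sum {m} (C k j) _) ⟩
      sum (λ k → sum (λ l → A i l * B l k * C k j))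
        ≈⟨ ∑-comm (λ k l → A i l * B l k * C k j) ⟩
      sum (λ l → sum (λ k → A i l * B l k * C k j))
        ≈⟨ sum-cong-≋ {m} (λ l → sum-cong-≋ {m} (λ k → *-assoc _ _ _)) ⟩
      sum (λ l → sum (λ k → A i l * (B l k * C k j)))
        ≈⟨ sum-cong-≋ {m} (λ l → *-distribˡ-sum {m} (A i l) _) ⟨
      sum (λ l → A i l * sum (λ k → B l k * C k j)) ∎

    *ᴹ-identityˡ : ∀ (A : Mat m) → Iᴹ *ᴹ A ≈ᴹ A
    *ᴹ-identityˡ A i j = trans
      (sum-single _ i λ k k≢i → trans (*-congʳ (Iᴹ-offDiagonal (k≢i ∘ ≡.sym))) (zeroˡ _))
      (trans (*-congʳ (Iᴹ-diagonal i)) (*-identityˡ _))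

    *ᴹ-identityʳ : ∀ (A : Mat m) → A *ᴹ Iᴹ ≈ᴹ A
    *ᴹ-identityʳ A i j = trans
      (sum-single _ j λ k k≢j → trans (*-congˡ (Iᴹ-offDiagonal k≢j)) (zeroʳ _))
      (trans (*-congˡ (Iᴹ-diagonal j)) (*-identityʳ _))

    ·ᴹ-*ᴹ-assoc : ∀ a (A B : Mat m) → (a ·ᴹ A) *ᴹ B ≈ᴹ a ·ᴹ (A *ᴹ B)
    ·ᴹ-*ᴹ-assoc a A B i j =
      trans (sum-cong-≋ {m} λ k → *-assoc _ _ _) (sym (*-distribˡ-sum {m} a _))

    *ᴹ-·ᴹ-comm : ∀ a (A B : Mat m) → A *ᴹ (a ·ᴹ B) ≈ᴹ a ·ᴹ (A *ᴹ B)
    *ᴹ-·ᴹ-comm a A B i j =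
      trans (sum-cong-≋ {m} λ k → x∙yz≈y∙xz _ _ _) (sym (*-distribˡ-sum {m} a _))

    scalar : Carrier → Mat m
    scalar a = a ·ᴹ Iᴹ

    scalar-*ᴹ : ∀ a (B : Mat m) → scalar a *ᴹ B ≈ᴹ a ·ᴹ B
    scalar-*ᴹ a B i j = trans (·ᴹ-*ᴹ-assoc a Iᴹ B i j) (*-congˡ (*ᴹ-identityˡ B i j))

    *ᴹ-scalar : ∀ a (B : Mat m) → B *ᴹ scalar a ≈ᴹ a ·ᴹ B
    *ᴹ-scalar a B i j = trans (*ᴹ-·ᴹ-comm a B Iᴹ i j) (*-congˡ (*ᴹ-identityʳ B i j))

    scalar-central : ∀ a (B : Mat m) → scalar a *ᴹ B ≈ᴹ B *ᴹ scalar a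
    scalar-central a B i j = trans (scalar-*ᴹ a B i j) (sym (*ᴹ-scalar a B i j))

  matrixRing : ℕ → Ring c ℓ
  matrixRing m = record
    { Carrier = Mat m
    ; _≈_     = _≈ᴹ_
    ; _+_     = _+ᴹ_
    ; _*_     = _*ᴹ_
    ; -_      = -ᴹ_
    ; 0#      = 0ᴹ
    ; 1#      = Iᴹ
    ; isRing  = record
      { +-isAbelianGroup = record
        { isGroup = record
          { isMonoid = record
            { isSemigroup = record
              { isMagma = record
                { isEquivalence = record
                  { refl  = λ i j → refl
                  ; sym   = λ p i j → sym (p i j)
                  ; trans = λ p q i j → trans (p i j) (q i j)
                  }
                ; ∙-cong = λ p q i j → +-cong (p i j) (q i j)
                }
              ; assoc = λ A B C i j → +-assoc _ _ _
              }
            ; identity = (λ A i j → +-identityˡ _) , (λ A i j → +-identityʳ _)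
            }
          ; inverse = (λ A i j → -‿inverseˡ _) , (λ A i j → -‿inverseʳ _)
          ; ⁻¹-cong = λ p i j → -‿cong (p i j)
          }
        ; comm = λ A B i j → +-comm _ _
        }
      ; *-cong     = λ p q i j → sum-cong-≋ {m} λ k → *-cong (p i k) (q k j)
      ; *-assoc    = *ᴹ-assoc
      ; *-identity = *ᴹ-identityˡ , *ᴹ-identityʳ
      ; distrib    =
          (λ A B C i j → trans (sum-cong-≋ {m} λ k → distribˡ _ _ _) (∑-distrib-+ {m} _ _))
        , (λ A B C i j → trans (sum-cong-≋ {m} λ k → distribʳ _ _ _) (∑-distrib-+ {m} _ _))
      }
    }

-- Alternating determinants and cofactors.

-- Expanding a determinant along its first two rows a and b gives
-- ∑ⱼ ∑ₗ (-1)^(j+l) aⱼ b_(punchIn j l) G(…), where G depends only on the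
-- increasing enumeration of the columns other than j and punchIn j l.
module Determinant {c ℓ} (R : CommutativeRing c ℓ) where
  open Vector using (_∷_)
  open CommutativeRing R hiding (zero)
  open MatrixRing R
  open SemiringSum semiring
  open RawSemiringDefs (RawRing.rawSemiring rawRing) using (_^_)
  open RingProperties ring
  open CommutativeSemigroupProperties *-commutativeSemigroup using (x∙yz≈y∙xz)
  open CommutativeSemigroupProperties +-commutativeSemigroup using () renaming (interchange to +-interchange)
  open SetoidReasoning setoid

  sgn : ℕ → Carrier
  sgn n = (- 1#) ^ n

  sgn-suc-* : ∀ n x → sgn (suc n) * x ≈ - (sgn n * x)
  sgn-suc-* n x = trans (*-assoc _ _ _) (-1*x≈-x _)

  sgn-sgn-* : ∀ n x → sgn n * (sgn n * x) ≈ x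
  sgn-sgn-* zero    x = trans (*-identityˡ _) (*-identityˡ _)
  sgn-sgn-* (suc n) x = begin
    sgn (suc n) * (sgn (suc n) * x)  ≈⟨ sgn-suc-* n _ ⟩
    - (sgn n * (sgn (suc n) * x))    ≈⟨ -‿cong (*-congˡ (sgn-suc-* n x)) ⟩
    - (sgn n * - (sgn n * x))        ≈⟨ -‿cong (-‿distribʳ-* _ _) ⟨
    - - (sgn n * (sgn n * x))        ≈⟨ -‿involutive _ ⟩
    sgn n * (sgn n * x)              ≈⟨ sgn-sgn-* n x ⟩
    x                                ∎

  expandRow : ∀ {n} → Vector Carrier n → Vector Carrier n → Carrier
  expandRow a g = sum λ j → sgn (toℕ j) * (a j * g j)

  expandRow-cong : ∀ {n} (a g h : Vector Carrier n) → (∀ j → g j ≈ h j) →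
                   expandRow a g ≈ expandRow a h
  expandRow-cong {n} a g h g≗h = sum-cong-≋ {n} λ j → *-congˡ (*-congˡ (g≗h j))

  expandRow-zero : ∀ {n} (a g : Vector Carrier n) → (∀ j → g j ≈ 0#) → expandRow a g ≈ 0#
  expandRow-zero {n} a g g≈0 = sum-zero {n} λ j →
    trans (*-congˡ (trans (*-congˡ (g≈0 j)) (zeroʳ _))) (zeroʳ _)

  expandRow-* : ∀ {n} x (a g : Vector Carrier n) → expandRow a (λ j → x * g j) ≈ x * expandRow a g
  expandRow-* {n} x a g = trans
    (sum-cong-≋ {n} λ j → trans (*-congˡ (x∙yz≈y∙xz _ _ _)) (x∙yz≈y∙xz _ _ _))
    (sym (*-distribˡ-sum {n} x _))

  det-cong : ∀ {m} {A B : Mat m} → A ≈ᴹ B → det A ≈ det B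
  det-cong {zero}  A≈B = refl
  det-cong {suc m} A≈B = sum-cong-≋ λ j →
    *-congˡ {sgn (toℕ j)} (*-cong (A≈B zero j) (det-cong λ i k → A≈B (suc i) (punchIn j k)))

  module TwoRows where

    Columns : ℕ → Set
    Columns n = Fin n → Fin (suc (suc n))

    -- Selections of columns are functions that get compared only pointwise, so `G` has to respect
    -- this comparison.
    Extensional : ∀ {n} → (Columns n → Carrier) → Set ℓ
    Extensional G = ∀ {h h′} → (∀ k → h k ≡ h′ k) → G h ≈ G h′

    expand : ∀ {n} (a b : Vector Carrier (suc (suc n))) → (Columns n → Carrier) → Carrier
    expand a b G = sum λ j → sgn (toℕ j) * (a j * sum λ l →
      sgn (toℕ l) * (b (punchIn j l) * G (λ k → punchIn j (punchIn l k))))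

    edge : ∀ {n} → Vector Carrier (suc (suc n)) → (Columns n → Carrier) → Carrier
    edge b G = sum λ l → sgn (toℕ l) * (b (suc l) * G (λ k → suc (punchIn l k)))

    inner : ∀ {n} (a b : Vector Carrier (suc (suc n))) → (Columns n → Carrier) → Carrier
    inner {n} a b G = sum λ j → sgn (toℕ j) * (a (suc j) * sum {n} λ l →
      sgn (toℕ l) * (b (suc (punchIn j l)) * G (λ k → punchIn (suc j) (punchIn (suc l) k))))

    -- If neither of the two rows uses column zero, that column heads the enumeration of the
    -- remaining ones.
    shift : ∀ {n} → (Columns (suc n) → Carrier) → Columns n → Carrier
    shift G h = G (zero ∷ (suc ∘ h))

    shift-extensional : ∀ {n} {G : Columns (suc n) → Carrier} → Extensional G → Extensional (shift G)
    shift-extensional ext h≗h′ = ext λ { zero → ≡.refl ; (suc k) → ≡.cong suc (h≗h′ k) }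

    -- The pairs of columns are split by the use of column zero. If row `a` takes it, `edge b` is
    -- left; if row `b` takes it, `edge a` is left with the opposite sign; if neither does, the two
    -- extra signs cancel. The first part is visibly alternating in `a` and `b`, and `inner` is the
    -- same problem in one column fewer.
    expand-step : ∀ {n} (a b : Vector Carrier (suc (suc n))) {G} → Extensional G →
                  expand a b G ≈ (a zero * edge b G - b zero * edge a G) + inner a b G
    expand-step {n} a b {G} ext = begin
      1# * (a zero * edge b G) + sum (λ j → sgn (suc (toℕ j)) * (a (suc j) * rowSum j))
        ≈⟨ +-cong (*-identityˡ _) (sum-cong-≋ split) ⟩
      a zero * edge b G + sum (λ j → - (b zero * first j) + second j)
        ≈⟨ +-congˡ (∑-distrib-+ (λ j → - (b zero * first j)) second) ⟩
      a zero * edge b G + (sum (λ j → - (b zero * first j)) + inner a b G)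
        ≈⟨ +-assoc _ _ _ ⟨
      a zero * edge b G + sum (λ j → - (b zero * first j)) + inner a b G
        ≈⟨ +-congʳ (+-congˡ (sum-neg (λ j → b zero * first j))) ⟩
      a zero * edge b G - sum (λ j → b zero * first j) + inner a b G
        ≈⟨ +-congʳ (+-congˡ (-‿cong (*-distribˡ-sum (b zero) first))) ⟨
      a zero * edge b G - b zero * edge a G + inner a b G ∎
      where
      rest : Fin (suc n) → Carrier
      rest j = sum {n} λ l →
        sgn (toℕ l) * (b (suc (punchIn j l)) * G (λ k → punchIn (suc j) (punchIn (suc l) k)))

      rowSum : Fin (suc n) → Carrier
      rowSum j = sum λ l →
        sgn (toℕ l) * (b (punchIn (suc j) l) * G (λ k → punchIn (suc j) (punchIn l k)))

      first second : Fin (suc n) → Carrier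
      first  j = sgn (toℕ j) * (a (suc j) * G (λ k → suc (punchIn j k)))
      second j = sgn (toℕ j) * (a (suc j) * rest j)

      rowSum-step : ∀ j → rowSum j ≈ b zero * G (λ k → suc (punchIn j k)) - rest j
      rowSum-step j = +-cong (*-identityˡ _)
        (trans (sum-cong-≋ {n} λ l → sgn-suc-* (toℕ l) _) (sum-neg {n} _))

      split : ∀ j → sgn (suc (toℕ j)) * (a (suc j) * rowSum j) ≈ - (b zero * first j) + second j
      split j = begin
        sgn (suc (toℕ j)) * (a (suc j) * rowSum j)
          ≈⟨ sgn-suc-* (toℕ j) _ ⟩
        - (s * (x * rowSum j))
          ≈⟨ -‿cong (*-congˡ (*-congˡ (rowSum-step j))) ⟩
        - (s * (x * (b zero * g - rest j)))
          ≈⟨ -‿cong (*-congˡ (x[y-z]≈xy-xz _ _ _)) ⟩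
        - (s * (x * (b zero * g) - x * rest j))
          ≈⟨ -‿cong (x[y-z]≈xy-xz _ _ _) ⟩
        - (s * (x * (b zero * g)) - second j)
          ≈⟨ ⁻¹-anti-homo‿- _ _ ⟩
        second j - s * (x * (b zero * g))
          ≈⟨ +-comm _ _ ⟩
        - (s * (x * (b zero * g))) + second j
          ≈⟨ +-congʳ (-‿cong (*-congˡ (x∙yz≈y∙xz _ _ _))) ⟩
        - (s * (b zero * (x * g))) + second j
          ≈⟨ +-congʳ (-‿cong (x∙yz≈y∙xz _ _ _)) ⟩
        - (b zero * first j) + second j ∎
        where
        s x g : Carrier
        s = sgn (toℕ j)
        x = a (suc j)
        g = G (λ k → suc (punchIn j k))

    inner-zero : (a b : Vector Carrier 2) (G : Columns 0 → Carrier) → inner a b G ≈ 0#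
    inner-zero a b G = sum-zero {f = λ j → sgn (toℕ j) * (a (suc j) * 0#)} λ j → trans (*-congˡ (zeroʳ _)) (zeroʳ _)

    inner-suc : ∀ {n} (a b : Vector Carrier (suc (suc (suc n)))) {G} → Extensional G →
                inner a b G ≈ expand (tail a) (tail b) (shift G)
    inner-suc a b {G} ext = expandRow-cong (tail a)
      (λ j → expandRow (λ l → tail b (punchIn j l)) (λ l → G (columns j l)))
      (λ j → expandRow (λ l → tail b (punchIn j l)) (λ l → G (columns′ j l)))
      λ j → expandRow-cong (λ l → tail b (punchIn j l))
        (λ l → G (columns j l)) (λ l → G (columns′ j l)) λ l → ext (same j l)
      where
      columns columns′ : ∀ j l → Columns _
      columns  j l k = punchIn (suc j) (punchIn (suc l) k)
      columns′ j l   = zero ∷ λ k → suc (punchIn j (punchIn l k))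

      same : ∀ j l k → columns j l k ≡ columns′ j l k
      same j l zero    = ≡.refl
      same j l (suc k) = ≡.refl

    -- Proved alongside antisymmetry and not from it: antisymmetry gives only that twice the value
    -- is zero, which says nothing in characteristic 2.
    expand-alternating : ∀ {n} (a : Vector Carrier (suc (suc n))) {G} → Extensional G →
                         expand a a G ≈ 0#
    inner-alternating : ∀ n (a : Vector Carrier (suc (suc n))) {G} → Extensional G →
                        inner a a G ≈ 0#
    expand-alternating {n} a ext = trans (expand-step a a ext)
      (trans (+-cong (-‿inverseʳ _) (inner-alternating n a ext)) (+-identityˡ _))
    inner-alternating zero    a {G} ext = inner-zero a a G
    inner-alternating (suc n) a ext =
      trans (inner-suc a a ext) (expand-alternating (tail a) (shift-extensional ext))

    expand-antisym : ∀ {n} (a b : Vector Carrier (suc (suc n))) {G} → Extensional G →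
                     expand a b G + expand b a G ≈ 0#
    inner-antisym : ∀ n (a b : Vector Carrier (suc (suc n))) {G} → Extensional G →
                    inner a b G + inner b a G ≈ 0#
    expand-antisym {n} a b {G} ext = begin
      expand a b G + expand b a G
        ≈⟨ +-cong (expand-step a b ext) (expand-step b a ext) ⟩
      (u - v + inner a b G) + (v - u + inner b a G)
        ≈⟨ +-interchange _ _ _ _ ⟩
      (u - v + (v - u)) + (inner a b G + inner b a G)
        ≈⟨ +-cong (trans (+-congˡ (sym (⁻¹-anti-homo‿- u v))) (-‿inverseʳ _))
                  (inner-antisym n a b ext) ⟩
      0# + 0#
        ≈⟨ +-identityˡ _ ⟩
      0# ∎
      where
      u v : Carrier
      u = a zero * edge b G
      v = b zero * edge a G
    inner-antisym zero    a b {G} ext =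
      trans (+-cong (inner-zero a b G) (inner-zero b a G)) (+-identityˡ _)
    inner-antisym (suc n) a b ext =
      trans (+-cong (inner-suc a b ext) (inner-suc b a ext))
            (expand-antisym (tail a) (tail b) (shift-extensional ext))

  open TwoRows

  -- With this `G`, expanding along the first two rows unfolds definitionally to `det A`, so the
  -- results on `expand` apply to determinants directly.
  lowerMinor : ∀ {m} → Mat (suc (suc m)) → Columns m → Carrier
  lowerMinor A h = det λ i k → A (suc (suc i)) (h k)

  lowerMinor-extensional : ∀ {m} (A : Mat (suc (suc m))) → Extensional (lowerMinor A)
  lowerMinor-extensional A h≗h′ =
    det-cong λ i k → reflexive (≡.cong (A (suc (suc i))) (h≗h′ k))

  swap₀₁ : ∀ {m} → Mat (suc (suc m)) → Mat (suc (suc m))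
  swap₀₁ A = A (suc zero) ∷ (A zero ∷ (λ i → A (suc (suc i))))

  det-swap₀₁ : ∀ {m} (A : Mat (suc (suc m))) → det A + det (swap₀₁ A) ≈ 0#
  det-swap₀₁ A = expand-antisym (A zero) (A (suc zero)) (lowerMinor-extensional A)

  -- Equal adjacent rows are the alternating case. Otherwise the first two rows are exchanged; every
  -- minor along the new first row then starts with the repeated row, and its copy is one place
  -- nearer.
  det-repeatedRow : ∀ {m} (A : Mat (suc m)) r → (∀ j → A zero j ≈ A (suc r) j) → det A ≈ 0#
  det-repeatedRow {suc m} A zero A₀≈A₁ = trans
    (det-cong {A = A} {B = A zero ∷ (A zero ∷ (λ i → A (suc (suc i))))} λ where
      zero          j → refl
      (suc zero)    j → sym (A₀≈A₁ j)
      (suc (suc i)) j → refl)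
    (expand-alternating (A zero) (lowerMinor-extensional A))
  det-repeatedRow {suc m} A (suc r) A₀≈Aᵣ = begin
    det A                     ≈⟨ +-identityʳ _ ⟨
    det A + 0#                ≈⟨ +-congˡ swap≈0 ⟨
    det A + det (swap₀₁ A)    ≈⟨ det-swap₀₁ A ⟩
    0#                        ∎
    where
    swap≈0 : det (swap₀₁ A) ≈ 0#
    swap≈0 = expandRow-zero (A (suc zero)) _ λ j →
      det-repeatedRow (minor j (swap₀₁ A)) r λ k → A₀≈Aᵣ (punchIn j k)

  moveToFront : ∀ {m} → Fin (suc m) → Mat (suc m) → Mat (suc m)
  moveToFront i A = A i ∷ removeAt A i

  -- Exchanging the first two rows of the result puts row zero of `A` back in front; row i has then
  -- only to be moved within the minors, where its index is smaller by one.
  det-moveToFront : ∀ {m} i (A : Mat (suc m)) → det (moveToFront i A) ≈ sgn (toℕ i) * det A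
  det-moveToFront zero A = trans
    (det-cong {A = moveToFront zero A} {B = A} λ { zero j → refl ; (suc i) j → refl }) (sym (*-identityˡ _))
  det-moveToFront {suc m} (suc i) A = begin
    det B                            ≈⟨ +-inverseˡ-unique _ _ (det-swap₀₁ B) ⟩
    - det (swap₀₁ B)                 ≈⟨ -‿cong (expandRow-cong (A zero) _ _ minor-swap) ⟩
    - expandRow (A zero) (λ j → sgn (toℕ i) * det (minor j A))
                                     ≈⟨ -‿cong (expandRow-* (sgn (toℕ i)) (A zero) (λ j → det (minor j A))) ⟩
    - (sgn (toℕ i) * det A)          ≈⟨ sgn-suc-* (toℕ i) _ ⟨
    sgn (suc (toℕ i)) * det A        ∎
    where
    B : Mat (suc (suc m))
    B = moveToFront (suc i) A

    minor-swap : ∀ j → det (minor j (swap₀₁ B)) ≈ sgn (toℕ i) * det (minor j A)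
    minor-swap j = trans
      (det-cong {A = minor j (swap₀₁ B)} {B = moveToFront i (minor j A)} λ { zero k → refl ; (suc r) k → refl })
      (det-moveToFront i (minor j A))

  -- The minor is taken after row i has been moved to the front, so the factor (-1)^i of the usual
  -- cofactor is missing; it reappears in `cofactor-diagonal`.
  cofactor : ∀ {m} → Mat (suc m) → Fin (suc m) → Vector Carrier (suc m)
  cofactor A i j = sgn (toℕ j) * det (minor j (moveToFront i A))

  expandRow-cofactor : ∀ {m} (A : Mat (suc m)) i (a : Vector Carrier (suc m)) →
                       sum (λ j → a j * cofactor A i j) ≈ det (a ∷ removeAt A i)
  expandRow-cofactor {m} A i a =
    sum-cong {suc m} (λ j → a j * cofactor A i j) _ λ j → x∙yz≈y∙xz _ _ _

  cofactor-diagonal : ∀ {m} (A : Mat (suc m)) i →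
                      sum (λ j → A i j * cofactor A i j) ≈ sgn (toℕ i) * det A
  cofactor-diagonal A i = trans (expandRow-cofactor A i (A i)) (det-moveToFront i A)

  cofactor-offDiagonal : ∀ {m} (A : Mat (suc m)) i r → ¬ (i ≡ r) →
                         sum (λ j → A r j * cofactor A i j) ≈ 0#
  cofactor-offDiagonal A i r i≢r = trans (expandRow-cofactor A i (A r))
    (det-repeatedRow (A r ∷ removeAt A i) (punchOut i≢r)
      λ j → reflexive (≡.cong (λ k → A k j) (≡.sym (Fin.punchIn-punchOut i≢r))))

-- Inverting an operator modulo the factors of an annihilating product.

module Divide {c ℓ} (M : Ring c ℓ) where
  open Ring M hiding (zero)
  open RingProperties M
  open SetoidReasoning setoid

  apply : ∀ {n} → Vector (Carrier → Carrier) n → Carrier → Carrier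
  apply {zero}  α r = r
  apply {suc n} α r = apply (tail α) (α zero r)

  apply-cong : ∀ {n} {α : Vector (Carrier → Carrier) n} →
               (∀ i {r s} → r ≈ s → α i r ≈ α i s) →
               ∀ {r s} → r ≈ s → apply α r ≈ apply α s
  apply-cong {zero}  α-cong r≈s = r≈s
  apply-cong {suc n} α-cong r≈s = apply-cong (α-cong ∘ suc) (α-cong zero r≈s)

  apply-comm : ∀ {n} {α : Vector (Carrier → Carrier) n} {ρ : Carrier → Carrier} →
               (∀ i {r s} → r ≈ s → α i r ≈ α i s) →
               (∀ i r → α i (ρ r) ≈ ρ (α i r)) →
               ∀ r → apply α (ρ r) ≈ ρ (apply α r)
  apply-comm {zero}  α-cong comm r = refl
  apply-comm {suc n} α-cong comm r =
    trans (apply-cong (α-cong ∘ suc) (comm zero r)) (apply-comm (α-cong ∘ suc) (comm ∘ suc) _)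

  -- ρᵢ inverts T up to the error αᵢ; since the composite of the αᵢ kills r, correcting
  -- by the ρᵢ in turn removes the error altogether.
  solve : ∀ {T : Carrier → Carrier} → (∀ {x y} → x ≈ y → T x ≈ T y) →
          (∀ x y → T (x + y) ≈ T x + T y) →
          ∀ {n} (α ρ : Vector (Carrier → Carrier) n) →
          (∀ i {r s} → r ≈ s → α i r ≈ α i s) → (∀ i {r s} → r ≈ s → ρ i r ≈ ρ i s) →
          (∀ i → ρ i 0# ≈ 0#) → (∀ i j r → α i (ρ j r) ≈ ρ j (α i r)) →
          (∀ i r → T (ρ i r) ≈ r + α i (ρ i r)) →
          ∀ r → apply α r ≈ 0# → ∃[ w ] T w ≈ r
  solve {T} T-cong T-+ {zero} α ρ α-cong ρ-cong ρ-0 comm step r r≈0 =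
    0# , trans (x+x≈x⇒x≈0 _ (trans (sym (T-+ 0# 0#)) (T-cong (+-identityˡ 0#)))) (sym r≈0)
  solve {T} T-cong T-+ {suc n} α ρ α-cong ρ-cong ρ-0 comm step r αr≈0 =
    ρ zero r - w , (begin
      T (ρ zero r - w)               ≈⟨ T-+ _ _ ⟩
      T (ρ zero r) + T (- w)         ≈⟨ +-cong (step zero r) T-neg ⟩
      (r + err) - err                ≈⟨ +-assoc _ _ _ ⟩
      r + (err - err)                ≈⟨ +-congˡ (-‿inverseʳ err) ⟩
      r + 0#                         ≈⟨ +-identityʳ r ⟩
      r                              ∎)
    where
    err : Carrier
    err = α zero (ρ zero r)

    err-killed : apply (tail α) err ≈ 0#
    err-killed = begin
      apply (tail α) (α zero (ρ zero r))   ≈⟨ apply-cong (α-cong ∘ suc) (comm zero zero r) ⟩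
      apply (tail α) (ρ zero (α zero r))   ≈⟨ apply-comm (α-cong ∘ suc) (λ i → comm (suc i) zero) _ ⟩
      ρ zero (apply (tail α) (α zero r))   ≈⟨ ρ-cong zero αr≈0 ⟩
      ρ zero 0#                            ≈⟨ ρ-0 zero ⟩
      0#                                   ∎

    rest : ∃[ w ] T w ≈ err
    rest = solve T-cong T-+ (tail α) (tail ρ) (α-cong ∘ suc) (ρ-cong ∘ suc) (ρ-0 ∘ suc)
      (λ i j → comm (suc i) (suc j)) (step ∘ suc) err err-killed

    w : Carrier
    w = proj₁ rest

    T-0 : T 0# ≈ 0#
    T-0 = x+x≈x⇒x≈0 _ (trans (sym (T-+ 0# 0#)) (T-cong (+-identityˡ 0#)))

    T-neg : T (- w) ≈ - err
    T-neg = +-inverseˡ-unique _ _ (begin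
      T (- w) + err     ≈⟨ +-congˡ (proj₂ rest) ⟨
      T (- w) + T w     ≈⟨ T-+ _ _ ⟨
      T (- w + w)       ≈⟨ T-cong (-‿inverseˡ w) ⟩
      T 0#              ≈⟨ T-0 ⟩
      0#                ∎)

  leftMul rightMul : ∀ {n} → Vector Carrier n → Vector (Carrier → Carrier) n
  leftMul  β i r = β i * r
  rightMul β i r = r * β i

  -- The model is γ = B - s, β j = B - μ j and t j the inverse of μ j - s: modulo β j the element γ
  -- is the scalar μ j - s, so t j inverts it up to a multiple of β j.
  rightDivide : ∀ {n} (β t : Vector Carrier n) γ →
                (∀ i j → t j * β i ≈ β i * t j) → (∀ j → t j * γ ≈ 1# + t j * β j) →
                (∀ r → apply (rightMul β) r ≈ 0#) → ∀ r → ∃[ w ] w * γ ≈ r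
  rightDivide β t γ comm step β≈0 r =
    solve *-congʳ (distribʳ γ) (rightMul β) (rightMul t) (λ i → *-congʳ) (λ i → *-congʳ)
      (λ i → zeroˡ _)
      (λ i j s → trans (*-assoc _ _ _) (trans (*-congˡ (comm i j)) (sym (*-assoc _ _ _))))
      (λ i s → begin
        s * t i * γ              ≈⟨ *-assoc _ _ _ ⟩
        s * (t i * γ)            ≈⟨ *-congˡ (step i) ⟩
        s * (1# + t i * β i)     ≈⟨ distribˡ _ _ _ ⟩
        s * 1# + s * (t i * β i) ≈⟨ +-cong (*-identityʳ s) (sym (*-assoc _ _ _)) ⟩
        s + s * t i * β i        ∎)
      r (β≈0 r)

  -- For w = s t with t a left inverse of l - b and l central, a w - w b = (a - l) w + w (l - b) =
  -- (a - l) w + s. The error is a left multiplication and the correction a right multiplication, so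
  -- they commute even though the ring does not.
  sylvester : ∀ {n} a b (l t : Vector Carrier n) → (∀ i s → l i * s ≈ s * l i) →
              (∀ i → t i * (l i - b) ≈ 1#) →
              (∀ r → apply (leftMul (λ i → a - l i)) r ≈ 0#) →
              ∀ r → ∃[ w ] a * w - w * b ≈ r
  sylvester a b l t central inv a≈0 r =
    solve (λ x≈y → +-cong (*-congˡ x≈y) (-‿cong (*-congʳ x≈y)))
      (λ x y → begin
        a * (x + y) - (x + y) * b
          ≈⟨ +-cong (distribˡ _ _ _) (trans (-‿cong (distribʳ _ _ _)) (sym (-‿+-comm _ _))) ⟩
        (a * x + a * y) + (- (x * b) - y * b)
          ≈⟨ interchange _ _ _ _ ⟩
        (a * x - x * b) + (a * y - y * b) ∎)
      (leftMul (λ i → a - l i)) (rightMul t) (λ i → *-congˡ) (λ i → *-congʳ)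
      (λ i → zeroˡ _) (λ i j s → sym (*-assoc _ _ _)) step r (a≈0 r)
    where
    open CommutativeSemigroupProperties +-commutativeSemigroup using (interchange)

    step : ∀ i s → a * (s * t i) - s * t i * b ≈ s + (a - l i) * (s * t i)
    step i s = begin
      a * u - u * b                          ≈⟨ +-congʳ (+-identityʳ _) ⟨
      a * u + 0# - u * b                     ≈⟨ +-congʳ (+-congˡ (-‿inverseˡ _)) ⟨
      a * u + (- (l i * u) + l i * u) - u * b ≈⟨ +-congʳ (+-assoc _ _ _) ⟨
      a * u - l i * u + l i * u - u * b      ≈⟨ +-assoc _ _ _ ⟩
      a * u - l i * u + (l i * u - u * b)    ≈⟨ +-cong (sym ([y-z]x≈yx-zx _ _ _)) lu-ub ⟩
      (a - l i) * u + s                      ≈⟨ +-comm _ _ ⟩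
      s + (a - l i) * u                      ∎
      where
      u : Carrier
      u = s * t i
      lu-ub : l i * u - u * b ≈ s
      lu-ub = begin
        l i * u - u * b        ≈⟨ +-congʳ (central i u) ⟩
        u * l i - u * b        ≈⟨ x[y-z]≈xy-xz _ _ _ ⟨
        u * (l i - b)          ≈⟨ *-assoc _ _ _ ⟩
        s * (t i * (l i - b))  ≈⟨ *-congˡ (inv i) ⟩
        s * 1#                 ≈⟨ *-identityʳ s ⟩
        s                      ∎

  apply-rightMul : ∀ {n} (β : Vector Carrier n) r → apply (rightMul β) r ≈ r * apply (rightMul β) 1#
  apply-rightMul {zero}  β r = sym (*-identityʳ r)
  apply-rightMul {suc n} β r = begin
    apply (rightMul (tail β)) (r * β zero)       ≈⟨ apply-rightMul (tail β) _ ⟩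
    r * β zero * P                               ≈⟨ *-assoc _ _ _ ⟩
    r * (β zero * P)                             ≈⟨ *-congˡ (*-congʳ (*-identityˡ _)) ⟨
    r * (1# * β zero * P)                        ≈⟨ *-congˡ (apply-rightMul (tail β) _) ⟨
    r * apply (rightMul (tail β)) (1# * β zero)  ∎
    where
    P : Carrier
    P = apply (rightMul (tail β)) 1#

-- Determinants under homomorphisms, and evaluation of polynomials at a ring element.

record IsOperationHomo {c ℓ d ℓ′} (Q : RawRing c ℓ) (R : CommutativeRing d ℓ′)
                       (h : RawRing.Carrier Q → CommutativeRing.Carrier R) :
                       Set (c ⊔ ℓ′) where
  private
    module Q = RawRing Q
  open CommutativeRing R
  field
    +-homo : ∀ x y → h (x Q.+ y) ≈ h x + h y
    *-homo : ∀ x y → h (x Q.* y) ≈ h x * h y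
    -‿homo : ∀ x → h (Q.- x) ≈ - h x
    0-homo : h Q.0# ≈ 0#
    1-homo : h Q.1# ≈ 1#

module DetHomo {c ℓ d ℓ′} {Q : RawRing c ℓ} {R : CommutativeRing d ℓ′}
               {h : RawRing.Carrier Q → CommutativeRing.Carrier R}
               (isHomo : IsOperationHomo Q R h) where
  private
    module Q where
      open RawRing Q public
      open RawMonoidDefs +-rawMonoid public using (sum)
      open RawSemiringDefs rawSemiring public using (_^_)
      open Matrix Q public
  open CommutativeRing R hiding (zero)
  open IsOperationHomo isHomo
  open SemiringSum semiring using (sum)
  open RawSemiringDefs (RawRing.rawSemiring rawRing) using (_^_)
  open Matrix rawRing using (det)
  open MatrixRing R using (sum-cong)

  sum-homo : ∀ {n} (f : Vector Q.Carrier n) → h (Q.sum f) ≈ sum (h ∘ f)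
  sum-homo {zero}  f = 0-homo
  sum-homo {suc n} f = trans (+-homo _ _) (+-congˡ (sum-homo (f ∘ suc)))

  ^-homo : ∀ x n → h (x Q.^ n) ≈ h x ^ n
  ^-homo x zero    = 1-homo
  ^-homo x (suc n) = trans (*-homo _ _) (*-congˡ (^-homo x n))

  ^-cong : ∀ {x y} n → x ≈ y → x ^ n ≈ y ^ n
  ^-cong zero    x≈y = refl
  ^-cong (suc n) x≈y = *-cong x≈y (^-cong n x≈y)

  det-homo : ∀ {m} (A : Q.Mat m) → h (Q.det A) ≈ det (λ i j → h (A i j))
  det-homo {zero}  A = 1-homo
  det-homo {suc m} A = trans (sum-homo summand) (sum-cong (h ∘ summand) _ λ j →
    trans (*-homo _ _) (*-cong
      (trans (^-homo _ (toℕ j)) (^-cong (toℕ j) (trans (-‿homo _) (-‿cong 1-homo))))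
      (trans (*-homo _ _) (*-congˡ (det-homo (Q.minor j A))))))
    where
    summand : Fin (suc m) → Q.Carrier
    summand j = (Q.- Q.1#) Q.^ toℕ j Q.* (A zero j Q.* Q.det (Q.minor j A))

-- The structure map of an algebra over `R`.
record CentralHomo {c ℓ d ℓ′} (R : CommutativeRing c ℓ) (T : Ring d ℓ′) :
                   Set (c ⊔ ℓ ⊔ d ⊔ ℓ′) where
  private
    module R = CommutativeRing R
  open Ring T
  field
    α         : R.Carrier → Carrier
    α-cong    : ∀ {x y} → x R.≈ y → α x ≈ α y
    α-+       : ∀ x y → α (x R.+ y) ≈ α x + α y
    α-*       : ∀ x y → α (x R.* y) ≈ α x * α y
    α-1       : α R.1# ≈ 1#
    α-central : ∀ x t → α x * t ≈ t * α x

module Evaluation {c ℓ d ℓ′} {R : CommutativeRing c ℓ} {T : Ring d ℓ′}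
                  (h : CentralHomo R T) (a : Ring.Carrier T) where
  private
    module R = CommutativeRing R
  open Ring T hiding (zero)
  open CentralHomo h
  open List using ([]; _∷_)
  open Polynomial R.rawRing
  open RawRing polyRing using () renaming (-_ to -ₚ_)
  open RingProperties T
  open CommutativeSemigroupProperties +-commutativeSemigroup using (interchange)
  open SetoidReasoning setoid

  α-0 : α R.0# ≈ 0#
  α-0 = x+x≈x⇒x≈0 _ (trans (sym (α-+ _ _)) (α-cong (R.+-identityˡ _)))

  α-neg : ∀ x → α (R.- x) ≈ - α x
  α-neg x = +-inverseˡ-unique _ _
    (trans (sym (α-+ _ _)) (trans (α-cong (R.-‿inverseˡ x)) α-0))

  eval : Poly → Carrier
  eval []      = 0#
  eval (x ∷ f) = α x + a * eval f

  eval-const : ∀ x → eval (const x) ≈ α x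
  eval-const x = trans (+-congˡ (zeroʳ a)) (+-identityʳ _)

  eval-+ : ∀ f g → eval (f +ₚ g) ≈ eval f + eval g
  eval-+ []      g       = sym (+-identityˡ _)
  eval-+ (x ∷ f) []      = sym (+-identityʳ _)
  eval-+ (x ∷ f) (y ∷ g) = begin
    α (x R.+ y) + a * eval (f +ₚ g)           ≈⟨ +-cong (α-+ x y) (*-congˡ (eval-+ f g)) ⟩
    (α x + α y) + a * (eval f + eval g)       ≈⟨ +-congˡ (distribˡ _ _ _) ⟩
    (α x + α y) + (a * eval f + a * eval g)   ≈⟨ interchange _ _ _ _ ⟩
    (α x + a * eval f) + (α y + a * eval g)   ∎

  eval-neg : ∀ f → eval (-ₚ f) ≈ - eval f
  eval-neg []      = sym -0#≈0#
  eval-neg (x ∷ f) = begin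
    α (R.- x) + a * eval (-ₚ f)    ≈⟨ +-cong (α-neg x) (*-congˡ (eval-neg f)) ⟩
    - α x + a * - eval f                      ≈⟨ +-congˡ (-‿distribʳ-* _ _) ⟨
    - α x - a * eval f                        ≈⟨ -‿+-comm _ _ ⟩
    - (α x + a * eval f)                      ∎

  α-*-shift : ∀ x t → a * (α x * t) ≈ α x * (a * t)
  α-*-shift x t = begin
    a * (α x * t)   ≈⟨ *-assoc _ _ _ ⟨
    a * α x * t     ≈⟨ *-congʳ (α-central x a) ⟨
    α x * a * t     ≈⟨ *-assoc _ _ _ ⟩
    α x * (a * t)   ∎

  eval-scale : ∀ x f → eval (List.map (x R.*_) f) ≈ α x * eval f
  eval-scale x []      = sym (zeroʳ _)
  eval-scale x (y ∷ f) = begin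
    α (x R.* y) + a * eval (List.map (x R.*_) f)  ≈⟨ +-cong (α-* x y) (*-congˡ (eval-scale x f)) ⟩
    α x * α y + a * (α x * eval f)                ≈⟨ +-congˡ (α-*-shift x _) ⟩
    α x * α y + α x * (a * eval f)                ≈⟨ distribˡ _ _ _ ⟨
    α x * (α y + a * eval f)                      ∎

  eval-* : ∀ f g → eval (f *ₚ g) ≈ eval f * eval g
  eval-* []      g = sym (zeroˡ _)
  eval-* (x ∷ f) g = begin
    eval (List.map (x R.*_) g +ₚ (R.0# ∷ (f *ₚ g)))
      ≈⟨ eval-+ (List.map (x R.*_) g) _ ⟩
    eval (List.map (x R.*_) g) + (α R.0# + a * eval (f *ₚ g))
      ≈⟨ +-cong (eval-scale x g) (trans (+-congʳ α-0) (+-identityˡ _)) ⟩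
    α x * eval g + a * eval (f *ₚ g)
      ≈⟨ +-congˡ (trans (*-congˡ (eval-* f g)) (sym (*-assoc _ _ _))) ⟩
    α x * eval g + a * eval f * eval g
      ≈⟨ distribʳ _ _ _ ⟨
    (α x + a * eval f) * eval g ∎

  eval-zero : ∀ f → (∀ n → coeff f n R.≈ R.0#) → eval f ≈ 0#
  eval-zero []      f≈0 = refl
  eval-zero (x ∷ f) f≈0 = begin
    α x + a * eval f   ≈⟨ +-cong (trans (α-cong (f≈0 0)) α-0) (*-congˡ (eval-zero f (f≈0 ∘ suc))) ⟩
    0# + a * 0#        ≈⟨ +-identityˡ _ ⟩
    a * 0#             ≈⟨ zeroʳ a ⟩
    0#                 ∎

  eval-cong : ∀ f g → (∀ n → coeff f n R.≈ coeff g n) → eval f ≈ eval g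
  eval-cong []      g       f≈g = sym (eval-zero g (R.sym ∘ f≈g))
  eval-cong (x ∷ f) []      f≈g = eval-zero (x ∷ f) f≈g
  eval-cong (x ∷ f) (y ∷ g) f≈g = +-cong (α-cong (f≈g 0)) (*-congˡ (eval-cong f g (f≈g ∘ suc)))

  *-eval-comm : ∀ f → a * eval f ≈ eval f * a
  *-eval-comm []      = trans (zeroʳ a) (sym (zeroˡ a))
  *-eval-comm (x ∷ f) = begin
    a * (α x + a * eval f)        ≈⟨ distribˡ _ _ _ ⟩
    a * α x + a * (a * eval f)    ≈⟨ +-cong (sym (α-central x a)) (*-congˡ (*-eval-comm f)) ⟩
    α x * a + a * (eval f * a)    ≈⟨ +-congˡ (*-assoc _ _ _) ⟨
    α x * a + a * eval f * a      ≈⟨ distribʳ _ _ _ ⟨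
    (α x + a * eval f) * a        ∎

  eval-comm : ∀ f g → eval f * eval g ≈ eval g * eval f
  eval-comm []      g = trans (zeroˡ _) (sym (zeroʳ _))
  eval-comm (x ∷ f) g = begin
    (α x + a * eval f) * eval g            ≈⟨ distribʳ _ _ _ ⟩
    α x * eval g + a * eval f * eval g     ≈⟨ +-cong (α-central x _) (*-assoc _ _ _) ⟩
    eval g * α x + a * (eval f * eval g)   ≈⟨ +-congˡ (*-congˡ (eval-comm f g)) ⟩
    eval g * α x + a * (eval g * eval f)   ≈⟨ +-congˡ (*-assoc _ _ _) ⟨
    eval g * α x + a * eval g * eval f     ≈⟨ +-congˡ (*-congʳ (*-eval-comm g)) ⟩
    eval g * α x + eval g * a * eval f     ≈⟨ +-congˡ (*-assoc _ _ _) ⟩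
    eval g * α x + eval g * (a * eval f)   ≈⟨ distribˡ _ _ _ ⟨
    eval g * (α x + a * eval f)            ∎

  -- The subring of T generated by α and a, presented as polynomials in a.
  evalRawRing : RawRing c ℓ′
  evalRawRing = record
    { Carrier = Poly
    ; _≈_     = λ f g → eval f ≈ eval g
    ; _+_     = _+ₚ_
    ; _*_     = _*ₚ_
    ; -_      = -ₚ_
    ; 0#      = []
    ; 1#      = const R.1#
    }

  -- Equality is equality of values, so `eval` is injective by definition and the ring laws pull
  -- back from `T`. Multiplication commutes because all values are polynomials in the one element
  -- `a`; this makes the determinant theory available over the subring that `a` generates.
  evalRing : CommutativeRing c ℓ′
  evalRing = record
    { isCommutativeRing = record
      { isRing = RingMonomorphism.isRing eval-isMonomorphism isRing
      ; *-comm = λ f g → trans (eval-* f g) (trans (eval-comm f g) (sym (eval-* g f)))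
      }
    }
    where
    open RingMorphisms evalRawRing rawRing using (IsRingMonomorphism)
    eval-isMonomorphism : IsRingMonomorphism eval
    eval-isMonomorphism = record
      { isRingHomomorphism = record
        { isSemiringHomomorphism = record
          { isNearSemiringHomomorphism = record
            { +-isMonoidHomomorphism = record
              { isMagmaHomomorphism = record
                { isRelHomomorphism = record { cong = id }
                ; homo = eval-+
                }
              ; ε-homo = refl
              }
            ; *-homo = eval-*
            }
          ; 1#-homo = trans (eval-const _) α-1
          }
        ; -‿homo = eval-neg
        }
      ; injective = id
      }

  open RawMonoidDefs (RawRing.*-rawMonoid polyRing) using () renaming (sum to product)
  open Divide T

  apply-rightMul-eval : ∀ {n} (f : Vector Poly n) (β : Vector Carrier n) →
    (∀ i → eval (f i) ≈ β i) → ∀ r → apply (rightMul β) r ≈ r * eval (product f)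
  apply-rightMul-eval {zero}  f β f≈β r =
    sym (trans (*-congˡ (trans (eval-const R.1#) α-1)) (*-identityʳ r))
  apply-rightMul-eval {suc n} f β f≈β r = begin
    apply (rightMul (β ∘ suc)) (r * β zero)         ≈⟨ apply-rightMul-eval (f ∘ suc) (β ∘ suc) (f≈β ∘ suc) _ ⟩
    r * β zero * eval (product (f ∘ suc))           ≈⟨ *-assoc _ _ _ ⟩
    r * (β zero * eval (product (f ∘ suc)))         ≈⟨ *-congˡ (*-congʳ (f≈β zero)) ⟨
    r * (eval (f zero) * eval (product (f ∘ suc)))  ≈⟨ *-congˡ (eval-* (f zero) _) ⟨
    r * eval (product f)                            ∎

  -- Composing left multiplications reverses the order of the factors; this is harmless since values
  -- of polynomials at `a` commute.
  apply-leftMul-eval : ∀ {n} (f : Vector Poly n) (β : Vector Carrier n) →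
    (∀ i → eval (f i) ≈ β i) → ∀ r → apply (leftMul β) r ≈ eval (product f) * r
  apply-leftMul-eval {zero}  f β f≈β r =
    sym (trans (*-congʳ (trans (eval-const R.1#) α-1)) (*-identityˡ r))
  apply-leftMul-eval {suc n} f β f≈β r = begin
    apply (leftMul (β ∘ suc)) (β zero * r)          ≈⟨ apply-leftMul-eval (f ∘ suc) (β ∘ suc) (f≈β ∘ suc) _ ⟩
    eval (product (f ∘ suc)) * (β zero * r)         ≈⟨ *-congˡ (*-congʳ (f≈β zero)) ⟨
    eval (product (f ∘ suc)) * (eval (f zero) * r)  ≈⟨ *-assoc _ _ _ ⟨
    eval (product (f ∘ suc)) * eval (f zero) * r    ≈⟨ *-congʳ (eval-comm (product (f ∘ suc)) (f zero)) ⟩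
    eval (f zero) * eval (product (f ∘ suc)) * r    ≈⟨ *-congʳ (eval-* (f zero) _) ⟨
    eval (product f) * r                            ∎

-- The Cayley-Hamilton theorem.

module CayleyHamilton {c ℓ} (R : CommutativeRing c ℓ) {m : ℕ}
                      (A : Matrix.Mat (CommutativeRing.rawRing R) m) where
  open CommutativeRing R hiding (zero)
  open MatrixRing R
  open Polynomial rawRing using (Poly; const; X; polyRing)
  open SemiringSum semiring
  open SetoidReasoning setoid
  private
    module M = Ring (matrixRing m)

  scalarHomo : CentralHomo R (matrixRing m)
  scalarHomo = record
    { α         = scalar
    ; α-cong    = λ x≈y i j → *-congʳ x≈y
    ; α-+       = λ x y i j → distribʳ _ _ _
    ; α-*       = λ x y i j → trans (*-assoc _ _ _) (sym (scalar-*ᴹ x (scalar y) i j))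
    ; α-1       = λ i j → *-identityˡ _
    ; α-central = scalar-central
    }

  open Evaluation scalarHomo A public

  module S where
    open CommutativeRing evalRing public
    open Matrix (CommutativeRing.rawRing evalRing) public
    open SemiringSum (CommutativeRing.semiring evalRing) public

  eval-sum : ∀ {n} (f : Vector Poly n) i j → eval (S.sum f) i j ≈ sum (λ k → eval (f k) i j)
  eval-sum {zero}  f i j = refl
  eval-sum {suc n} f i j = trans (eval-+ (f zero) _ i j) (+-congˡ (eval-sum (f ∘ suc) i j))

  -- The matrix X - A over the commutative ring generated by `A`, where X acts as `A` itself; its
  -- entries are thus m × m matrices.
  characteristicMatrix : S.Mat m
  characteristicMatrix = X S.·ᴹ S.Iᴹ S.-ᴹ (λ i j → const (A i j))

  eval-X : eval X ≈ᴹ A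
  eval-X i j = begin
    0# * Iᴹ i j + (A *ᴹ eval (const 1#)) i j   ≈⟨ +-cong (zeroˡ _) (M.*-congˡ {A} (eval-const 1#) i j) ⟩
    0# + (A *ᴹ scalar 1#) i j                  ≈⟨ +-identityˡ _ ⟩
    (A *ᴹ scalar 1#) i j                       ≈⟨ *ᴹ-scalar 1# A i j ⟩
    1# * A i j                                 ≈⟨ *-identityˡ _ ⟩
    A i j                                      ∎

  eval-characteristicMatrix : ∀ r j → eval (characteristicMatrix r j) ≈ᴹ
                              A *ᴹ eval (S.Iᴹ r j) -ᴹ A r j ·ᴹ Iᴹ
  eval-characteristicMatrix r j s t = begin
    eval (characteristicMatrix r j) s t
      ≈⟨ eval-+ (X S.* S.Iᴹ r j) _ s t ⟩
    eval (X S.* S.Iᴹ r j) s t + eval (S.- const (A r j)) s t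
      ≈⟨ +-cong (eval-* X (S.Iᴹ r j) s t) (eval-neg (const (A r j)) s t) ⟩
    (eval X *ᴹ eval (S.Iᴹ r j)) s t - eval (const (A r j)) s t
      ≈⟨ +-cong (M.*-congʳ {eval (S.Iᴹ r j)} eval-X s t) (-‿cong (eval-const (A r j) s t)) ⟩
    (A *ᴹ eval (S.Iᴹ r j)) s t - A r j * Iᴹ s t ∎

  -- When X acts as A, X eⱼ = ∑ᵣ Aᵣⱼ eᵣ.
  characteristicMatrix-annihilates : ∀ j s →
    sum (λ r → eval (characteristicMatrix r j) s r) ≈ 0#
  characteristicMatrix-annihilates j s = begin
    sum (λ r → eval (characteristicMatrix r j) s r)
      ≈⟨ sum-cong-≋ {m} (λ r → eval-characteristicMatrix r j s r) ⟩
    sum (λ r → (A *ᴹ eval (S.Iᴹ r j)) s r - A r j * Iᴹ s r)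
      ≈⟨ ∑-distrib-+ {m} _ _ ⟩
    sum (λ r → (A *ᴹ eval (S.Iᴹ r j)) s r) + sum (λ r → - (A r j * Iᴹ s r))
      ≈⟨ +-cong first (trans (sum-neg {m} _) (-‿cong second)) ⟩
    A s j - A s j
      ≈⟨ -‿inverseʳ _ ⟩
    0# ∎
    where
    I-diagonal : ∀ j → eval (S.Iᴹ j j) ≈ᴹ Iᴹ
    I-diagonal j s t = trans (SI.Iᴹ-diagonal j s t) (trans (eval-const 1# s t) (*-identityˡ _))
      where module SI = MatrixRing evalRing

    first : sum (λ r → (A *ᴹ eval (S.Iᴹ r j)) s r) ≈ A s j
    first = begin
      sum (λ r → (A *ᴹ eval (S.Iᴹ r j)) s r)
        ≈⟨ sum-single {m} _ j (λ r r≢j → trans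
             (M.*-congˡ {A} (MatrixRing.Iᴹ-offDiagonal evalRing r≢j) s r) (M.zeroʳ A s r)) ⟩
      (A *ᴹ eval (S.Iᴹ j j)) s j   ≈⟨ M.*-congˡ {A} (I-diagonal j) s j ⟩
      (A *ᴹ Iᴹ) s j                ≈⟨ *ᴹ-identityʳ A s j ⟩
      A s j                        ∎

    second : sum (λ r → A r j * Iᴹ s r) ≈ A s j
    second = begin
      sum (λ r → A r j * Iᴹ s r)
        ≈⟨ sum-single {m} _ s (λ r r≢s → trans (*-congˡ (Iᴹ-offDiagonal (r≢s ∘ ≡.sym))) (zeroʳ _)) ⟩
      A s j * Iᴹ s s               ≈⟨ *-congˡ (Iᴹ-diagonal s) ⟩
      A s j * 1#                   ≈⟨ *-identityʳ _ ⟩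
      A s j                        ∎

  -- The vector relations of `characteristicMatrix-annihilates` survive multiplication by a
  -- polynomial in `A` from the left; commutativity of `evalRing` is what allows `g j` to be moved
  -- there.
  eval-combination : ∀ (g : Vector Poly m) s →
    sum (λ r → eval (S.sum λ j → characteristicMatrix r j S.* g j) s r) ≈ 0#
  eval-combination g s = begin
    sum (λ r → eval (S.sum λ j → characteristicMatrix r j S.* g j) s r)
      ≈⟨ sum-cong-≋ {m} (λ r → eval-sum {m} _ s r) ⟩
    sum (λ r → sum (λ j → eval (characteristicMatrix r j S.* g j) s r))
      ≈⟨ ∑-comm {m} {m} _ ⟩
    sum (λ j → sum (λ r → eval (characteristicMatrix r j S.* g j) s r))
      ≈⟨ sum-zero {m} column ⟩
    0# ∎
    where
    column : ∀ j → sum (λ r → eval (characteristicMatrix r j S.* g j) s r) ≈ 0#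
    column j = begin
      sum (λ r → eval (characteristicMatrix r j S.* g j) s r)
        ≈⟨ sum-cong-≋ {m} (λ r → trans (S.*-comm (characteristicMatrix r j) (g j) s r)
                                       (eval-* (g j) (characteristicMatrix r j) s r)) ⟩
      sum (λ r → sum (λ t → eval (g j) s t * eval (characteristicMatrix r j) t r))
        ≈⟨ ∑-comm {m} {m} _ ⟩
      sum (λ t → sum (λ r → eval (g j) s t * eval (characteristicMatrix r j) t r))
        ≈⟨ sum-cong-≋ {m} (λ t → *-distribˡ-sum {m} _ _) ⟨
      sum (λ t → eval (g j) s t * sum (λ r → eval (characteristicMatrix r j) t r))
        ≈⟨ sum-zero {m} (λ t → trans (*-congˡ (characteristicMatrix-annihilates j t)) (zeroʳ _)) ⟩
      0# ∎

module CayleyHamiltonTheorem {c ℓ} (R : CommutativeRing c ℓ) where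
  open CommutativeRing R hiding (zero)
  open MatrixRing R
  open SemiringSum semiring
  open SetoidReasoning setoid

  module _ {m} (A : Mat (suc m)) where
    open CayleyHamilton R A
    open Determinant evalRing using (sgn; sgn-sgn-*; cofactor; cofactor-diagonal; cofactor-offDiagonal)
    -- Taking the cofactors of row i as multipliers, the combination in row r is zero unless r = i,
    -- where it is the signed determinant. The relation therefore collapses to the statement that
    -- this determinant kills the i-th basis vector.
    eval-signedDet : ∀ i s → eval (sgn (toℕ i) S.* S.det characteristicMatrix) s i ≈ 0#
    eval-signedDet i s = begin
      eval (sgn (toℕ i) S.* S.det characteristicMatrix) s i
        ≈⟨ cofactor-diagonal characteristicMatrix i s i ⟨
      eval (row i) s i
        ≈⟨ sum-single (λ r → eval (row r) s r) i (λ r r≢i →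
             cofactor-offDiagonal characteristicMatrix i r (r≢i ∘ ≡.sym) s r) ⟨
      sum (λ r → eval (row r) s r)
        ≈⟨ eval-combination (cofactor characteristicMatrix i) s ⟩
      0# ∎
      where
      row : Fin (suc m) → S.Carrier
      row r = S.sum λ j → characteristicMatrix r j S.* cofactor characteristicMatrix i j

    eval-det : eval (S.det characteristicMatrix) ≈ᴹ 0ᴹ
    eval-det s i = begin
      eval d s i                                 ≈⟨ sgn-sgn-* (toℕ i) d s i ⟨
      eval (sgn (toℕ i) S.* (sgn (toℕ i) S.* d)) s i
        ≈⟨ eval-* (sgn (toℕ i)) _ s i ⟩
      (eval (sgn (toℕ i)) *ᴹ eval (sgn (toℕ i) S.* d)) s i
        ≈⟨ sum-zero {suc m} {λ t → eval (sgn (toℕ i)) s t * eval (sgn (toℕ i) S.* d) t i}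
             (λ t → trans (*-congˡ (eval-signedDet i t)) (zeroʳ _)) ⟩
      0# ∎
      where
      d : S.Carrier
      d = S.det characteristicMatrix

  -- `charPoly` is a determinant over the raw polynomials, `eval-det` concerns one over `evalRing`.
  -- Both use the same operations on lists and differ only in equality, so the identity map carries
  -- one determinant to the other.
  eval-charPoly : ∀ {m} (A : Mat m) → CayleyHamilton.eval R A (charPoly rawRing A) ≈ᴹ 0ᴹ
  eval-charPoly {suc m} A i j = trans (det-homo entries i j)
    (trans (det-cong {A = entries} {B = characteristicMatrix} entries≈ i j) (eval-det A i j))
    where
    open CayleyHamilton R A
    polynomials : IsOperationHomo (Polynomial.polyRing rawRing) evalRing id
    polynomials = record
      { +-homo = λ f g i j → refl
      ; *-homo = λ f g i j → refl
      ; -‿homo = λ f i j → refl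
      ; 0-homo = λ i j → refl
      ; 1-homo = λ i j → refl
      }

    open DetHomo polynomials using (det-homo)
    open Polynomial rawRing using (X; const; polyRing)
    open Determinant evalRing using (det-cong)
    module P = Matrix polyRing

    entries : P.Mat (suc m)
    entries = X P.·ᴹ P.Iᴹ P.-ᴹ (λ i j → const (A i j))

    Iᴹ-entries : ∀ r s → P.Iᴹ {suc m} r s ≡ S.Iᴹ r s
    Iᴹ-entries r s with r Fin.≟ s
    ... | yes _ = ≡.refl
    ... | no  _ = ≡.refl

    entries≈ : ∀ r s → entries r s S.≈ characteristicMatrix r s
    entries≈ r s = S.reflexive {entries r s} {characteristicMatrix r s}
      (≡.cong (λ f → X S.* f S.+ (S.- const (A r s))) (Iᴹ-entries r s))

-- Sylvester equations for matrices annihilated by linear factors.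

module Sylvester {c ℓ} (R : CommutativeRing c ℓ) {m : ℕ} where
  open CommutativeRing R hiding (zero)
  open MatrixRing R
  open RingProperties ring
  private
    module M where
      open Ring (matrixRing m) public
      open RingProperties (matrixRing m) public
  open Divide (matrixRing m)
  open SetoidReasoning setoid

  AnnihilatesRight AnnihilatesLeft : ∀ {n} → Vector Carrier n → Mat m → Set _
  AnnihilatesRight l A = ∀ r → apply (rightMul (λ i → A -ᴹ scalar (l i))) r ≈ᴹ 0ᴹ
  AnnihilatesLeft  l A = ∀ r → apply (leftMul  (λ i → A -ᴹ scalar (l i))) r ≈ᴹ 0ᴹ

  -- Splitting B - s = (μ j - s) + (B - μ j) shows that the inverse of μ j - s divides correctly
  -- modulo B - μ j.
  rightDivide-scalar : ∀ {n} (B : Mat m) (μ t : Vector Carrier n) s →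
    (∀ j → t j * (μ j - s) ≈ 1#) → AnnihilatesRight μ B →
    ∀ r → ∃[ w ] w *ᴹ (B -ᴹ scalar s) ≈ᴹ r
  rightDivide-scalar B μ t s inv B≈0 = rightDivide (λ j → B -ᴹ scalar (μ j)) (scalar ∘ t)
    (B -ᴹ scalar s) (λ i j → scalar-central (t j) _)
    (λ j → λ i k → begin
      (scalar (t j) *ᴹ (B -ᴹ scalar s)) i k
        ≈⟨ scalar-*ᴹ (t j) (B -ᴹ scalar s) i k ⟩
      t j * (B i k - s * Iᴹ i k)
        ≈⟨ *-congˡ (difference (B i k) (μ j) s (Iᴹ i k)) ⟩
      t j * ((μ j - s) * Iᴹ i k + (B i k - μ j * Iᴹ i k))
        ≈⟨ distribˡ _ _ _ ⟩
      t j * ((μ j - s) * Iᴹ i k) + t j * (B i k - μ j * Iᴹ i k)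
        ≈⟨ +-cong (trans (sym (*-assoc _ _ _)) (trans (*-congʳ (inv j)) (*-identityˡ _)))
                  (sym (scalar-*ᴹ (t j) (B -ᴹ scalar (μ j)) i k)) ⟩
      Iᴹ i k + (scalar (t j) *ᴹ (B -ᴹ scalar (μ j))) i k ∎)
    B≈0
    where
    difference : ∀ b μ s e → b - s * e ≈ (μ - s) * e + (b - μ * e)
    difference b μ s e = begin
      b - s * e                              ≈⟨ +-comm _ _ ⟩
      - (s * e) + b                          ≈⟨ +-congʳ (+-identityˡ _) ⟨
      0# - s * e + b                         ≈⟨ +-congʳ (+-congʳ (-‿inverseˡ _)) ⟨
      - (μ * e) + μ * e - s * e + b          ≈⟨ +-congʳ (+-assoc _ _ _) ⟩
      - (μ * e) + (μ * e - s * e) + b        ≈⟨ +-congʳ (+-comm _ _) ⟩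
      (μ * e - s * e) - μ * e + b            ≈⟨ +-assoc _ _ _ ⟩
      (μ * e - s * e) + (- (μ * e) + b)      ≈⟨ +-cong (sym ([y-z]x≈yx-zx _ _ _)) (+-comm _ _) ⟩
      (μ - s) * e + (b - μ * e)              ∎

  sylvester-scalar : ∀ {n} (A B : Mat m) (l μ : Vector Carrier n) (t : Fin n → Fin n → Carrier) s →
    (∀ i j → t i j * (μ j - (l i - s)) ≈ 1#) → AnnihilatesLeft l A → AnnihilatesRight μ B →
    ∀ r → ∃[ w ] w *ᴹ (scalar s +ᴹ B) -ᴹ A *ᴹ w ≈ᴹ r
  sylvester-scalar A B l μ t s inv A≈0 B≈0 r = w , λ i j → begin
    (w *ᴹ (scalar s +ᴹ B)) i j - (A *ᴹ w) i j     ≈⟨ ⁻¹-anti-homo‿- _ _ ⟨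
    - ((A *ᴹ w) i j - (w *ᴹ (scalar s +ᴹ B)) i j) ≈⟨ -‿cong (proj₂ solution i j) ⟩
    - (- r i j)                                   ≈⟨ -‿involutive _ ⟩
    r i j                                         ∎
    where
    -- A left inverse of l i - (s + B) is wanted, and this matrix is the negative of B - (l i - s);
    -- hence the right side -I.
    divided : ∀ i → ∃[ g ] g *ᴹ (B -ᴹ scalar (l i - s)) ≈ᴹ -ᴹ Iᴹ
    divided i = rightDivide-scalar B μ (t i) (l i - s) (inv i) B≈0 (-ᴹ Iᴹ)

    flip : ∀ i j k → (scalar (l i) -ᴹ (scalar s +ᴹ B)) j k ≈ - (B -ᴹ scalar (l i - s)) j k
    flip i j k = begin
      l i * e - (s * e + b)                ≈⟨ +-congˡ (-‿+-comm _ _) ⟨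
      l i * e + (- (s * e) - b)            ≈⟨ +-assoc _ _ _ ⟨
      l i * e - s * e - b                  ≈⟨ +-congʳ ([y-z]x≈yx-zx _ _ _) ⟨
      (l i - s) * e - b                    ≈⟨ ⁻¹-anti-homo‿- _ _ ⟨
      - (b - (l i - s) * e)                ∎
      where
      e b : Carrier
      e = Iᴹ j k
      b = B j k

    -- `sylvester` treats the operator with the opposite sign, so -r is the right side.
    solution : ∃[ w ] A *ᴹ w -ᴹ w *ᴹ (scalar s +ᴹ B) ≈ᴹ -ᴹ r
    solution = sylvester A (scalar s +ᴹ B) (scalar ∘ l) (proj₁ ∘ divided)
      (λ i → scalar-central (l i))
      (λ i → M.trans (M.*-congˡ {proj₁ (divided i)} (flip i))
               (M.trans (M.sym (M.-‿distribʳ-* (proj₁ (divided i)) (B -ᴹ scalar (l i - s))))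
                 (M.trans (M.-‿cong (proj₂ (divided i))) (M.-‿involutive Iᴹ))))
      A≈0 (-ᴹ r)

    w : Mat m
    w = proj₁ solution

module Spectrum {c ℓ} (R : CommutativeRing c ℓ) {m : ℕ} where
  open CommutativeRing R hiding (zero)
  open MatrixRing R
  open Sylvester R {m}
  open Divide (matrixRing m)
  open CayleyHamiltonTheorem R using (eval-charPoly)
  open Polynomial rawRing using (Poly; const; X; polyRing)
  open RawRing polyRing using () renaming (_+_ to _+ₚ_; -_ to -ₚ_)
  private
    module M = Ring (matrixRing m)

  module _ (A : Mat m) (l : Vector Carrier m) (spectrum : AreEigenvalues rawRing A l) where
    open CayleyHamilton R A

    factor : Fin m → Poly
    factor i = X +ₚ (-ₚ const (l i))

    open RawMonoidDefs (RawRing.*-rawMonoid polyRing) using () renaming (sum to product)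

    eval-product : eval (product factor) ≈ᴹ 0ᴹ
    eval-product i j = trans (sym (eval-cong (charPoly rawRing A) (product factor) spectrum i j))
                             (eval-charPoly A i j)

    eval-factor : ∀ k → eval (factor k) ≈ᴹ A -ᴹ scalar (l k)
    eval-factor k i j = trans (eval-+ X (-ₚ const (l k)) i j)
      (+-cong (eval-X i j) (trans (eval-neg (const (l k)) i j) (-‿cong (eval-const (l k) i j))))

    annihilatesRight : AnnihilatesRight l A
    annihilatesRight r i j =
      trans (apply-rightMul-eval factor (λ k → A -ᴹ scalar (l k)) eval-factor r i j)
            (trans (M.*-congˡ {r} eval-product i j) (M.zeroʳ r i j))

    annihilatesLeft : AnnihilatesLeft l A
    annihilatesLeft r i j =
      trans (apply-leftMul-eval factor (λ k → A -ᴹ scalar (l k)) eval-factor r i j)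
            (trans (M.*-congʳ {r} eval-product i j) (M.zeroˡ r i j))

module Transport {c ℓ} (R : CommutativeRing c ℓ) {m : ℕ}
  (φ : CommutativeRing.Carrier R → CommutativeRing.Carrier R)
  (φ-cong : ∀ {x y} → CommutativeRing._≈_ R x y → CommutativeRing._≈_ R (φ x) (φ y))
  (isHomo : IsOperationHomo (CommutativeRing.rawRing R) R φ) where

  open CommutativeRing R hiding (zero)
  open IsOperationHomo isHomo
  open DetHomo isHomo using (sum-homo)
  open MatrixRing R
  open Sylvester R {m}
  open Divide (matrixRing m)
  open SemiringSum semiring
  private
    module M = Ring (matrixRing m)

  map : Mat m → Mat m
  map A i j = φ (A i j)

  map-*ᴹ : ∀ A B → map (A *ᴹ B) ≈ᴹ map A *ᴹ map B
  map-*ᴹ A B i j = trans (sum-homo {m} _) (sum-cong-≋ {m} λ k → *-homo _ _)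

  map-Iᴹ : map Iᴹ ≈ᴹ Iᴹ
  map-Iᴹ i j with i Fin.≟ j
  ... | yes _ = 1-homo
  ... | no  _ = 0-homo

  map-factor : ∀ A a → map (A -ᴹ scalar a) ≈ᴹ map A -ᴹ scalar (φ a)
  map-factor A a i j = trans (+-homo _ _) (+-congˡ (trans (-‿homo _)
    (-‿cong (trans (*-homo _ _) (*-congˡ (map-Iᴹ i j))))))

  map-apply : ∀ {n} (l : Vector Carrier n) A r →
    map (apply (rightMul (λ i → A -ᴹ scalar (l i))) r) ≈ᴹ
    apply (rightMul (λ i → map A -ᴹ scalar (φ (l i)))) (map r)
  map-apply {zero}  l A r i j = refl
  map-apply {suc n} l A r i j = trans (map-apply (l ∘ suc) A (r *ᴹ (A -ᴹ scalar (l zero))) i j)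
    (apply-cong {α = rightMul (λ i → map A -ᴹ scalar (φ (l (suc i))))}
      (λ k → M.*-congʳ {map A -ᴹ scalar (φ (l (suc k)))}) first i j)
    where
    first : map (r *ᴹ (A -ᴹ scalar (l zero))) ≈ᴹ map r *ᴹ (map A -ᴹ scalar (φ (l zero)))
    first i j = trans (map-*ᴹ r (A -ᴹ scalar (l zero)) i j)
      (M.*-congˡ {map r} (map-factor A (l zero)) i j)

  -- Applying φ to the annihilation of `A` yields the claim only at matrices in the image of `map`.
  -- Since the composite is right multiplication by its value at `Iᴹ`, and `Iᴹ` is its own image,
  -- this is enough.
  map-annihilatesRight : ∀ {n} (l : Vector Carrier n) A →
                         AnnihilatesRight l A → AnnihilatesRight (φ ∘ l) (map A)
  map-annihilatesRight l A A≈0 r i j =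
    trans (apply-rightMul (λ k → map A -ᴹ scalar (φ (l k))) r i j)
          (trans (M.*-congˡ {r} unit i j) (M.zeroʳ r i j))
    where
    unit : apply (rightMul (λ k → map A -ᴹ scalar (φ (l k)))) Iᴹ ≈ᴹ 0ᴹ
    unit i j =
      trans (apply-cong {α = rightMul (λ k → map A -ᴹ scalar (φ (l k)))}
               (λ k → M.*-congʳ {map A -ᴹ scalar (φ (l k))}) (M.sym map-Iᴹ) i j)
      (trans (sym (map-apply l A Iᴹ i j)) (trans (φ-cong (A≈0 Iᴹ i j)) 0-homo))

-- Additivity of the Frobenius and the characteristic of a finite field.

prime∤! : ∀ {p} → Prime p → ∀ {k} → k ℕ.< p → ¬ (p ∣ k !)
prime∤! {p} pp {zero}  _   p∣1 = ℕ.nonTrivial⇒≢1 {{prime⇒nonTrivial pp}} (∣1⇒≡1 p∣1)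
prime∤! {p} pp {suc k} k<p p∣ with euclidsLemma (suc k) (k !) pp p∣
... | inj₁ p∣k+1 = ℕ.<⇒≱ k<p (∣⇒≤ p∣k+1)
... | inj₂ p∣k!  = prime∤! pp (ℕ.<-trans (ℕ.n<1+n k) k<p) p∣k!

C*k![n∸k]!≡n! : ∀ {n k} → k ℕ.≤ n → (n ℕ.C k) ℕ.* (k ! ℕ.* (n ℕ.∸ k) !) ≡ n !
C*k![n∸k]!≡n! {n} {k} k≤n =
  ≡.trans (≡.cong (ℕ._* (k ! ℕ.* (n ℕ.∸ k) !)) (ℕ.nCk≡n!/k![n-k]! k≤n))
          (ℕ.m/n*n≡m (ℕ.k![n∸k]!∣n! k≤n))
  where
  instance
    _ = k ℕ.!* (n ℕ.∸ k) !≢0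

-- p divides p! = C(p,k) k! (p-k)!, but neither of the two factorials.
prime∣C : ∀ {p} → Prime p → ∀ {k} → 0 ℕ.< k → k ℕ.< p → p ∣ p ℕ.C k
prime∣C {p@(suc p-1)} pp {k} 0<k k<p
  with euclidsLemma (p ℕ.C k) (k ! ℕ.* (p ℕ.∸ k) !) pp
         (≡.subst (p ∣_) (≡.sym (C*k![n∸k]!≡n! (ℕ.<⇒≤ k<p))) (m∣m*n (p-1 !)))
... | inj₁ p∣C = p∣C
... | inj₂ p∣kk with euclidsLemma (k !) ((p ℕ.∸ k) !) pp p∣kk
...   | inj₁ p∣k!   = contradiction p∣k! (prime∤! pp k<p)
...   | inj₂ p∣p-k! = contradiction p∣p-k! (prime∤! pp (ℕ.∸-monoʳ-< 0<k (ℕ.<⇒≤ k<p)))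

module Frobenius {c ℓ} (R : CommutativeRing c ℓ) where
  open CommutativeRing R hiding (zero)
  open Exp commutativeSemiring
  open Mult semiring using (×-congʳ; ×-assoc-*; ×1-homo-*) renaming (_×_ to _×ᵣ_)
  open SemiringSum semiring
  open RingProperties ring
  open SetoidReasoning setoid

  Additive : ℕ → Set _
  Additive n = ∀ a b → (a + b) ^ n ≈ a ^ n + b ^ n

  ×-multiple : ∀ {p n} → p ×ᵣ 1# ≈ 0# → p ∣ n → ∀ a → n ×ᵣ a ≈ 0#
  ×-multiple {p} p≈0 (divides k ≡.refl) a = begin
    (k ℕ.* p) ×ᵣ a            ≈⟨ ×-congʳ (k ℕ.* p) (*-identityˡ a) ⟨
    (k ℕ.* p) ×ᵣ (1# * a)     ≈⟨ ×-assoc-* (k ℕ.* p) 1# a ⟨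
    (k ℕ.* p) ×ᵣ 1# * a       ≈⟨ *-congʳ (×1-homo-* k p) ⟩
    k ×ᵣ 1# * p ×ᵣ 1# * a     ≈⟨ *-congʳ (*-congˡ p≈0) ⟩
    k ×ᵣ 1# * 0# * a          ≈⟨ *-congʳ (zeroʳ _) ⟩
    0# * a                    ≈⟨ zeroˡ a ⟩
    0#                        ∎

  additive-prime : ∀ {p} → Prime p → p ×ᵣ 1# ≈ 0# → Additive p
  additive-prime {suc p} pp p≈0 a b = begin
    (a + b) ^ suc p
      ≈⟨ Binomial.theorem commutativeSemiring (suc p) a b ⟩
    term zero + sum (λ k → term (suc k))
      ≈⟨ +-congˡ (sum-init-last (λ k → term (suc k))) ⟩
    term zero + (sum (λ k → term (suc (inject₁ k))) + term (suc (fromℕ p)))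
      ≈⟨ +-cong first (+-cong middle last) ⟩
    b ^ suc p + (0# + a ^ suc p)
      ≈⟨ +-congˡ (+-identityˡ _) ⟩
    b ^ suc p + a ^ suc p
      ≈⟨ +-comm _ _ ⟩
    a ^ suc p + b ^ suc p ∎
    where
    term : Fin (suc (suc p)) → Carrier
    term = Binomial.binomialTerm commutativeSemiring a b (suc p)

    first : term zero ≈ b ^ suc p
    first = trans (+-identityʳ _) (*-identityˡ _)

    middle : sum (λ k → term (suc (inject₁ k))) ≈ 0#
    middle = trans (sum-cong-≋ {p} (λ k → ×-multiple p≈0
      (prime∣C pp (ℕ.s≤s ℕ.z≤n) (ℕ.s≤s (≡.subst (ℕ._< p) (≡.sym (Fin.toℕ-inject₁ k)) (Fin.toℕ<n k)))) _))
      (sum-replicate-zero p)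

    last : term (suc (fromℕ p)) ≈ a ^ suc p
    last rewrite Fin.toℕ-fromℕ p | ℕ.nCn≡1 (suc p) | ℕ.n∸n≡0 p = trans (+-identityʳ _) (*-identityʳ _)

  additive-1 : Additive 1
  additive-1 a b = trans (*-identityʳ _) (sym (+-cong (*-identityʳ a) (*-identityʳ b)))

  additive-* : ∀ m n → Additive m → Additive n → Additive (m ℕ.* n)
  additive-* m n m+ n+ a b = begin
    (a + b) ^ (m ℕ.* n)           ≈⟨ ^-assocʳ (a + b) m n ⟨
    ((a + b) ^ m) ^ n             ≈⟨ ^-congˡ n (m+ a b) ⟩
    (a ^ m + b ^ m) ^ n           ≈⟨ n+ _ _ ⟩
    (a ^ m) ^ n + (b ^ m) ^ n     ≈⟨ +-cong (^-assocʳ a m n) (^-assocʳ b m n) ⟩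
    a ^ (m ℕ.* n) + b ^ (m ℕ.* n) ∎

  additive-^ : ∀ m n → Additive m → Additive (m ℕ.^ n)
  additive-^ m zero    m+ = additive-1
  additive-^ m (suc n) m+ = additive-* m (m ℕ.^ n) m+ (additive-^ m n m+)

  additive-0 : ∀ {n} → Additive n → 0# ^ n ≈ 0#
  additive-0 {n} n+ = x+x≈x⇒x≈0 _ (trans (sym (n+ 0# 0#)) (^-congˡ n (+-identityˡ 0#)))

  additive-neg : ∀ {n} → Additive n → ∀ a → (- a) ^ n ≈ - (a ^ n)
  additive-neg {n} n+ a = +-inverseˡ-unique _ _
    (trans (sym (n+ (- a) a)) (trans (^-congˡ n (-‿inverseˡ a)) (additive-0 {n} n+)))

  1^ : ∀ n → 1# ^ n ≈ 1#
  1^ zero    = refl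
  1^ (suc n) = trans (*-identityˡ _) (1^ n)

module FiniteFieldCharacteristic {q c ℓ} (F : FiniteField q c ℓ) where
  open FiniteField F
  open Field field′ hiding (zero)
  open Inverse enumeration
  open Mult semiring using () renaming (_×_ to _×ᵣ_)
  open SemiringSum semiring
  open RingProperties ring
  open SetoidReasoning setoid

  translate : Permutation.Permutation q q
  translate = Permutation.permutation (λ i → to (from i + 1#)) (λ i → to (from i - 1#))
    (λ i → ≡.trans (to-cong (trans (+-congʳ (strictlyInverseʳ _))
      (trans (+-assoc _ _ _) (trans (+-congˡ (-‿inverseˡ 1#)) (+-identityʳ _))))) (strictlyInverseˡ i))
    (λ i → ≡.trans (to-cong (trans (+-congʳ (strictlyInverseʳ _))
      (trans (+-assoc _ _ _) (trans (+-congˡ (-‿inverseʳ 1#)) (+-identityʳ _))))) (strictlyInverseˡ i))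

  -- Translation by 1 permutes the field, so the sum of all elements equals itself plus q · 1.
  q×1≈0 : q ×ᵣ 1# ≈ 0#
  q×1≈0 = +-identityʳ-unique (sum from) _ (begin
    sum from + q ×ᵣ 1#               ≈⟨ +-congˡ (sum-replicate q) ⟨
    sum from + sum {q} (λ _ → 1#)    ≈⟨ ∑-distrib-+ {q} from (λ _ → 1#) ⟨
    sum (λ i → from i + 1#)          ≈⟨ sum-cong-≋ {q} (λ i → strictlyInverseʳ (from i + 1#)) ⟨
    sum (λ i → from (to (from i + 1#))) ≈⟨ sum-permute from translate ⟨
    sum from                         ∎)

-- Order on the rationals and on extended valuations.

·-monoʳ-≤ : ∀ n {r s} → r ℚ.≤ s → n · r ℚ.≤ n · s
·-monoʳ-≤ zero    r≤s = ℚ.≤-refl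
·-monoʳ-≤ (suc n) r≤s = ℚ.+-mono-≤ r≤s (·-monoʳ-≤ n r≤s)

·-cancelˡ-≤ : ∀ n {r s} → suc n · r ℚ.≤ suc n · s → r ℚ.≤ s
·-cancelˡ-≤ n {r} {s} nr≤ns = ℚ.≮⇒≥ λ s<r →
  ℚ.<-irrefl ≡.refl (ℚ.<-≤-trans (ℚ.+-mono-<-≤ s<r (·-monoʳ-≤ n (ℚ.<⇒≤ s<r))) nr≤ns)

·-nonNeg : ∀ n {r} → 0ℚ ℚ.≤ r → 0ℚ ℚ.≤ n · r
·-nonNeg zero    0≤r = ℚ.≤-refl
·-nonNeg (suc n) 0≤r = ℚ.+-mono-≤ 0≤r (·-nonNeg n 0≤r)

·-monoˡ-≤ : ∀ {m n r} → 0ℚ ℚ.≤ r → m ℕ.≤ n → m · r ℚ.≤ n · r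
·-monoˡ-≤ {n = n} 0≤r ℕ.z≤n       = ·-nonNeg n 0≤r
·-monoˡ-≤ {r = r} 0≤r (ℕ.s≤s m≤n) = ℚ.+-monoʳ-≤ r (·-monoˡ-≤ 0≤r m≤n)

toℚᵘ-·1 : ∀ n → toℚᵘ (n · 1ℚ) ℚᵘ.≃ mkℚᵘ (+ n) 0
toℚᵘ-·1 zero    = *≡* ≡.refl
toℚᵘ-·1 (suc n) = ℚᵘ.≃-trans (ℚ.toℚᵘ-homo-+ 1ℚ (n · 1ℚ))
  (ℚᵘ.≃-trans (ℚᵘ.+-congʳ (toℚᵘ 1ℚ) (toℚᵘ-·1 n))
    (*≡* (≡.cong (λ k → (+ 1 ℤ.+ k) ℤ.* + 1) (ℤ.*-identityʳ (+ n)))))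

-- Denominators are at least 1, so a nonnegative rational is at most its numerator.
≤·1 : ∀ r → ∃[ n ] r ℚ.≤ n · 1ℚ
≤·1 (mkℚ (+ n) d c) = n , ℚ.toℚᵘ-cancel-≤ (ℚᵘ.≤-respʳ-≃ (ℚᵘ.≃-sym (toℚᵘ-·1 n))
  (*≤* (ℤ.*-monoˡ-≤-nonNeg (+ n) (ℤ.+≤+ (ℕ.s≤s ℕ.z≤n)))))
≤·1 (mkℚ -[1+ n ] d c) = 0 , ℚ.<⇒≤ (ℚ.negative⁻¹ _)

TendsToInfinity : (ℕ → ℚ) → Set
TendsToInfinity f = ∀ r → ∃[ N ] ∀ n → N ℕ.≤ n → r ℚ.≤ f n

archimedean : ∀ {ε} → 0ℚ ℚ.< ε → TendsToInfinity (_· ε)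
archimedean {ε} 0<ε r = N , λ n N≤n → ℚ.≤-trans r≤N·ε (·-monoˡ-≤ (ℚ.<⇒≤ 0<ε) N≤n)
  where
  open CommutativeRing ℚ.+-*-commutativeRing using (semiring)
  open Mult semiring using (×-assoc-*)
  instance
    ε-positive : ℚ.Positive ε
    ε-positive = ℚ.positive 0<ε
    ε-nonNeg : ℚ.NonNegative ε
    ε-nonNeg = ℚ.pos⇒nonNeg ε
    ε-nonZero : ℚ.NonZero ε
    ε-nonZero = ℚ.pos⇒nonZero ε
  s : ℚ
  s = r ℚ.* ℚ.1/ ε
  N : ℕ
  N = proj₁ (≤·1 s)
  r≤N·ε : r ℚ.≤ N · ε
  r≤N·ε = begin
    r                       ≡⟨ ℚ.*-identityʳ r ⟨
    r ℚ.* 1ℚ                ≡⟨ ≡.cong (r ℚ.*_) (ℚ.*-inverseˡ ε) ⟨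
    r ℚ.* (ℚ.1/ ε ℚ.* ε)    ≡⟨ ℚ.*-assoc r (ℚ.1/ ε) ε ⟨
    s ℚ.* ε                 ≤⟨ ℚ.*-monoʳ-≤-nonNeg ε (proj₂ (≤·1 s)) ⟩
    N · 1ℚ ℚ.* ε            ≡⟨ ×-assoc-* N 1ℚ ε ⟩
    N · (1ℚ ℚ.* ε)          ≡⟨ ≡.cong (N ·_) (ℚ.*-identityˡ ε) ⟩
    N · ε                   ∎
    where open ℚ.≤-Reasoning

⊓⁺-glb : ∀ {r a b} → [ r ] ≤⁺ a → [ r ] ≤⁺ b → [ r ] ≤⁺ a ⊓⁺ b
⊓⁺-glb {a = nothing}              r≤a     r≤b     = r≤b
⊓⁺-glb {a = just _} {b = nothing} r≤a     r≤b     = r≤a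
⊓⁺-glb {a = just _} {b = just _}  [ r≤a ] [ r≤b ] = [ ℚ.⊓-glb r≤a r≤b ]

⊓⁺-lowerˡ : ∀ {r} a b → [ r ] ≤⁺ a ⊓⁺ b → [ r ] ≤⁺ a
⊓⁺-lowerˡ nothing  b        r≤     = _ ≤⊤⁺
⊓⁺-lowerˡ (just a) nothing  r≤     = r≤
⊓⁺-lowerˡ (just a) (just b) [ r≤ ] = [ ℚ.≤-trans r≤ (ℚ.p⊓q≤p a b) ]

⊓⁺-lowerʳ : ∀ {r} a b → [ r ] ≤⁺ a ⊓⁺ b → [ r ] ≤⁺ b
⊓⁺-lowerʳ nothing  b        r≤     = r≤
⊓⁺-lowerʳ (just a) nothing  r≤     = _ ≤⊤⁺
⊓⁺-lowerʳ (just a) (just b) [ r≤ ] = [ ℚ.≤-trans r≤ (ℚ.p⊓q≤q a b) ]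

+⁺-mono-≤ : ∀ {r s a b} → [ r ] ≤⁺ a → [ s ] ≤⁺ b → [ r ℚ.+ s ] ≤⁺ a +⁺ b
+⁺-mono-≤ [ r≤a ] [ s≤b ]   = [ ℚ.+-mono-≤ r≤a s≤b ]
+⁺-mono-≤ {b = b} [ r≤a ] (_ ≤⊤⁺)  = _ ≤⊤⁺
+⁺-mono-≤ (_ ≤⊤⁺) s≤b       = _ ≤⊤⁺

finite-lowerBound : ∀ a → ∃[ r ] [ r ] ≤⁺ a
finite-lowerBound nothing  = 0ℚ , (_ ≤⊤⁺)
finite-lowerBound (just r) = r , [ ℚ.≤-refl ]

-- Strictness is turned into a rational margin: ∣π₀∣ < 1 becomes ∣π₀∣ ≤ q^(- ε), and a point inside
-- the disc of convergence gets a rate at which the terms decay.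
<⁺⇒+≤⁺ : ∀ {r a} → [ r ] <⁺ a → ∃[ ε ] 0ℚ ℚ.< ε × [ r ℚ.+ ε ] ≤⁺ a
<⁺⇒+≤⁺ {r} {just s} [ r<s ] = s ℚ.- r ,
  ≡.subst (ℚ._< s ℚ.- r) (ℚ.+-inverseʳ r) (ℚ.+-monoˡ-< (ℚ.- r) r<s) ,
  [ ℚ.≤-reflexive (solve 2 (λ r s → r :+ (s :- r) := s) ≡.refl r s) ]
  where open +-*-Solver
<⁺⇒+≤⁺ {r} [ _ ]<⊤⁺ = 1ℚ , ℚ.positive⁻¹ 1ℚ , (_ ≤⊤⁺)

-- Valuation, limits and roots in the completed algebraic closure.

module Valuation {c ℓ a b} {F : Field c ℓ} (C : CompletedAlgebraicClosure F a b) where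
  open CompletedAlgebraicClosure C hiding (zero)
  open List using ([]; _∷_)
  open All using (All; []; _∷_)
  open Exp commutativeSemiring using (_^_; ^-congˡ)
  open SemiringSum semiring
  open RingProperties ring
  open SetoidReasoning setoid

  Val≥ : ℚ → Carrier → Set
  Val≥ r y = [ r ] ≤⁺ v y

  telescope : ∀ x y z → (x - y) + (y - z) ≈ x - z
  telescope x y z = begin
    (x - y) + (y - z)      ≈⟨ +-assoc _ _ _ ⟩
    x + (- y + (y - z))    ≈⟨ +-congˡ (+-assoc _ _ _) ⟨
    x + ((- y + y) - z)    ≈⟨ +-congˡ (+-congʳ (-‿inverseˡ y)) ⟩
    x + (0# - z)           ≈⟨ +-congˡ (+-identityˡ _) ⟩
    x - z                  ∎

  v-0 : v 0# ≡ ⊤⁺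
  v-0 = Equivalence.from (v≡⊤⇔≈0 0#) refl

  Val≥-cong : ∀ {r y z} → y ≈ z → Val≥ r y → Val≥ r z
  Val≥-cong y≈z = ≡.subst ([ _ ] ≤⁺_) (v-cong y≈z)

  Val≥-mono : ∀ {r s y} → r ℚ.≤ s → Val≥ s y → Val≥ r y
  Val≥-mono r≤s = ≤⁺-trans ℚ.≤-trans [ r≤s ]

  Val≥-0 : ∀ {r} → Val≥ r 0#
  Val≥-0 = ≡.subst ([ _ ] ≤⁺_) (≡.sym v-0) (_ ≤⊤⁺)

  Val≥-+ : ∀ {r y z} → Val≥ r y → Val≥ r z → Val≥ r (y + z)
  Val≥-+ {y = y} {z} r≤y r≤z = ≤⁺-trans ℚ.≤-trans (⊓⁺-glb r≤y r≤z) (v-+ y z)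

  Val≥-* : ∀ {r s y z} → Val≥ r y → Val≥ s z → Val≥ (r ℚ.+ s) (y * z)
  Val≥-* {y = y} {z} r≤y s≤z = ≡.subst ([ _ ] ≤⁺_) (≡.sym (v-* y z)) (+⁺-mono-≤ r≤y s≤z)

  double-zero : ∀ {r} → r ℚ.+ r ≡ 0ℚ → r ≡ 0ℚ
  double-zero {r} 2r≡0 = ℚ.≤-antisym
    (·-cancelˡ-≤ 1 (ℚ.≤-reflexive (≡.trans (≡.cong (r ℚ.+_) (ℚ.+-identityʳ r)) 2r≡0)))
    (·-cancelˡ-≤ 1 (ℚ.≤-reflexive (≡.sym (≡.trans (≡.cong (r ℚ.+_) (ℚ.+-identityʳ r)) 2r≡0))))

  v-1 : v 1# ≡ [ 0ℚ ]
  v-1 with v 1# in eq | ≡.trans (≡.sym (v-cong (*-identityˡ 1#))) (v-* 1# 1#)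
  ... | nothing | _    = contradiction (Equivalence.to (v≡⊤⇔≈0 1#) eq) 1≉0
  ... | just r  | r≡2r = ≡.cong [_] (GroupProperties.identityʳ-unique ℚ.+-0-group r r (≡.sym ([]-injective r≡2r)))

  v-neg1 : v (- 1#) ≡ [ 0ℚ ]
  v-neg1 with v (- 1#) | ≡.trans (≡.sym v-1) (≡.trans (v-cong 1≈) (v-* (- 1#) (- 1#)))
    where
    1≈ : 1# ≈ - 1# * - 1#
    1≈ = sym (trans (-1*x≈-x (- 1#)) (-‿involutive 1#))
  ... | just r | 0≡2r = ≡.cong [_] (double-zero (≡.sym ([]-injective 0≡2r)))

  Val≥-neg : ∀ {r y} → Val≥ r y → Val≥ r (- y)
  Val≥-neg {r} {y} r≤y = Val≥-cong (-1*x≈-x y) (≡.subst (λ s → Val≥ s (- 1# * y)) (ℚ.+-identityˡ r)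
    (Val≥-* {y = - 1#} (≡.subst ([ 0ℚ ] ≤⁺_) (≡.sym v-neg1) [ ℚ.≤-refl ]) r≤y))

  Val≥-sub : ∀ {r y z} → Val≥ r y → Val≥ r z → Val≥ r (y - z)
  Val≥-sub r≤y r≤z = Val≥-+ r≤y (Val≥-neg r≤z)

  Val≥-swap : ∀ {r} y z → Val≥ r (y - z) → Val≥ r (z - y)
  Val≥-swap y z r≤ = Val≥-cong (⁻¹-anti-homo‿- y z) (Val≥-neg r≤)

  Val≥-sum : ∀ {r n} (f : Vector Carrier n) → (∀ k → Val≥ r (f k)) → Val≥ r (sum f)
  Val≥-sum {n = zero}  f r≤f = Val≥-0
  Val≥-sum {n = suc n} f r≤f = Val≥-+ (r≤f zero) (Val≥-sum (f ∘ suc) (r≤f ∘ suc))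

  Val≥-1 : Val≥ 0ℚ 1#
  Val≥-1 = ≡.subst ([ 0ℚ ] ≤⁺_) (≡.sym v-1) [ ℚ.≤-refl ]

  Val≥-^ : ∀ {r y} n → Val≥ r y → Val≥ (n · r) (y ^ n)
  Val≥-^ zero    r≤y = Val≥-1
  Val≥-^ (suc n) r≤y = Val≥-* r≤y (Val≥-^ n r≤y)

  v-^ : ∀ {y s} n → v y ≡ [ s ] → v (y ^ n) ≡ [ n · s ]
  v-^ zero    vy = v-1
  v-^ {y} (suc n) vy = ≡.trans (v-* y (y ^ n)) (≡.cong₂ _+⁺_ vy (v-^ n vy))

  Val≥-root : ∀ {r y} n → Val≥ (suc n · r) (y ^ suc n) → Val≥ r y
  Val≥-root {r} {y} n nr≤ with v y in vy
  ... | nothing = _ ≤⊤⁺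
  ... | just s  with ≡.subst ([ suc n · r ] ≤⁺_) (v-^ {y} (suc n) vy) nr≤
  ...   | [ nr≤ns ] = [ ·-cancelˡ-≤ n nr≤ns ]

  -- The valuation decides whether y vanishes: a finite value s of y would give the power the finite
  -- value n · s.
  ^≈0⇒≈0 : ∀ y n → y ^ n ≈ 0# → y ≈ 0#
  ^≈0⇒≈0 y n yⁿ≈0 with v y in vy
  ... | nothing = Equivalence.to (v≡⊤⇔≈0 y) vy
  ... | just s  with ≡.trans (≡.sym (v-^ {y} n vy)) (Equivalence.from (v≡⊤⇔≈0 (y ^ n)) yⁿ≈0)
  ...   | ()

  Val≥-all⇒≈0 : ∀ y → (∀ r → Val≥ r y) → y ≈ 0#
  Val≥-all⇒≈0 y all with v y in vy
  ... | nothing = Equivalence.to (v≡⊤⇔≈0 y) vy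
  ... | just s with all (s ℚ.+ 1ℚ)
  ...   | [ s+1≤s ] = contradiction
    (ℚ.<-≤-trans (≡.subst (ℚ._< s ℚ.+ 1ℚ) (ℚ.+-identityʳ s) (ℚ.+-monoʳ-< s (ℚ.positive⁻¹ 1ℚ))) s+1≤s)
    (ℚ.<-irrefl ≡.refl)

  CauchyAt : ℕ → ℚ → (ℕ → Carrier) → Set
  CauchyAt N r y = ∀ m n → N ℕ.≤ m → N ℕ.≤ n → Val≥ r (y m - y n)

  -- In an ultrametric the limit is as close to `y n` as the later terms are to each other, from the
  -- same index on. Keeping this modulus gives explicit remainders for series.
  Limit : (ℕ → Carrier) → Carrier → Set
  Limit y z = ∀ N r → CauchyAt N r y → ∀ n → N ℕ.≤ n → Val≥ r (y n - z)

  limit : ∀ y → Cauchy y → ∃[ z ] Limit y z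
  limit y cauchy = proj₁ (complete y cauchy) , modulus
    where
    z : Carrier
    z = proj₁ (complete y cauchy)
    modulus : Limit y z
    modulus N r cauchyAt n N≤n with proj₂ (complete y cauchy) r
    ... | M , near = Val≥-cong (telescope (y n) (y k) z)
      (Val≥-+ (cauchyAt n k N≤n (ℕ.m≤m⊔n N M)) (near k (ℕ.m≤n⊔m N M)))
      where
      k : ℕ
      k = N ℕ.⊔ M

  partial : (ℕ → Carrier) → ℕ → Carrier
  partial y n = sum {n} λ k → y (toℕ k)

  partial-suc : ∀ y n → partial y (suc n) ≈ partial y n + y n
  partial-suc y n = trans (sum-init-last (λ k → y (toℕ k)))
    (+-cong (sum-cong-≋ {n} λ k → reflexive (≡.cong y (Fin.toℕ-inject₁ k)))
            (reflexive (≡.cong y (Fin.toℕ-fromℕ n))))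

  -- By the ultrametric inequality adding a term of valuation at least r never spoils the bound, so
  -- small terms alone make a series Cauchy.
  partial-tail : ∀ {y N r} → (∀ k → N ℕ.≤ k → Val≥ r (y k)) →
                 ∀ n → N ℕ.≤ n → Val≥ r (partial y n - partial y N)
  partial-tail {y} {N} {r} small n N≤n with ℕ.≤⇒≤′ N≤n
  ... | ℕ.≤′-refl = Val≥-cong (sym (-‿inverseʳ _)) Val≥-0
  ... | ℕ.≤′-step {n = k} N≤′k = Val≥-cong step
    (Val≥-+ (small k (ℕ.≤′⇒≤ N≤′k)) (partial-tail small k (ℕ.≤′⇒≤ N≤′k)))
    where
    step : y k + (partial y k - partial y N) ≈ partial y (suc k) - partial y N
    step = trans (sym (+-assoc _ _ _)) (+-congʳ (trans (+-comm _ _) (sym (partial-suc y k))))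

  partial-cauchyAt : ∀ {y N r} → (∀ k → N ℕ.≤ k → Val≥ r (y k)) → CauchyAt N r (partial y)
  partial-cauchyAt {y} {N} small m n N≤m N≤n =
    Val≥-cong (telescope (partial y m) (partial y N) (partial y n))
      (Val≥-+ (partial-tail small m N≤m) (Val≥-swap _ _ (partial-tail small n N≤n)))

  module _ where
    open LaurentSeries F using (constant; x; laurentRing; _≈ₗ_; _+ₗ_; vanishes)
    open RingMorphisms laurentRing (CommutativeRing.rawRing commutativeRing)
    open IsRingHomomorphism ι-isHomo using (0#-homo; 1#-homo; +-homo; ⟦⟧-cong)
    open Mult semiring using () renaming (_×_ to _×ᵣ_)
    private
      module F = Field F
      module MultF = Mult F.semiring

    Val≥-ιx : Val≥ 1ℚ (ι x)
    Val≥-ιx = ≡.subst ([ 1ℚ ] ≤⁺_) (≡.sym (v-extends x (+ 1) (vanishes x) F.1≉0)) [ ℚ.≤-refl ]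

    constant-+ : ∀ s t → constant (s F.+ t) ≈ₗ constant s +ₗ constant t
    constant-+ s t j with j ℤ.≟ + 0
    ... | yes _ = F.refl
    ... | no  _ = F.sym (F.+-identityˡ _)

    ι-constant-× : ∀ n → ι (constant (n MultF.× F.1#)) ≈ n ×ᵣ 1#
    ι-constant-× zero    = 0#-homo
    ι-constant-× (suc n) = trans (⟦⟧-cong (constant-+ _ _))
      (trans (+-homo _ _) (+-cong 1#-homo (ι-constant-× n)))

    ×1≈0 : ∀ n → n MultF.× F.1# F.≈ F.0# → n ×ᵣ 1# ≈ 0#
    ×1≈0 n n≈0 = trans (sym (ι-constant-× n)) (trans (⟦⟧-cong constant-cong) 0#-homo)
      where
      constant-cong : constant (n MultF.× F.1#) ≈ₗ constant F.0#
      constant-cong j with j ℤ.≟ + 0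
      ... | yes _ = n≈0
      ... | no  _ = F.refl

    algebraic-0 : Algebraic 0#
    algebraic-0 = constant F.0# ∷ [] , trans (+-cong 0#-homo (zeroˡ _)) (+-identityˡ _)

  open Frobenius commutativeRing using (Additive; additive-neg; additive-prime; additive-^)

  ^-difference : ∀ {n} → Additive n → ∀ y z → (y - z) ^ n ≈ y ^ n - z ^ n
  ^-difference {n} n+ y z = trans (n+ y (- z)) (+-congˡ (additive-neg {n} n+ z))

  evalMonic-pure : ∀ n z y → evalMonic (CommutativeRing.rawRing commutativeRing)
                               (z ∷ List.replicate n 0#) y ≈ z + y ^ suc n
  evalMonic-pure n z y = +-congˡ (*-congˡ (zeros n))
    where
    zeros : ∀ n → evalMonic (CommutativeRing.rawRing commutativeRing) (List.replicate n 0#) y ≈ y ^ n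
    zeros zero    = refl
    zeros (suc n) = trans (+-identityˡ _) (*-congˡ (zeros n))

  -- Only algebraic elements are given to have roots; since n-th powers are additive,
  -- roots of approximations form a Cauchy sequence.
  root : ∀ n → Additive (suc n) → ∀ y → ∃[ z ] z ^ suc n ≈ y
  root n n+ y = z , x∙y⁻¹≈ε⇒x≈y _ _ (Val≥-all⇒≈0 _ close)
    where
    -- The polynomial to be solved is w + X^(n+1), whose roots satisfy X^(n+1) = -w; so w has to
    -- approximate -y.
    approx : ∀ k → ∃[ w ] Algebraic w × Val≥ (k · 1ℚ) (- y - w)
    approx k = dense (- y) (k · 1ℚ)
    w ρ : ℕ → Carrier
    w k = proj₁ (approx k)
    rootOf : ∀ k → ∃[ u ] Algebraic u × evalMonic (CommutativeRing.rawRing commutativeRing)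
                                          (w k ∷ List.replicate n 0#) u ≈ 0#
    rootOf k = algebraicallyClosed (w k) (List.replicate n 0#)
      (proj₁ (proj₂ (approx k)) ∷ replicate-algebraic n)
      where
      replicate-algebraic : ∀ n → All Algebraic (List.replicate n 0#)
      replicate-algebraic zero    = []
      replicate-algebraic (suc n) = algebraic-0 ∷ replicate-algebraic n
    ρ k = proj₁ (rootOf k)

    ρ^ : ∀ k → ρ k ^ suc n ≈ - w k
    ρ^ k = +-inverseʳ-unique _ _
      (trans (sym (evalMonic-pure n (w k) (ρ k))) (proj₂ (proj₂ (rootOf k))))

    near : ∀ k → Val≥ (k · 1ℚ) (ρ k ^ suc n - y)
    near k = Val≥-cong (trans (+-comm _ _) (+-congʳ (sym (ρ^ k)))) (proj₂ (proj₂ (approx k)))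

    cauchyAt : ∀ N r → suc n · r ℚ.≤ N · 1ℚ → CauchyAt N r ρ
    cauchyAt N r nr≤N j k N≤j N≤k = Val≥-root n
      (Val≥-cong (trans (telescope _ _ _) (sym (^-difference {suc n} n+ (ρ j) (ρ k))))
        (Val≥-+ (bound j N≤j) (Val≥-swap _ _ (bound k N≤k))))
      where
      bound : ∀ k → N ℕ.≤ k → Val≥ (suc n · r) (ρ k ^ suc n - y)
      bound k N≤k = Val≥-mono
        (ℚ.≤-trans nr≤N (·-monoˡ-≤ (ℚ.<⇒≤ (ℚ.positive⁻¹ 1ℚ)) N≤k)) (near k)

    limitρ : ∃[ z ] Limit ρ z
    limitρ = limit ρ λ r → proj₁ (≤·1 (suc n · r)) , cauchyAt _ r (proj₂ (≤·1 (suc n · r)))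
    z : Carrier
    z = proj₁ limitρ

    close : ∀ r → Val≥ r (z ^ suc n - y)
    close r = Val≥-cong (telescope _ _ _) (Val≥-+
      (Val≥-swap (ρ K ^ suc n) (z ^ suc n)
        (Val≥-cong (^-difference {suc n} n+ (ρ K) z) (Val≥-mono r≤ns (Val≥-^ (suc n) ρ-z))))
      (Val≥-mono (ℚ.≤-trans r≤ns (proj₂ (≤·1 (suc n · s)))) (near K)))
      where
      s : ℚ
      s = 0ℚ ℚ.⊔ r
      r≤ns : r ℚ.≤ suc n · s
      r≤ns = ℚ.≤-trans (ℚ.p≤q⊔p 0ℚ r) (≡.subst (ℚ._≤ suc n · s) (ℚ.+-identityʳ s)
        (ℚ.+-monoʳ-≤ s (·-nonNeg n (ℚ.p≤p⊔q 0ℚ r))))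
      K : ℕ
      K = proj₁ (≤·1 (suc n · s))
      ρ-z : Val≥ s (ρ K - z)
      ρ-z = proj₂ limitρ K s (cauchyAt K s (proj₂ (≤·1 (suc n · s)))) K ℕ.≤-refl

-- Powers of q, entrywise Frobenius and series of matrices.

2≤primePower : ∀ {q} → IsPrimePower q → 2 ℕ.≤ q
2≤primePower (p , suc e , pp , _ , ≡.refl) = ℕ.≤-trans (ℕ.nonTrivial⇒n>1 p)
  (ℕ.m≤m*n p (p ℕ.^ e) {{ℕ.m^n≢0 p e}})
  where
  instance
    _ = prime⇒nonTrivial pp
    _ = ℕ.nonTrivial⇒nonZero p

n≤m^n : ∀ {m} → 2 ℕ.≤ m → ∀ n → suc n ℕ.≤ m ℕ.^ n
n≤m^n 2≤m zero    = ℕ.≤-refl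
n≤m^n {m} 2≤m (suc n) = begin
  suc (suc n)              ≤⟨ ℕ.s≤s (ℕ.m≤m+n (suc n) n) ⟩
  suc (suc n ℕ.+ n)        ≡⟨ ≡.cong suc (ℕ.+-suc n n) ⟨
  suc n ℕ.+ suc n          ≡⟨ ≡.cong (suc n ℕ.+_) (ℕ.+-identityʳ (suc n)) ⟨
  2 ℕ.* suc n              ≤⟨ ℕ.*-mono-≤ 2≤m (n≤m^n 2≤m n) ⟩
  m ℕ.* m ℕ.^ n            ∎
  where open ℕ.≤-Reasoning

·-distrib-sub : ∀ n r s → n · (r ℚ.- s) ≡ n · r ℚ.- n · s
·-distrib-sub n r s = begin
  n · (r ℚ.- s)                       ≡⟨ solve 2 (λ x y → x := (x :+ y) :- y) ≡.refl _ (n · s) ⟩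
  n · (r ℚ.- s) ℚ.+ n · s ℚ.- n · s   ≡⟨ ≡.cong (ℚ._- n · s) (×-distrib-+ (r ℚ.- s) s n) ⟨
  n · (r ℚ.- s ℚ.+ s) ℚ.- n · s       ≡⟨ ≡.cong (λ x → n · x ℚ.- n · s) (solve 2 (λ r s → r :- s :+ s := r) ≡.refl r s) ⟩
  n · r ℚ.- n · s                     ∎
  where
  open ≡.≡-Reasoning
  open +-*-Solver

module MatrixSeries {c ℓ a b} (q : ℕ) (pp : IsPrimePower q)
                (F : FiniteField q c ℓ) (C : CompletedAlgebraicClosure (FiniteField.field′ F) a b)
                {m : ℕ} where
  open Carlitz F C using (τ^; vᴹ; partialSum; SumsTo; powerTerms)
  open CompletedAlgebraicClosure C hiding (zero)
  open Valuation C
  open Exp commutativeSemiring using (_^_; ^-congˡ; ^-congʳ; ^-assocʳ; ^-distrib-*)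
  open MatrixRing commutativeRing
  open Frobenius commutativeRing
  open SemiringSum semiring
  open RingProperties ring
  open Mult semiring using (×1-homo-*; ×-homo-1) renaming (_×_ to _×ᵣ_)
  open SetoidReasoning setoid
  module M = Ring (matrixRing m)

  ×1-homo-^ : ∀ p e → (p ℕ.^ e) ×ᵣ 1# ≈ (p ×ᵣ 1#) ^ e
  ×1-homo-^ p zero    = ×-homo-1 1#
  ×1-homo-^ p (suc e) = trans (×1-homo-* p (p ℕ.^ e)) (*-congˡ (×1-homo-^ p e))

  q×1≈0 : q ×ᵣ 1# ≈ 0#
  q×1≈0 = ×1≈0 q (FiniteFieldCharacteristic.q×1≈0 F)

  -- The finite field gives q · 1 = 0. As q · 1 = (p · 1)^e in a field with a valuation, already p ·
  -- 1 = 0, so the p-th power is additive and with it its e-th iterate.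
  q-additive : Additive q
  q-additive = from pp
    where
    from : IsPrimePower q → Additive q
    from (p , e , p-prime , _ , q≡p^e) = ≡.subst Additive (≡.sym q≡p^e)
      (additive-^ p e (additive-prime p-prime (^≈0⇒≈0 (p ×ᵣ 1#) e
        (trans (sym (×1-homo-^ p e)) (trans (reflexive (≡.cong (_×ᵣ 1#) (≡.sym q≡p^e))) q×1≈0)))))

  q^-additive : ∀ k → Additive (q ℕ.^ k)
  q^-additive k = additive-^ q k q-additive

  2≤q : 2 ℕ.≤ q
  2≤q = 2≤primePower pp

  k<q^k : ∀ k → k ℕ.< q ℕ.^ k
  k<q^k = n≤m^n 2≤q

  q^-isHomo : ∀ k → IsOperationHomo rawRing commutativeRing (_^ (q ℕ.^ k))
  q^-isHomo k = record
    { +-homo = q^-additive k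
    ; *-homo = λ x y → ^-distrib-* x y (q ℕ.^ k)
    ; -‿homo = additive-neg {q ℕ.^ k} (q^-additive k)
    ; 0-homo = additive-0 {q ℕ.^ k} (q^-additive k)
    ; 1-homo = 1^ (q ℕ.^ k)
    }
    where open CommutativeRing commutativeRing using (rawRing)

  module Frobeniusᴹ (k : ℕ) = Transport commutativeRing {m} (_^ (q ℕ.^ k)) (^-congˡ (q ℕ.^ k)) (q^-isHomo k)

  τ-cong : ∀ k {A B : Mat m} → A ≈ᴹ B → τ^ k A ≈ᴹ τ^ k B
  τ-cong k A≈B i j = ^-congˡ (q ℕ.^ k) (A≈B i j)

  τ-τ : ∀ j k (A : Mat m) → τ^ j (τ^ k A) ≈ᴹ τ^ (j ℕ.+ k) A
  τ-τ j k A i l = trans (^-assocʳ (A i l) (q ℕ.^ k) (q ℕ.^ j))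
    (^-congʳ (A i l) (≡.trans (ℕ.*-comm (q ℕ.^ k) (q ℕ.^ j)) (≡.sym (ℕ.^-distribˡ-+-* q j k))))

  τ-0 : ∀ (A : Mat m) → τ^ 0 A ≈ᴹ A
  τ-0 A i j = *-identityʳ _

  MVal≥ : ℚ → Mat m → Set
  MVal≥ r A = ∀ i j → Val≥ r (A i j)

  foldr-⊓⁺-glb : ∀ {n r} (f : Vector (ℚ ⁺) n) → (∀ i → [ r ] ≤⁺ f i) → [ r ] ≤⁺ Vector.foldr _⊓⁺_ ⊤⁺ f
  foldr-⊓⁺-glb {zero}  f r≤f = _ ≤⊤⁺
  foldr-⊓⁺-glb {suc n} f r≤f = ⊓⁺-glb (r≤f zero) (foldr-⊓⁺-glb (f ∘ suc) (r≤f ∘ suc))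

  foldr-⊓⁺-lower : ∀ {n r} (f : Vector (ℚ ⁺) n) → [ r ] ≤⁺ Vector.foldr _⊓⁺_ ⊤⁺ f → ∀ i → [ r ] ≤⁺ f i
  foldr-⊓⁺-lower f r≤ zero    = ⊓⁺-lowerˡ (f zero) _ r≤
  foldr-⊓⁺-lower f r≤ (suc i) = foldr-⊓⁺-lower (f ∘ suc) (⊓⁺-lowerʳ (f zero) _ r≤) i

  MVal≥⇒vᴹ : ∀ {r} (A : Mat m) → MVal≥ r A → [ r ] ≤⁺ vᴹ A
  MVal≥⇒vᴹ A r≤A = foldr-⊓⁺-glb {m} _ λ i → foldr-⊓⁺-glb {m} _ (r≤A i)

  vᴹ⇒MVal≥ : ∀ {r} (A : Mat m) → [ r ] ≤⁺ vᴹ A → MVal≥ r A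
  vᴹ⇒MVal≥ A r≤ i j = foldr-⊓⁺-lower {m} _ (foldr-⊓⁺-lower {m} _ r≤ i) j

  MVal≥-* : ∀ {r s} (A B : Mat m) → MVal≥ r A → MVal≥ s B → MVal≥ (r ℚ.+ s) (A *ᴹ B)
  MVal≥-* A B r≤A s≤B i j = Val≥-sum {n = m} _ λ k → Val≥-* (r≤A i k) (s≤B k j)

  MVal≥-τ : ∀ {r} k (A : Mat m) → MVal≥ r A → MVal≥ ((q ℕ.^ k) · r) (τ^ k A)
  MVal≥-τ k A r≤A i j = Val≥-^ (q ℕ.^ k) (r≤A i j)

  MVal≥-mono : ∀ {r s} (A : Mat m) → r ℚ.≤ s → MVal≥ s A → MVal≥ r A
  MVal≥-mono A r≤s s≤A i j = Val≥-mono r≤s (s≤A i j)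

  MVal≥-Iᴹ : MVal≥ 0ℚ Iᴹ
  MVal≥-Iᴹ i j with i Fin.≟ j
  ... | yes _ = Val≥-1
  ... | no  _ = Val≥-0

  MVal≥-scalar : ∀ {r} y → Val≥ r y → MVal≥ r (scalar y)
  MVal≥-scalar {r} y r≤y i j =
    ≡.subst (λ s → Val≥ s (y * Iᴹ i j)) (ℚ.+-identityʳ r) (Val≥-* r≤y (MVal≥-Iᴹ i j))

  Small : (ℕ → Mat m) → ℕ → ℚ → Set
  Small A N r = ∀ k → N ℕ.≤ k → MVal≥ r (A k)

  Vanishing : (ℕ → Mat m) → Set
  Vanishing A = ∀ r → ∃[ N ] Small A N r

  -- Sharper than `SumsTo`: any common bound on the terms from N on also bounds the remainders from
  -- N on.
  HasTails : (ℕ → Mat m) → Mat m → Set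
  HasTails A S = ∀ N r → Small A N r → ∀ n → N ℕ.≤ n → MVal≥ r (partialSum A n -ᴹ S)

  series : ∀ A → Vanishing A → ∃[ S ] HasTails A S
  series A vanishing = (λ i j → proj₁ (entry i j)) ,
    λ N r small n N≤n i j → proj₂ (entry i j) N r (partial-cauchyAt λ k N≤k → small k N≤k i j) n N≤n
    where
    entry : ∀ i j → ∃[ z ] Limit (partial λ k → A k i j) z
    entry i j = limit _ λ r → proj₁ (vanishing r) ,
      partial-cauchyAt λ k N≤k → proj₂ (vanishing r) k N≤k i j

  tails⇒sumsTo : ∀ {A S} → Vanishing A → HasTails A S → SumsTo A S
  tails⇒sumsTo {A} {S} vanishing tails r = proj₁ (vanishing r) ,
    λ n N≤n → MVal≥⇒vᴹ (partialSum A n -ᴹ S) (tails _ r (proj₂ (vanishing r)) n N≤n)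

  partialSum-cong : ∀ {A B : ℕ → Mat m} → (∀ k → A k ≈ᴹ B k) → ∀ n → partialSum A n ≈ᴹ partialSum B n
  partialSum-cong A≈B n i j = sum-cong-≋ {n} λ k → A≈B (toℕ k) i j

  sumsTo-unique : ∀ {A B S T} → (∀ k → A k ≈ᴹ B k) → SumsTo A S → SumsTo B T → S ≈ᴹ T
  sumsTo-unique {A} {B} {S} {T} A≈B sumS sumT i j = x∙y⁻¹≈ε⇒x≈y _ _ (Val≥-all⇒≈0 _ close)
    where
    close : ∀ r → Val≥ r (S i j - T i j)
    close r = Val≥-cong (telescope _ _ _) (Val≥-+
      (Val≥-swap _ _ (vᴹ⇒MVal≥ (partialSum A n -ᴹ S) (proj₂ (sumS r) n (ℕ.m≤m⊔n _ _)) i j))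
      (Val≥-cong (+-congʳ (sym (partialSum-cong A≈B n i j)))
        (vᴹ⇒MVal≥ (partialSum B n -ᴹ T) (proj₂ (sumT r) n (ℕ.m≤n⊔m _ _)) i j)))
      where
      n : ℕ
      n = proj₁ (sumS r) ℕ.⊔ proj₁ (sumT r)

  sumsTo-cong : ∀ {A S T} → S ≈ᴹ T → SumsTo A S → SumsTo A T
  sumsTo-cong {A} {S} {T} S≈T sumS r = proj₁ (sumS r) , λ n N≤n →
    MVal≥⇒vᴹ (partialSum A n -ᴹ T) λ i j → Val≥-cong (+-congˡ (-‿cong (S≈T i j)))
      (vᴹ⇒MVal≥ (partialSum A n -ᴹ S) (proj₂ (sumS r) n N≤n) i j)

  *ᴹ-partialSum : ∀ P (A : ℕ → Mat m) n → P *ᴹ partialSum A n ≈ᴹ partialSum (λ k → P *ᴹ A k) n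
  *ᴹ-partialSum P A n i j = trans (sum-cong-≋ {m} λ k → *-distribˡ-sum {n} _ _) (∑-comm {m} {n} _)

  partialSum-*ᴹ : ∀ P (A : ℕ → Mat m) n → partialSum A n *ᴹ P ≈ᴹ partialSum (λ k → A k *ᴹ P) n
  partialSum-*ᴹ P A n i j = trans (sum-cong-≋ {m} λ k → *-distribʳ-sum {n} _ _) (∑-comm {m} {n} _)

  τ-partialSum : ∀ l (A : ℕ → Mat m) n → τ^ l (partialSum A n) ≈ᴹ partialSum (λ k → τ^ l (A k)) n
  τ-partialSum l A n i j = DetHomo.sum-homo (q^-isHomo l) {n} _

  powerTerms-cong : ∀ P {s t : Mat m} → s ≈ᴹ t → ∀ k → powerTerms P s k ≈ᴹ powerTerms P t k
  powerTerms-cong P s≈t k = M.*-congˡ {P k} (τ-cong k s≈t)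

-- Triangular double sums and multiplication by x.

module TriangularSum {c ℓ} (R : CommutativeRing c ℓ) where
  open CommutativeRing R hiding (zero)
  open SemiringSum semiring

  -- Removing the summands with j = 0 leaves the same claim for the shifted f, one size smaller; at
  -- k = 0 what remains of the inner sum is empty.
  triangular : ∀ n (f : ℕ → ℕ → Carrier) →
    sum {n} (λ k → sum {suc (toℕ k)} λ j → f (toℕ j) (toℕ k ℕ.∸ toℕ j)) ≈
    sum {n} (λ j → sum {n ℕ.∸ toℕ j} λ l → f (toℕ j) (toℕ l))
  triangular zero    f = refl
  triangular (suc n) f = trans
    (∑-distrib-+ {suc n} (λ k → f 0 (toℕ k)) (λ k → sum {toℕ k} λ j → f (suc (toℕ j)) (toℕ k ℕ.∸ suc (toℕ j))))
    (+-congˡ (trans (+-identityˡ _) (triangular n λ j → f (suc j))))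

-- The coefficients of x t do not depend on the bound recorded with t.
module Shift {c ℓ} (F : Field c ℓ) where
  open Field F hiding (zero)
  open LaurentSeries F
  open MatrixRing commutativeRing using (sum-zero)

  coeff-x* : ∀ t j → coeff (x *ₗ t) j ≈ coeff t (j ℤ.- + 1)
  coeff-x* t j = trans (+-cong (*-identityˡ _) (sum-zero
      {ℤ.∣ j ℤ.- (+ 1 ℤ.+ bound t) ∣} λ i → zeroˡ _))
    (+-identityʳ _)

  x*-cong : ∀ s t → s ≈ₗ t → x *ₗ s ≈ₗ x *ₗ t
  x*-cong s t s≈t j = trans (coeff-x* s j) (trans (s≈t (j ℤ.- + 1)) (sym (coeff-x* t j)))

-- The coefficients wₖ: existence and growth.

module CarlitzEquation {c ℓ a b} (q : ℕ) (pp : IsPrimePower q)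
  (F : FiniteField q c ℓ) (C : CompletedAlgebraicClosure (FiniteField.field′ F) a b) where

  private
    module Z = Carlitz F C

  module Coefficients {m : ℕ} (π : ℕ → Z.Mat m)
    (λs : Vector Z.Carrier m) (spectrum : Z.IsSpectrum (π 0) λs)
    (nonresonant : ∀ i j k → 1 ℕ.≤ k → ¬ (λs i Z.- λs j Z.^ (q ℕ.^ k) Z.≈ Z.⟦ k ⟧)) where

    open Z using (⟦_⟧; τ^; vᴹ; partialSum; SumsTo; powerTerms)
    open CompletedAlgebraicClosure C hiding (zero)
    open Valuation C
    open Exp commutativeSemiring using (_^_; ^-congˡ)
    open MatrixSeries q pp F C {m}
    open MatrixRing commutativeRing
    open Sylvester commutativeRing {m}
    open Frobenius commutativeRing
    open SemiringSum semiring
    open RingProperties ring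
    open LaurentSeries (FiniteField.field′ F) using (x)
    module MR = RingProperties (matrixRing m)
    module MReasoning = SetoidReasoning M.setoid

    annihilatedLeft : AnnihilatesLeft λs (π 0)
    annihilatedLeft = Spectrum.annihilatesLeft commutativeRing (π 0) λs spectrum

    annihilatedRight : AnnihilatesRight λs (π 0)
    annihilatedRight = Spectrum.annihilatesRight commutativeRing (π 0) λs spectrum

    inverseˡ : ∀ y → ¬ (y ≈ 0#) → ∃[ z ] z * y ≈ 1#
    inverseˡ y y≉0 = proj₁ (inverse y y≉0) , trans (*-comm _ _) (proj₂ (inverse y y≉0))

    sub-sub : ∀ y z → y - (y - z) ≈ z
    sub-sub y z = begin
      y - (y - z)     ≈⟨ +-congˡ (⁻¹-anti-homo‿- y z) ⟩
      y + (z - y)     ≈⟨ +-comm _ _ ⟩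
      z - y + y       ≈⟨ +-assoc _ _ _ ⟩
      z + (- y + y)   ≈⟨ +-congˡ (-‿inverseˡ y) ⟩
      z + 0#          ≈⟨ +-identityʳ z ⟩
      z               ∎
      where open SetoidReasoning setoid

    -- Comparing coefficients of τᵏg in τdu = P(τ)u gives wₖ (T^ k) = ∑_{j ≤ k} πⱼ τʲ(wₖ₋ⱼ), where
    -- the term j = 0 is moved to the left and makes this a Sylvester equation for wₖ.
    T^ : ℕ → Mat m
    T^ k = scalar ⟦ k ⟧ +ᴹ τ^ k (π 0)

    step : ∀ k (r : Mat m) → 1 ℕ.≤ k → ∃[ w ] w *ᴹ T^ k -ᴹ π 0 *ᴹ w ≈ᴹ r
    step k r 1≤k = sylvester-scalar (π 0) (τ^ k (π 0)) λs (λ j → λs j ^ (q ℕ.^ k))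
      (λ i j → proj₁ (unit i j)) ⟦ k ⟧ (λ i j → proj₂ (unit i j)) annihilatedLeft
      (Frobeniusᴹ.map-annihilatesRight k λs (π 0) annihilatedRight) r
      where
      -- If this difference vanished, λᵢ - λⱼ^(qᵏ) would equal [k], the excluded resonance.
      unit : ∀ i j → ∃[ t ] t * (λs j ^ (q ℕ.^ k) - (λs i - ⟦ k ⟧)) ≈ 1#
      unit i j = inverseˡ _ λ eq → nonresonant i j k 1≤k
        (trans (+-congˡ (-‿cong (x∙y⁻¹≈ε⇒x≈y _ _ eq))) (sub-sub (λs i) ⟦ k ⟧))

    -- The right side of the recursion for the coefficient with index n + 1: l stands for j - 1, and
    -- `h l` for the coefficient with index n - l.
    convolution : (ℕ → Mat m) → ℕ → Mat m
    convolution h n = partialSum (λ l → π (suc l) *ᴹ τ^ (suc l) (h l)) (suc n)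

    -- history n d is w (n - d)
    history : ℕ → ℕ → Mat m
    history zero    d       = Iᴹ
    history (suc n) zero    = proj₁ (step (suc n) (convolution (history n) n) (ℕ.s≤s ℕ.z≤n))
    history (suc n) (suc d) = history n d

    w : ℕ → Mat m
    w n = history n 0

    -- This holds also for d > n, since there the default value and truncated subtraction both yield
    -- `w 0`.
    history-w : ∀ n d → history n d ≡ w (n ℕ.∸ d)
    history-w n       zero    = ≡.refl
    history-w zero    (suc d) = ≡.refl
    history-w (suc n) (suc d) = history-w n d

    recurrence : ∀ n → w (suc n) *ᴹ T^ (suc n) -ᴹ π 0 *ᴹ w (suc n) ≈ᴹ
                       convolution (λ l → w (n ℕ.∸ l)) n
    recurrence n i j = trans
      (proj₂ (step (suc n) (convolution (history n) n) (ℕ.s≤s ℕ.z≤n)) i j)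
      (partialSum-cong (λ l i j → reflexive (≡.cong (λ h → (π (suc l) *ᴹ τ^ (suc l) h) i j) (history-w n l)))
        (suc n) i j)

    -- The recursion with the term j = 0 moved back to the right. At k = 0 both sides are π₀,
    -- because w₀ = I and [0] = 0.
    w-convolution : ∀ k → w k *ᴹ T^ k ≈ᴹ partialSum (λ j → π j *ᴹ τ^ j (w (k ℕ.∸ j))) (suc k)
    w-convolution zero i j = begin
      (Iᴹ *ᴹ T^ 0) i j                    ≈⟨ *ᴹ-identityˡ (T^ 0) i j ⟩
      ⟦ 0 ⟧ * Iᴹ i j + π 0 i j ^ 1        ≈⟨ +-cong (*-congʳ zero-bracket) (τ-0 (π 0) i j) ⟩
      0# * Iᴹ i j + π 0 i j               ≈⟨ trans (+-congʳ (zeroˡ _)) (+-identityˡ _) ⟩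
      π 0 i j                             ≈⟨ *ᴹ-identityʳ (π 0) i j ⟨
      (π 0 *ᴹ Iᴹ) i j                     ≈⟨ M.*-congˡ {π 0} (τ-0 Iᴹ) i j ⟨
      (π 0 *ᴹ τ^ 0 Iᴹ) i j                ≈⟨ +-identityʳ _ ⟨
      (π 0 *ᴹ τ^ 0 Iᴹ) i j + 0#           ∎
      where
      open SetoidReasoning setoid
      zero-bracket : ⟦ 0 ⟧ ≈ 0#
      zero-bracket = trans (+-congʳ (*-identityʳ _)) (-‿inverseʳ _)
    w-convolution (suc n) i j = begin
      W                                  ≈⟨ sub-sub P W ⟨
      P - (P - W)                        ≈⟨ +-congˡ (⁻¹-anti-homo‿- P W) ⟩
      P + (W - P)                        ≈⟨ +-cong (sym (M.*-congˡ {π 0} (τ-0 (w (suc n))) i j)) (recurrence n i j) ⟩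
      (π 0 *ᴹ τ^ 0 (w (suc n))) i j + convolution (λ l → w (n ℕ.∸ l)) n i j ∎
      where
      open SetoidReasoning setoid
      W P : Carrier
      W = (w (suc n) *ᴹ T^ (suc n)) i j
      P = (π 0 *ᴹ w (suc n)) i j

    -- The nonresonance condition with i = j and k = 1 says that -x is not an eigenvalue.
    eigenvalue≉-x : ∀ j → ¬ (λs j - - ι x ≈ 0#)
    eigenvalue≉-x j eq = nonresonant j j 1 ℕ.≤-refl (begin
      λs j - λs j ^ (q ℕ.^ 1)          ≈⟨ +-cong λ≈-x (-‿cong (^-congˡ (q ℕ.^ 1) λ≈-x)) ⟩
      - ι x - (- ι x) ^ (q ℕ.^ 1)      ≈⟨ +-congˡ (-‿cong (additive-neg {q ℕ.^ 1} (q^-additive 1) (ι x))) ⟩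
      - ι x - - (ι x ^ (q ℕ.^ 1))      ≈⟨ +-congˡ (-‿involutive _) ⟩
      - ι x + ι x ^ (q ℕ.^ 1)          ≈⟨ +-comm _ _ ⟩
      ⟦ 1 ⟧                            ∎)
      where
      open SetoidReasoning setoid
      λ≈-x : λs j ≈ - ι x
      λ≈-x = x∙y⁻¹≈ε⇒x≈y _ _ eq

    resolvent : ∃[ G ] G *ᴹ (π 0 -ᴹ scalar (- ι x)) ≈ᴹ Iᴹ
    resolvent = rightDivide-scalar (π 0) λs (λ j → proj₁ (unit j)) (- ι x) (λ j → proj₂ (unit j))
      annihilatedRight Iᴹ
      where
      unit : ∀ j → ∃[ t ] t * (λs j - - ι x) ≈ 1#
      unit j = inverseˡ _ (eigenvalue≉-x j)

    G : Mat m
    G = proj₁ resolvent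

    -- T^ k differs from -x by E^ k, which tends to 0; so for large k the Sylvester
    -- operator is a small perturbation of -(π₀ + x).
    E^ : ℕ → Mat m
    E^ k = scalar (ι x ^ (q ℕ.^ k)) +ᴹ τ^ k (π 0)

    T^≈ : ∀ k → T^ k ≈ᴹ E^ k -ᴹ scalar (ι x)
    T^≈ k i j = trans (+-congʳ ([y-z]x≈yx-zx _ _ _))
      (trans (+-assoc _ _ _) (trans (+-congˡ (+-comm _ _)) (sym (+-assoc _ _ _))))

    -- As x is central, w (E - x) - π₀ w = r reads (π₀ + x) w = w E - r, and `G` is a left inverse
    -- of π₀ + x.
    resolvent-equation : ∀ k (w r : Mat m) → w *ᴹ T^ k -ᴹ π 0 *ᴹ w ≈ᴹ r →
                         w ≈ᴹ G *ᴹ (w *ᴹ E^ k -ᴹ r)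
    resolvent-equation k w r eq = begin
      w                                        ≈⟨ *ᴹ-identityˡ w ⟨
      Iᴹ *ᴹ w                                  ≈⟨ M.*-congʳ {w} (proj₂ resolvent) ⟨
      G *ᴹ (π 0 -ᴹ scalar (- ι x)) *ᴹ w        ≈⟨ *ᴹ-assoc G (π 0 -ᴹ scalar (- ι x)) w ⟩
      G *ᴹ ((π 0 -ᴹ scalar (- ι x)) *ᴹ w)      ≈⟨ M.*-congˡ {G} rearranged ⟩
      G *ᴹ (w *ᴹ E^ k -ᴹ r)                    ∎
      where
      module R = SetoidReasoning setoid
      open MReasoning
      rearranged : (π 0 -ᴹ scalar (- ι x)) *ᴹ w ≈ᴹ w *ᴹ E^ k -ᴹ r
      rearranged i j = R.begin
        ((π 0 -ᴹ scalar (- ι x)) *ᴹ w) i j           R.≈⟨ MR.[y-z]x≈yx-zx w (π 0) (scalar (- ι x)) i j ⟩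
        P - (scalar (- ι x) *ᴹ w) i j                R.≈⟨ +-congˡ (-‿cong (scalar-*ᴹ (- ι x) w i j)) ⟩
        P - (- ι x * w i j)                          R.≈⟨ +-congˡ (trans (-‿cong (sym (-‿distribˡ-* _ _))) (-‿involutive _)) ⟩
        P + X                                        R.≈⟨ sub-sub W (P + X) ⟨
        W - (W - (P + X))                            R.≈⟨ +-congˡ (-‿cong (+-congˡ (-‿cong (+-comm P X)))) ⟩
        W - (W - (X + P))                            R.≈⟨ +-congˡ (-‿cong (+-congˡ (-‿+-comm X P))) ⟨
        W - (W + (- X - P))                          R.≈⟨ +-congˡ (-‿cong (+-assoc W (- X) (- P))) ⟨
        W - ((W - X) - P)                            R.≈⟨ +-congˡ (-‿cong (trans (+-congʳ (sym wT)) (eq i j))) ⟩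
        W - r i j                                    R.∎
        where
        W P X : Carrier
        W = (w *ᴹ E^ k) i j
        P = (π 0 *ᴹ w) i j
        X = ι x * w i j
        wT : (w *ᴹ T^ k) i j ≈ W - X
        wT = trans (M.*-congˡ {w} (T^≈ k) i j) (trans (MR.x[y-z]≈xy-xz w (E^ k) (scalar (ι x)) i j)
          (+-congˡ (-‿cong (*ᴹ-scalar (ι x) w i j))))

    module Bounds (e : ℚ) (π≥e : ∀ k → MVal≥ e (π k))
                  (ε : ℚ) (0<ε : 0ℚ ℚ.< ε) (π₀≥ε : MVal≥ ε (π 0)) where

      -- A common decay rate for the two summands of `E^`: x has valuation at least 1, and π₀ at
      -- least ε.
      δ : ℚ
      δ = ε ℚ.⊓ 1ℚ

      0<δ : 0ℚ ℚ.< δ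
      0<δ = positive-⊓ (ℚ.≤-total ε 1ℚ)
        where
        positive-⊓ : _ → 0ℚ ℚ.< δ
        positive-⊓ (inj₁ ε≤1) = ≡.subst (0ℚ ℚ.<_) (≡.sym (ℚ.p≤q⇒p⊓q≡p ε≤1)) 0<ε
        positive-⊓ (inj₂ 1≤ε) = ≡.subst (0ℚ ℚ.<_) (≡.sym (ℚ.p≥q⇒p⊓q≡q 1≤ε)) (ℚ.positive⁻¹ 1ℚ)

      E≥ : ∀ k → MVal≥ ((q ℕ.^ k) · δ) (E^ k)
      E≥ k i j = Val≥-+
        (MVal≥-scalar (ι x ^ (q ℕ.^ k)) (Val≥-^ (q ℕ.^ k) (Val≥-mono (ℚ.p⊓q≤q ε 1ℚ) Val≥-ιx)) i j)
        (MVal≥-τ k (π 0) (MVal≥-mono (π 0) (ℚ.p⊓q≤p ε 1ℚ) π₀≥ε) i j)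

      -- Here γ is a valuation bound for the resolvent; the constant of the same name in the theorem
      -- corresponds to `e`.
      γ : ℚ
      γ = proj₁ (finite-lowerBound (vᴹ G))

      G≥γ : MVal≥ γ G
      G≥γ = vᴹ⇒MVal≥ G (proj₂ (finite-lowerBound (vᴹ G)))

      -- From this index on γ + qᵏ δ ≥ 1, as qᵏ ≥ k; so w ↦ G (w E) strictly raises valuations.
      K₀ : ℕ
      K₀ = proj₁ (archimedean 0<δ (1ℚ ℚ.- γ))

      -- For large k the perturbation w E is strictly smaller than G⁻¹ w, hence negligible.
      resolvent-bound : ∀ k → K₀ ℕ.≤ k → ∀ (w r : Mat m) {s} → w *ᴹ T^ k -ᴹ π 0 *ᴹ w ≈ᴹ r →
                        MVal≥ s r → MVal≥ (γ ℚ.+ s) w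
      resolvent-bound k K₀≤k w r {s} eq r≥s =
        cases (vᴹ w) ≡.refl
        where
        Qδ : ℚ
        Qδ = (q ℕ.^ k) · δ

        module Finite (t : ℚ) (vw : vᴹ w ≡ [ t ]) where

          w≥t : MVal≥ t w
          w≥t = vᴹ⇒MVal≥ w (≡.subst ([ t ] ≤⁺_) (≡.sym vw) [ ℚ.≤-refl ])

          improve : ∀ {p} → p ℚ.≤ s → p ℚ.≤ t ℚ.+ Qδ → MVal≥ (γ ℚ.+ p) w
          improve p≤s p≤t i j = Val≥-cong (sym (resolvent-equation k w r eq i j))
            (MVal≥-* G (w *ᴹ E^ k -ᴹ r) G≥γ (λ i j → Val≥-sub
              (Val≥-mono p≤t (MVal≥-* w (E^ k) w≥t (E≥ k) i j)) (Val≥-mono p≤s (r≥s i j))) i j)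

          t<γ+t+Qδ : t ℚ.< γ ℚ.+ (t ℚ.+ Qδ)
          t<γ+t+Qδ = begin-strict
            t                                   ≡⟨ solve 2 (λ t g → t := g :+ (t :+ (:- g))) ≡.refl t γ ⟩
            γ ℚ.+ (t ℚ.- γ)                     <⟨ ℚ.+-monoʳ-< γ (ℚ.+-monoʳ-< t (≡.subst (ℚ._< 1ℚ ℚ.- γ)
                                                     (ℚ.+-identityˡ (ℚ.- γ)) (ℚ.+-monoˡ-< (ℚ.- γ) (ℚ.positive⁻¹ 1ℚ)))) ⟩
            γ ℚ.+ (t ℚ.+ (1ℚ ℚ.- γ))            ≤⟨ ℚ.+-monoʳ-≤ γ (ℚ.+-monoʳ-≤ t
                                                     (proj₂ (archimedean 0<δ (1ℚ ℚ.- γ)) (q ℕ.^ k)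
                                                       (ℕ.≤-trans K₀≤k (ℕ.<⇒≤ (k<q^k k))))) ⟩
            γ ℚ.+ (t ℚ.+ Qδ)                    ∎
            where
            open ℚ.≤-Reasoning
            open +-*-Solver

          bound : s ℚ.≤ t ℚ.+ Qδ ⊎ t ℚ.+ Qδ ℚ.≤ s → MVal≥ (γ ℚ.+ s) w
          bound (inj₁ s≤) = improve ℚ.≤-refl s≤
          -- If w E were the dominant term, w would have valuation at least γ + t + qᵏ δ > t,
          -- although t is its exact valuation.
          bound (inj₂ ≤s) = contradiction
            (ℚ.<-≤-trans t<γ+t+Qδ ([≤]-injective (≡.subst ([ γ ℚ.+ (t ℚ.+ Qδ) ] ≤⁺_) vw (MVal≥⇒vᴹ w (improve ≤s ℚ.≤-refl)))))
            (ℚ.<-irrefl ≡.refl)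

        cases : ∀ v → vᴹ w ≡ v → MVal≥ (γ ℚ.+ s) w
        cases nothing  vw = vᴹ⇒MVal≥ w (≡.subst ([ _ ] ≤⁺_) (≡.sym vw) (_ ≤⊤⁺))
        cases (just t) vw = Finite.bound t vw (ℚ.≤-total s (t ℚ.+ Qδ))

      -- Below `K₀` the map w ↦ G (w E) need not contract; these finitely many coefficients are
      -- bounded one by one.
      initialBound : ∀ K → ∃[ D ] 0ℚ ℚ.≤ D × (∀ k → k ℕ.< K → MVal≥ (ℚ.- D) (w k))
      initialBound zero    = 0ℚ , ℚ.≤-refl , λ k ()
      initialBound (suc K) = D ℚ.⊔ (ℚ.- r) ,
        ℚ.≤-trans (proj₁ (proj₂ (initialBound K))) (ℚ.p≤p⊔q D (ℚ.- r)) , bound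
        where
        D r : ℚ
        D = proj₁ (initialBound K)
        r = proj₁ (finite-lowerBound (vᴹ (w K)))

        neg-neg : ∀ r → ℚ.- (ℚ.- r) ≡ r
        neg-neg r = solve 1 (λ r → :- (:- r) := r) ≡.refl r
          where open +-*-Solver

        bound : ∀ k → k ℕ.< suc K → MVal≥ (ℚ.- (D ℚ.⊔ (ℚ.- r))) (w k)
        bound k k<1+K = cases (ℕ.m<1+n⇒m<n∨m≡n k<1+K)
          where
          cases : k ℕ.< K ⊎ k ≡ K → MVal≥ (ℚ.- (D ℚ.⊔ (ℚ.- r))) (w k)
          cases (inj₁ k<K)    = MVal≥-mono (w k) (ℚ.neg-antimono-≤ (ℚ.p≤p⊔q D (ℚ.- r)))
            (proj₂ (proj₂ (initialBound K)) k k<K)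
          cases (inj₂ ≡.refl) = MVal≥-mono (w k) (≡.subst (ℚ.- (D ℚ.⊔ (ℚ.- r)) ℚ.≤_) (neg-neg r)
            (ℚ.neg-antimono-≤ (ℚ.p≤q⊔p D (ℚ.- r)))) (vᴹ⇒MVal≥ (w k) (proj₂ (finite-lowerBound (vᴹ (w k)))))

      -- Large enough for the coefficients below `K₀`, and for the loss γ + e that one step of the
      -- recursion incurs through the resolvent and some πⱼ.
      D : ℚ
      D = proj₁ (initialBound K₀) ℚ.⊔ (ℚ.- (γ ℚ.+ e))

      0≤D : 0ℚ ℚ.≤ D
      0≤D = ℚ.≤-trans (proj₁ (proj₂ (initialBound K₀))) (ℚ.p≤p⊔q _ _)

      -D≤γ+e : ℚ.- D ℚ.≤ γ ℚ.+ e
      -D≤γ+e = ≡.subst (ℚ.- D ℚ.≤_) (solve 1 (λ r → :- (:- r) := r) ≡.refl (γ ℚ.+ e))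
        (ℚ.neg-antimono-≤ (ℚ.p≤q⊔p (proj₁ (initialBound K₀)) (ℚ.- (γ ℚ.+ e))))
        where open +-*-Solver

      -- ∣wₖ∣ ≤ q^(D (qᵏ - 1)), so W converges for ∣s∣ < q^(- D).
      growth : ℕ → ℚ
      growth k = D ℚ.- (q ℕ.^ k) · D

      D+D≤q^·D : ∀ k → D ℚ.+ D ℚ.≤ (q ℕ.^ suc k) · D
      D+D≤q^·D k = ≡.subst (ℚ._≤ (q ℕ.^ suc k) · D) (≡.cong (D ℚ.+_) (ℚ.+-identityʳ D))
        (·-monoˡ-≤ {2} 0≤D (ℕ.≤-trans (ℕ.s≤s (ℕ.s≤s ℕ.z≤n)) (k<q^k (suc k))))

      -- The right side exceeds the left by (q^(l+1) - 1) D + γ + e. The first summand is at least D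
      -- because q ≥ 2, and D + γ + e ≥ 0 by the choice of `D`.
      growth-step : ∀ l k → l ℕ.≤ k →
                    growth (suc k) ℚ.≤ γ ℚ.+ (e ℚ.+ (q ℕ.^ suc l) · growth (k ℕ.∸ l))
      growth-step l k l≤k = begin
        D ℚ.- Qk                                    ≡⟨ solve 2 (λ d x → d :- x := (:- d) :+ ((d :+ d) :- x)) ≡.refl D Qk ⟩
        ℚ.- D ℚ.+ (D ℚ.+ D ℚ.- Qk)                  ≤⟨ ℚ.+-mono-≤ -D≤γ+e (ℚ.+-monoˡ-≤ (ℚ.- Qk) (D+D≤q^·D l)) ⟩
        γ ℚ.+ e ℚ.+ ((q ℕ.^ suc l) · D ℚ.- Qk)      ≡⟨ ℚ.+-assoc γ e _ ⟩
        γ ℚ.+ (e ℚ.+ ((q ℕ.^ suc l) · D ℚ.- Qk))    ≡⟨ ≡.cong (λ y → γ ℚ.+ (e ℚ.+ ((q ℕ.^ suc l) · D ℚ.- y))) Qk≡ ⟩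
        γ ℚ.+ (e ℚ.+ ((q ℕ.^ suc l) · D ℚ.- (q ℕ.^ suc l) · ((q ℕ.^ (k ℕ.∸ l)) · D)))
                                                    ≡⟨ ≡.cong (λ y → γ ℚ.+ (e ℚ.+ y)) (·-distrib-sub (q ℕ.^ suc l) D _) ⟨
        γ ℚ.+ (e ℚ.+ (q ℕ.^ suc l) · growth (k ℕ.∸ l)) ∎
        where
        open ℚ.≤-Reasoning
        open +-*-Solver
        Qk : ℚ
        Qk = (q ℕ.^ suc k) · D
        Qk≡ : Qk ≡ (q ℕ.^ suc l) · ((q ℕ.^ (k ℕ.∸ l)) · D)
        Qk≡ = ≡.trans (≡.cong (_· D) (≡.trans
          (≡.cong (λ y → q ℕ.^ suc y) (≡.sym (ℕ.m+[n∸m]≡n l≤k))) (ℕ.^-distribˡ-+-* q (suc l) (k ℕ.∸ l))))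
          (≡.sym (×-assocˡ D (q ℕ.^ suc l) (q ℕ.^ (k ℕ.∸ l))))

      w-growth : ∀ k → MVal≥ (growth k) (w k)
      w-growth k = below (suc k) k (ℕ.n<1+n k)
        where
        -- Strong induction on k, made structural by the bound n. It starts from `growth 0`, which
        -- is 0, the valuation bound of I.
        below : ∀ n k → k ℕ.< n → MVal≥ (growth k) (w k)
        below n zero    _ = MVal≥-mono Iᴹ
          (ℚ.≤-reflexive (≡.trans (≡.cong (λ y → D ℚ.- y) (ℚ.+-identityʳ D)) (ℚ.+-inverseʳ D))) MVal≥-Iᴹ
        below (suc n) (suc k) (ℕ.s≤s k<n) = cases (suc k ℕ.<? K₀)
          where
          open +-*-Solver
          D₀ : ℚ
          D₀ = proj₁ (initialBound K₀)

          -- For positive indices `growth` is at most -D, so the individual bounds below `K₀`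
          -- already imply the uniform one.
          growth≤ : growth (suc k) ℚ.≤ ℚ.- D₀
          growth≤ = begin
            D ℚ.- (q ℕ.^ suc k) · D     ≤⟨ ℚ.+-monoʳ-≤ D (ℚ.neg-antimono-≤ (D+D≤q^·D k)) ⟩
            D ℚ.- (D ℚ.+ D)             ≡⟨ solve 1 (λ d → d :- (d :+ d) := :- d) ≡.refl D ⟩
            ℚ.- D                       ≤⟨ ℚ.neg-antimono-≤ (ℚ.p≤p⊔q D₀ _) ⟩
            ℚ.- D₀                      ∎
            where open ℚ.≤-Reasoning

          term≤ : ∀ l → l ℕ.≤ k → growth (suc k) ℚ.- γ ℚ.≤ e ℚ.+ (q ℕ.^ suc l) · growth (k ℕ.∸ l)
          term≤ l l≤k = ≡.subst (growth (suc k) ℚ.- γ ℚ.≤_)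
            (solve 2 (λ g y → g :+ y :- g := y) ≡.refl γ _)
            (ℚ.+-monoˡ-≤ (ℚ.- γ) (growth-step l k l≤k))

          term≥ : ∀ l → l ℕ.≤ k →
                  MVal≥ (growth (suc k) ℚ.- γ) (π (suc l) *ᴹ τ^ (suc l) (w (k ℕ.∸ l)))
          term≥ l l≤k = MVal≥-mono (π (suc l) *ᴹ τ^ (suc l) (w (k ℕ.∸ l))) (term≤ l l≤k)
            (MVal≥-* (π (suc l)) (τ^ (suc l) (w (k ℕ.∸ l))) (π≥e (suc l))
              (MVal≥-τ (suc l) (w (k ℕ.∸ l)) (below n (k ℕ.∸ l) (ℕ.≤-<-trans (ℕ.m∸n≤m k l) k<n))))

          cases : Dec (suc k ℕ.< K₀) → MVal≥ (growth (suc k)) (w (suc k))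
          cases (yes k<K₀) = MVal≥-mono (w (suc k)) growth≤
            (proj₂ (proj₂ (initialBound K₀)) (suc k) k<K₀)
          cases (no k≮K₀)  = ≡.subst (λ y → MVal≥ y (w (suc k)))
            (solve 2 (λ g y → g :+ (y :- g) := y) ≡.refl γ (growth (suc k)))
            (resolvent-bound (suc k) (ℕ.≮⇒≥ k≮K₀) (w (suc k)) _ (recurrence k) λ i j →
              Val≥-sum {n = suc k} _ λ l → term≥ (toℕ l) (ℕ.≤-pred (Fin.toℕ<n l)) i j)

      -- The part qᵏ D of the valuation of τᵏ(s) cancels the growth of wₖ; the margin η is what
      -- drives the terms to 0.
      term-bound : ∀ {η} s → MVal≥ (D ℚ.+ η) s → ∀ k →
                   MVal≥ (D ℚ.+ (q ℕ.^ k) · η) (powerTerms w s k)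
      term-bound {η} s s≥ k = ≡.subst (λ y → MVal≥ y (powerTerms w s k)) bound≡
        (MVal≥-* (w k) (τ^ k s) (w-growth k) (MVal≥-τ k s s≥))
        where
        open +-*-Solver
        bound≡ : growth k ℚ.+ (q ℕ.^ k) · (D ℚ.+ η) ≡ D ℚ.+ (q ℕ.^ k) · η
        bound≡ = ≡.trans (≡.cong (growth k ℚ.+_) (×-distrib-+ D η (q ℕ.^ k)))
          (solve 3 (λ d x y → d :- x :+ (x :+ y) := d :+ y) ≡.refl D _ _)

      tail-bound : ∀ {η} → 0ℚ ℚ.≤ η → ∀ s → MVal≥ (D ℚ.+ η) s → ∀ N →
                   Small (powerTerms w s) N (D ℚ.+ (q ℕ.^ N) · η)
      tail-bound 0≤η s s≥ N k N≤k = MVal≥-mono (powerTerms w s k)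
        (ℚ.+-monoʳ-≤ D (·-monoˡ-≤ 0≤η (ℕ.^-monoʳ-≤ q {{q-nonZero}} N≤k))) (term-bound s s≥ k)
        where
        q-nonZero : ℕ.NonZero q
        q-nonZero = ℕ.>-nonZero (ℕ.≤-trans (ℕ.s≤s ℕ.z≤n) 2≤q)

      vanishing : ∀ {η} → 0ℚ ℚ.< η → ∀ s → MVal≥ (D ℚ.+ η) s → Vanishing (powerTerms w s)
      vanishing {η} 0<η s s≥ r = N , λ k N≤k → MVal≥-mono (powerTerms w s k) (r≤ k N≤k) (term-bound s s≥ k)
        where
        N : ℕ
        N = proj₁ (archimedean 0<η r)
        r≤ : ∀ k → N ℕ.≤ k → r ℚ.≤ D ℚ.+ (q ℕ.^ k) · η
        r≤ k N≤k = ℚ.≤-trans (proj₂ (archimedean 0<η r) (q ℕ.^ k) (ℕ.≤-trans N≤k (ℕ.<⇒≤ (k<q^k k))))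
          (≡.subst (ℚ._≤ D ℚ.+ (q ℕ.^ k) · η) (ℚ.+-identityˡ _) (ℚ.+-monoˡ-≤ _ 0≤D))

      positiveRadius : Z.PositiveRadius w
      positiveRadius = D , λ s D<s → sumAt s (<⁺⇒+≤⁺ D<s)
        where
        sumAt : ∀ s → ∃[ η ] 0ℚ ℚ.< η × [ D ℚ.+ η ] ≤⁺ vᴹ s → ∃[ S ] SumsTo (powerTerms w s) S
        sumAt s (η , 0<η , D+η≤s) = proj₁ limitAt ,
          tails⇒sumsTo {powerTerms w s} {proj₁ limitAt} small (proj₂ limitAt)
          where
          small : Vanishing (powerTerms w s)
          small = vanishing 0<η s (vᴹ⇒MVal≥ s D+η≤s)
          limitAt : ∃[ S ] HasTails (powerTerms w s) S
          limitAt = series (powerTerms w s) small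

  -- The function W(g(t)) and the equation it satisfies.

  module Solution {m : ℕ} (π : ℕ → Z.Mat m)
    (λs : Vector Z.Carrier m) (spectrum : Z.IsSpectrum (π 0) λs)
    (nonresonant : ∀ i j k → 1 ℕ.≤ k → ¬ (λs i Z.- λs j Z.^ (q ℕ.^ k) Z.≈ Z.⟦ k ⟧))
    (e : ℚ) (π≥e : ∀ k → [ e ] ≤⁺ Z.vᴹ (π k)) (π₀<1 : [ 0ℚ ] <⁺ Z.vᴹ (π 0))
    (g : Z.O ⟶ₛ Z.MatSetoid {m}) (continuous : Z.IsContinuous g) (linear : Z.IsFqLinear g)
    (equation : ∀ t → Z.Δ g t Z.≈ᴹ π 0 Z.*ᴹ (g ⟨$⟩ t)) where

    open Z using (τ^; vᴹ; partialSum; SumsTo; powerTerms; Δ; Disc; O; toO; x·_; _+ᵈ_; MatSetoid;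
                  IsCarlitzDerivative; IsSolution; constant; vanishes; coeff)
    open CompletedAlgebraicClosure C hiding (zero)
    open Valuation C
    open Exp commutativeSemiring using (_^_; ^-congˡ)
    open MatrixSeries q pp F C {m}
    open MatrixRing commutativeRing
    open Coefficients π λs spectrum nonresonant
    open Frobenius commutativeRing
    open SemiringSum semiring
    open RingProperties ring
    open LaurentSeries (FiniteField.field′ F) using (x)
    open Shift (FiniteField.field′ F) using (x*-cong)
    open SetoidReasoning setoid
    private
      module K = Field (FiniteField.field′ F)

    improvedBound : ∃[ ε ] 0ℚ ℚ.< ε × [ 0ℚ ℚ.+ ε ] ≤⁺ vᴹ (π 0)
    improvedBound = <⁺⇒+≤⁺ π₀<1

    open Bounds e (λ k → vᴹ⇒MVal≥ (π k) (π≥e k)) (proj₁ improvedBound) (proj₁ (proj₂ improvedBound))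
      (vᴹ⇒MVal≥ (π 0) (≡.subst (λ r → [ r ] ≤⁺ vᴹ (π 0)) (ℚ.+-identityˡ _) (proj₂ (proj₂ improvedBound))))
      public

    0≤1 : 0ℚ ℚ.≤ 1ℚ
    0≤1 = ℚ.<⇒≤ (ℚ.positive⁻¹ 1ℚ)

    origin : Setoid.Carrier O
    origin = constant K.0# , vanishes (constant K.0#)

    constant-0 : ∀ j → coeff (constant K.0#) j K.≈ K.0#
    constant-0 j with j ℤ.≟ + 0
    ... | yes _ = K.refl
    ... | no  _ = K.refl

    g-origin : g ⟨$⟩ origin ≈ᴹ 0ᴹ
    g-origin i j = x+x≈x⇒x≈0 _ (trans (sym (Z.IsFqLinear.+-homo linear origin origin i j))
      (Func.cong g {origin +ᵈ origin} {origin}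
        (λ k → K.trans (K.+-congʳ (constant-0 k)) (K.+-identityˡ _)) i j))

    -- Since g vanishes at the origin, continuity there puts g(t) inside the disc of convergence,
    -- with margin η = 1, as soon as ∣t∣ ≤ q^(- radius).
    radius : ℕ
    radius = proj₁ (continuous origin (D ℚ.+ 1ℚ))

    Domain : Set _
    Domain = Setoid.Carrier (Disc radius)

    s : Domain → Mat m
    s t = g ⟨$⟩ toO t

    s-bound : ∀ t → MVal≥ (D ℚ.+ 1ℚ) (s t)
    s-bound t@(t₁ , t₀) i j = Val≥-cong
      (trans (+-congˡ (trans (-‿cong (g-origin i j)) -0#≈0#)) (+-identityʳ _))
      (vᴹ⇒MVal≥ (s t -ᴹ (g ⟨$⟩ origin)) (proj₂ (continuous origin (D ℚ.+ 1ℚ)) (toO t) near) i j)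
      where
      near : ∀ k → k ℤ.< + radius → coeff t₁ k K.+ K.- coeff (constant K.0#) k K.≈ K.0#
      near k k< = K.trans (K.+-cong (t₀ k k<) (K.-‿cong (constant-0 k))) (K.-‿inverseʳ K.0#)

    s-equation : ∀ t → s (x· t) ≈ᴹ ι x ·ᴹ s t +ᴹ π 0 *ᴹ s t
    s-equation t i j = begin
      s (x· t) i j                          ≈⟨ +-identityʳ _ ⟨
      s (x· t) i j + 0#                     ≈⟨ +-congˡ (-‿inverseˡ X) ⟨
      s (x· t) i j + (- X + X)              ≈⟨ +-assoc _ _ _ ⟨
      s (x· t) i j - X + X                  ≈⟨ +-congʳ (+-congʳ (Func.cong g {toO (x· t)} {x· toO t} (λ k → K.refl) i j)) ⟩
      Δ g (toO t) i j + X                   ≈⟨ +-comm _ _ ⟩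
      X + Δ g (toO t) i j                   ≈⟨ +-congˡ (equation (toO t) i j) ⟩
      X + (π 0 *ᴹ s t) i j                  ∎
      where
      X : Carrier
      X = ι x * s t i j

    terms : Domain → ℕ → Mat m
    terms t = powerTerms w (s t)

    terms-vanishing : ∀ t → Vanishing (terms t)
    terms-vanishing t = vanishing (ℚ.positive⁻¹ 1ℚ) (s t) (s-bound t)

    W : Domain → Mat m
    W t = proj₁ (series (terms t) (terms-vanishing t))

    W-tails : ∀ t → HasTails (terms t) (W t)
    W-tails t = proj₂ (series (terms t) (terms-vanishing t))

    W-sumsTo : ∀ t → SumsTo (terms t) (W t)
    W-sumsTo t = tails⇒sumsTo {terms t} {W t} (terms-vanishing t) (W-tails t)

    u : Disc radius ⟶ₛ MatSetoid {m}
    u = record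
      { to   = W
      ; cong = λ {t} {t′} t≈t′ → sumsTo-unique {terms t} {terms t′} {W t} {W t′}
          (powerTerms-cong w {s t} {s t′} (Func.cong g {toO t} {toO t′} t≈t′)) (W-sumsTo t) (W-sumsTo t′)
      }

    remainder : ∀ t n → MVal≥ (D ℚ.+ (q ℕ.^ n) · 1ℚ) (partialSum (terms t) n -ᴹ W t)
    remainder t n = W-tails t n _ (tail-bound 0≤1 (s t) (s-bound t) n) n ℕ.≤-refl

    images : Domain → ℕ → Mat m
    images t k = w k *ᴹ T^ k *ᴹ τ^ k (s t)

    -- Raising g(xt) = x g(t) + π₀ g(t) to the power qᵏ turns τᵏ(g) at xt into `E^ k` times τᵏ(g) at
    -- t; subtracting x leaves `T^ k`. So `images` lists what Δ makes of the single terms of u.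
    terms-x· : ∀ t k → terms (x· t) k -ᴹ ι x ·ᴹ terms t k ≈ᴹ images t k
    terms-x· t k = MM.begin
      w k *ᴹ τ^ k (s (x· t)) -ᴹ ι x ·ᴹ (w k *ᴹ σ)
        MM.≈⟨ M.+-cong {w k *ᴹ τ^ k (s (x· t))} (M.*-congˡ {w k} τ-step)
             (M.-‿cong (M.trans {ι x ·ᴹ (w k *ᴹ σ)} (M.sym (*ᴹ-·ᴹ-comm (ι x) (w k) σ))
               (M.*-congˡ {w k} (M.sym (scalar-*ᴹ (ι x) σ))))) ⟩
      w k *ᴹ (E^ k *ᴹ σ) -ᴹ w k *ᴹ (scalar (ι x) *ᴹ σ)
        MM.≈⟨ MR.x[y-z]≈xy-xz (w k) (E^ k *ᴹ σ) (scalar (ι x) *ᴹ σ) ⟨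
      w k *ᴹ (E^ k *ᴹ σ -ᴹ scalar (ι x) *ᴹ σ)
        MM.≈⟨ M.*-congˡ {w k} (MR.[y-z]x≈yx-zx σ (E^ k) (scalar (ι x))) ⟨
      w k *ᴹ ((E^ k -ᴹ scalar (ι x)) *ᴹ σ)
        MM.≈⟨ M.*-congˡ {w k} (M.*-congʳ {σ} (T^≈ k)) ⟨
      w k *ᴹ (T^ k *ᴹ σ)
        MM.≈⟨ *ᴹ-assoc (w k) (T^ k) σ ⟨
      images t k MM.∎
      where
      module MM = SetoidReasoning M.setoid
      σ : Mat m
      σ = τ^ k (s t)
      τ-step : τ^ k (s (x· t)) ≈ᴹ E^ k *ᴹ σ
      τ-step i j = begin
        s (x· t) i j ^ (q ℕ.^ k)
          ≈⟨ ^-congˡ (q ℕ.^ k) (s-equation t i j) ⟩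
        (ι x * s t i j + (π 0 *ᴹ s t) i j) ^ (q ℕ.^ k)
          ≈⟨ q^-additive k _ _ ⟩
        (ι x * s t i j) ^ (q ℕ.^ k) + τ^ k (π 0 *ᴹ s t) i j
          ≈⟨ +-cong (IsOperationHomo.*-homo (q^-isHomo k) _ _) (Frobeniusᴹ.map-*ᴹ k (π 0) (s t) i j) ⟩
        ι x ^ (q ℕ.^ k) * σ i j + (τ^ k (π 0) *ᴹ σ) i j
          ≈⟨ +-congʳ (scalar-*ᴹ _ σ i j) ⟨
        (scalar (ι x ^ (q ℕ.^ k)) *ᴹ σ) i j + (τ^ k (π 0) *ᴹ σ) i j
          ≈⟨ M.distribʳ σ (scalar (ι x ^ (q ℕ.^ k))) (τ^ k (π 0)) i j ⟨
        (E^ k *ᴹ σ) i j ∎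

    partialSum-images : ∀ t n → partialSum (terms (x· t)) n -ᴹ ι x ·ᴹ partialSum (terms t) n ≈ᴹ
                                partialSum (images t) n
    partialSum-images t n i j = begin
      partialSum (terms (x· t)) n i j - ι x * partialSum (terms t) n i j
        ≈⟨ +-congˡ (-‿cong (*-distribˡ-sum {n} (ι x) _)) ⟩
      sum {n} (λ k → terms (x· t) (toℕ k) i j) - sum {n} (λ k → ι x * terms t (toℕ k) i j)
        ≈⟨ +-congˡ (sum-neg {n} _) ⟨
      sum {n} (λ k → terms (x· t) (toℕ k) i j) + sum {n} (λ k → - (ι x * terms t (toℕ k) i j))
        ≈⟨ ∑-distrib-+ {n} _ _ ⟨
      sum {n} (λ k → terms (x· t) (toℕ k) i j - ι x * terms t (toℕ k) i j)
        ≈⟨ sum-cong-≋ {n} (λ k → terms-x· t (toℕ k) i j) ⟩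
      partialSum (images t) n i j ∎

    -- Δ combines the remainders of u at xt and at t; the factor x only improves the second one.
    Δu-remainder : ∀ t n → MVal≥ (D ℚ.+ (q ℕ.^ n) · 1ℚ) (partialSum (images t) n -ᴹ Δ u t)
    Δu-remainder t n i j = Val≥-cong regroup (Val≥-sub (remainder (x· t) n i j)
      (Val≥-mono weaken (Val≥-* Val≥-ιx (remainder t n i j))))
      where
      r : ℚ
      r = D ℚ.+ (q ℕ.^ n) · 1ℚ
      weaken : r ℚ.≤ 1ℚ ℚ.+ r
      weaken = ≡.subst (ℚ._≤ 1ℚ ℚ.+ r) (ℚ.+-identityˡ r) (ℚ.+-monoˡ-≤ r 0≤1)
      open CommutativeSemigroupProperties +-commutativeSemigroup using (interchange)
      regroup : (partialSum (terms (x· t)) n i j - W (x· t) i j) - ι x * (partialSum (terms t) n i j - W t i j)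
                ≈ partialSum (images t) n i j - Δ u t i j
      regroup = begin
        (p′ - u′) - ι x * (p - u₀)                ≈⟨ +-congˡ (-‿cong (x[y-z]≈xy-xz _ _ _)) ⟩
        (p′ - u′) - (ι x * p - ι x * u₀)          ≈⟨ +-congˡ (-‿+-comm _ _) ⟨
        (p′ - u′) + (- (ι x * p) - - (ι x * u₀))  ≈⟨ interchange _ _ _ _ ⟩
        (p′ - ι x * p) + (- u′ - - (ι x * u₀))    ≈⟨ +-cong (partialSum-images t n i j) (-‿+-comm _ _) ⟩
        partialSum (images t) n i j - (u′ - ι x * u₀) ∎
        where
        p′ p u′ u₀ : Carrier
        p′ = partialSum (terms (x· t)) n i j
        p  = partialSum (terms t) n i j
        u′ = W (x· t) i j
        u₀ = W t i j

    -- τᵏ = τʲ τ^(k-j) and τʲ is multiplicative, so τʲ(w_(k-j)) τᵏ(g) is τʲ of the term of u with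
    -- index k - j.
    images≈ : ∀ t k → images t k ≈ᴹ
              partialSum (λ j → π j *ᴹ τ^ j (terms t (k ℕ.∸ j))) (suc k)
    images≈ t k i l = begin
      images t k i l
        ≈⟨ M.*-congʳ {σ} (w-convolution k) i l ⟩
      (partialSum (λ j → π j *ᴹ τ^ j (w (k ℕ.∸ j))) (suc k) *ᴹ σ) i l
        ≈⟨ partialSum-*ᴹ σ (λ j → π j *ᴹ τ^ j (w (k ℕ.∸ j))) (suc k) i l ⟩
      partialSum (λ j → π j *ᴹ τ^ j (w (k ℕ.∸ j)) *ᴹ σ) (suc k) i l
        ≈⟨ sum-cong {suc k} _ _ (λ j → term (toℕ j) (ℕ.≤-pred (Fin.toℕ<n j)) i l) ⟩
      partialSum (λ j → π j *ᴹ τ^ j (terms t (k ℕ.∸ j))) (suc k) i l ∎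
      where
      σ : Mat m
      σ = τ^ k (s t)
      term : ∀ j → j ℕ.≤ k → π j *ᴹ τ^ j (w (k ℕ.∸ j)) *ᴹ σ ≈ᴹ π j *ᴹ τ^ j (terms t (k ℕ.∸ j))
      term j j≤k = M.trans {π j *ᴹ τ^ j (w (k ℕ.∸ j)) *ᴹ σ}
        (*ᴹ-assoc (π j) (τ^ j (w (k ℕ.∸ j))) σ) (M.*-congˡ {π j} (M.trans
          (M.*-congˡ {τ^ j (w (k ℕ.∸ j))} (M.trans
            (M.reflexive (≡.cong (λ y → τ^ y (s t)) (≡.sym (ℕ.m+[n∸m]≡n j≤k))))
            (M.sym (τ-τ j (k ℕ.∸ j) (s t)))))
          (M.sym (Frobeniusᴹ.map-*ᴹ j (w (k ℕ.∸ j)) (τ^ (k ℕ.∸ j) (s t))))))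

    -- The terms with j + l < n are regrouped by j, and the additivity of τʲ collects each group
    -- into one truncation of u.
    partialSum-images≈ : ∀ t n → partialSum (images t) n ≈ᴹ
      partialSum (λ j → π j *ᴹ τ^ j (partialSum (terms t) (n ℕ.∸ j))) n
    partialSum-images≈ t n i l = begin
      partialSum (images t) n i l
        ≈⟨ sum-cong-≋ {n} (λ k → images≈ t (toℕ k) i l) ⟩
      sum {n} (λ k → sum {suc (toℕ k)} λ j → f (toℕ j) (toℕ k ℕ.∸ toℕ j))
        ≈⟨ TriangularSum.triangular commutativeRing n f ⟩
      sum {n} (λ j → sum {n ℕ.∸ toℕ j} λ k → f (toℕ j) (toℕ k))
        ≈⟨ sum-cong-≋ {n} (λ j → linearity (toℕ j)) ⟨
      partialSum (λ j → π j *ᴹ τ^ j (partialSum (terms t) (n ℕ.∸ j))) n i l ∎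
      where
      f : ℕ → ℕ → Carrier
      f j k = (π j *ᴹ τ^ j (terms t k)) i l
      linearity : ∀ j → (π j *ᴹ τ^ j (partialSum (terms t) (n ℕ.∸ j))) i l ≈ partial (f j) (n ℕ.∸ j)
      linearity j = trans (M.*-congˡ {π j} (τ-partialSum j (terms t) (n ℕ.∸ j)) i l)
        (*ᴹ-partialSum (π j) (λ k → τ^ j (terms t k)) (n ℕ.∸ j) i l)

    -- Truncating u at n - j leaves a remainder of valuation at least D + q^(n-j) ≥ q^(n-j), which
    -- τʲ raises to at least qⁿ. The bound is thus the same for all j, and multiplying by πⱼ changes
    -- it by `e` only.
    πu-remainder : ∀ t n → MVal≥ (e ℚ.+ (q ℕ.^ n) · 1ℚ)
      (partialSum (images t) n -ᴹ partialSum (powerTerms π (W t)) n)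
    πu-remainder t n i l = Val≥-cong (sym regroup) (Val≥-sum {n = n} _ λ j →
      Val≥-mono (bound (toℕ j) (ℕ.<⇒≤ (Fin.toℕ<n j)))
        (MVal≥-* (π (toℕ j)) (τ^ (toℕ j) (R (toℕ j))) (vᴹ⇒MVal≥ (π (toℕ j)) (π≥e (toℕ j)))
          (MVal≥-τ (toℕ j) (R (toℕ j)) (remainder t (n ℕ.∸ toℕ j))) i l))
      where
      R : ℕ → Mat m
      R j = partialSum (terms t) (n ℕ.∸ j) -ᴹ W t
      bound : ∀ j → j ℕ.≤ n →
              e ℚ.+ (q ℕ.^ n) · 1ℚ ℚ.≤ e ℚ.+ (q ℕ.^ j) · (D ℚ.+ (q ℕ.^ (n ℕ.∸ j)) · 1ℚ)
      bound j j≤n = ℚ.+-monoʳ-≤ e (≡.subst (ℚ._≤ (q ℕ.^ j) · (D ℚ.+ (q ℕ.^ (n ℕ.∸ j)) · 1ℚ)) power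
        (·-monoʳ-≤ (q ℕ.^ j) (≡.subst (ℚ._≤ D ℚ.+ (q ℕ.^ (n ℕ.∸ j)) · 1ℚ) (ℚ.+-identityˡ _)
          (ℚ.+-monoˡ-≤ ((q ℕ.^ (n ℕ.∸ j)) · 1ℚ) 0≤D))))
        where
        power : (q ℕ.^ j) · ((q ℕ.^ (n ℕ.∸ j)) · 1ℚ) ≡ (q ℕ.^ n) · 1ℚ
        power = ≡.trans (×-assocˡ 1ℚ (q ℕ.^ j) (q ℕ.^ (n ℕ.∸ j))) (≡.cong (_· 1ℚ)
          (≡.trans (≡.sym (ℕ.^-distribˡ-+-* q j (n ℕ.∸ j))) (≡.cong (q ℕ.^_) (ℕ.m+[n∸m]≡n j≤n))))
      P Q : ℕ → Carrier
      P j = (π j *ᴹ τ^ j (partialSum (terms t) (n ℕ.∸ j))) i l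
      Q j = (π j *ᴹ τ^ j (W t)) i l
      summand : ∀ j → P j - Q j ≈ (π j *ᴹ τ^ j (R j)) i l
      summand j = sym (trans
        (M.*-congˡ {π j} (λ a c → ^-difference {q ℕ.^ j} (q^-additive j)
          (partialSum (terms t) (n ℕ.∸ j) a c) (W t a c)) i l)
        (MR.x[y-z]≈xy-xz (π j) (τ^ j (partialSum (terms t) (n ℕ.∸ j))) (τ^ j (W t)) i l))
      regroup : partialSum (images t) n i l - partial Q n ≈ sum {n} (λ j → (π (toℕ j) *ᴹ τ^ (toℕ j) (R (toℕ j))) i l)
      regroup = begin
        partialSum (images t) n i l - partial Q n
          ≈⟨ +-cong (partialSum-images≈ t n i l) (sym (sum-neg {n} _)) ⟩
        sum {n} (λ j → P (toℕ j)) + sum {n} (λ j → - Q (toℕ j))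
          ≈⟨ ∑-distrib-+ {n} _ _ ⟨
        sum {n} (λ j → P (toℕ j) - Q (toℕ j))
          ≈⟨ sum-cong-≋ {n} (λ j → summand (toℕ j)) ⟩
        sum {n} (λ j → (π (toℕ j) *ᴹ τ^ (toℕ j) (R (toℕ j))) i l) ∎

    -- The partial sums of `images` are close both to those of P(τ)u and to Δu.
    πu-sumsTo-Δu : ∀ t → SumsTo (powerTerms π (W t)) (Δ u t)
    πu-sumsTo-Δu t r = N , λ n N≤n → MVal≥⇒vᴹ (partialSum (powerTerms π (W t)) n -ᴹ Δ u t) λ i j →
      Val≥-cong (telescope _ _ _) (Val≥-+
        (Val≥-swap _ _ (Val≥-mono (large n N≤n (ℚ.p⊓q≤p e D)) (πu-remainder t n i j)))
        (Val≥-mono (large n N≤n (ℚ.p⊓q≤q e D)) (Δu-remainder t n i j)))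
      where
      o : ℚ
      o = e ℚ.⊓ D
      N : ℕ
      N = proj₁ (archimedean (ℚ.positive⁻¹ 1ℚ) (r ℚ.- o))
      large : ∀ n → N ℕ.≤ n → ∀ {y} → o ℚ.≤ y → r ℚ.≤ y ℚ.+ (q ℕ.^ n) · 1ℚ
      large n N≤n {y} o≤y = ≡.subst (ℚ._≤ y ℚ.+ (q ℕ.^ n) · 1ℚ)
        (solve 2 (λ o r → o :+ (r :- o) := r) ≡.refl o r)
        (ℚ.+-mono-≤ o≤y (proj₂ (archimedean (ℚ.positive⁻¹ 1ℚ) (r ℚ.- o)) (q ℕ.^ n)
          (ℕ.≤-trans N≤n (ℕ.<⇒≤ (k<q^k n)))))
        where open +-*-Solver

    rootq : ∀ y → ∃[ z ] z ^ (q ℕ.^ 1) ≈ y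
    rootq = root′ (q ℕ.^ 1) (k<q^k 1) (q^-additive 1)
      where
      root′ : ∀ n → 1 ℕ.< n → Additive n → ∀ y → ∃[ z ] z ^ n ≈ y
      root′ (suc n) _ = root n

    du : Disc radius ⟶ₛ MatSetoid {m}
    du = record
      { to   = λ t i j → proj₁ (rootq (Δ u t i j))
      -- Roots are chosen separately for each representative of t; they agree because the additive
      -- q-th power map has trivial kernel.
      ; cong = λ {t} {t′} t≈t′ i j → x∙y⁻¹≈ε⇒x≈y _ _ (^≈0⇒≈0 _ (q ℕ.^ 1) (begin
          (proj₁ (rootq (Δ u t i j)) - proj₁ (rootq (Δ u t′ i j))) ^ (q ℕ.^ 1)
            ≈⟨ ^-difference {q ℕ.^ 1} (q^-additive 1) _ _ ⟩
          proj₁ (rootq (Δ u t i j)) ^ (q ℕ.^ 1) - proj₁ (rootq (Δ u t′ i j)) ^ (q ℕ.^ 1)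
            ≈⟨ +-cong (proj₂ (rootq _)) (-‿cong (proj₂ (rootq _))) ⟩
          Δ u t i j - Δ u t′ i j
            ≈⟨ x≈y⇒x∙y⁻¹≈ε (Δ-cong {t} {t′} t≈t′ i j) ⟩
          0# ∎))
      }
      where
      Δ-cong : ∀ {t t′} → Setoid._≈_ (Disc radius) t t′ → Δ u t ≈ᴹ Δ u t′
      Δ-cong {t} {t′} t≈t′ i j = +-cong (Func.cong u {x· t} {x· t′} (x*-cong (proj₁ t) (proj₁ t′) t≈t′) i j)
        (-‿cong (*-congˡ (Func.cong u {t} {t′} t≈t′ i j)))

    du-isCarlitzDerivative : IsCarlitzDerivative {m} {radius} u du
    du-isCarlitzDerivative t i j = proj₂ (rootq (Δ u t i j))

    isSolution : IsSolution {m} {radius} π u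
    isSolution = du , du-isCarlitzDerivative , λ t →
      sumsTo-cong {powerTerms π (W t)} {Δ u t} {τ^ 1 (du ⟨$⟩ t)}
        (λ i j → sym (du-isCarlitzDerivative t i j)) (πu-sumsTo-Δu t)

open import Data.Nat.Base using (_≤_; _^_)

theorem2 : ∀ {c ℓ a b} (q : ℕ) → IsPrimePower q →
    (F : FiniteField q c ℓ) (C : CompletedAlgebraicClosure (FiniteField.field′ F) a b) →
    let module Z = Carlitz F C in
    (m : ℕ) → 1 ≤ m →
    (π : ℕ → Z.Mat m) →
    -- the bound γ on ∣πₖ∣ is q^(- e)
    (e : ℚ) → (∀ k → [ e ] ≤⁺ Z.vᴹ (π k)) →
    [ 0ℚ ] <⁺ Z.vᴹ (π 0) →
    (g : Z.O ⟶ₛ Z.MatSetoid {m}) → Z.IsContinuous g → Z.IsFqLinear g →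
    (∀ t → Z.Δ g t Z.≈ᴹ π 0 Z.*ᴹ (g ⟨$⟩ t)) →
    (λs : Vector Z.Carrier m) → Z.IsSpectrum (π 0) λs →
    (∀ i j k → 1 ≤ k → ¬ (λs i Z.- λs j Z.^ (q ^ k) Z.≈ Z.⟦ k ⟧)) →
    ∃[ w ] (w 0 Z.≈ᴹ Z.Iᴹ {m}) × Z.PositiveRadius w ×
      ∃[ n ] ∃[ u ] Z.IsSolution {m} {n} π u ×
        (∀ t → Z.SumsTo (Z.powerTerms w (g ⟨$⟩ Z.toO t)) (u ⟨$⟩ t))
theorem2 q pp F C m _ π e π≥e π₀<1 g continuous linear equation λs spectrum nonresonant =
  w , (λ i j → CompletedAlgebraicClosure.refl C) , positiveRadius , radius , u , isSolution , W-sumsTo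
  where
  open CarlitzEquation q pp F C
  open Coefficients π λs spectrum nonresonant using (w)
  open Solution π λs spectrum nonresonant e π≥e π₀<1 g continuous linear equation
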